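{- Let $0<\epsilon<2$ and let $f\colon \mathbb{F}_2^n\to\mathbb{F}_2$ have algebraic thickness $\mathcal{T}(f)=n^{3-\epsilon}$. Then there exists a flat $E\subseteq\mathbb{F}_2^n$ of dimension at least $$\frac{4}{15}\sqrt{\frac{2}{3}n^{\epsilon}}-3$$ such that $f$ restricted to $E$ is constant. Furthermore, such a flat can be found efficiently: there is an algorithm which, given a representation $(g,A)$ of $f$ (where $A$ is an affine bijection of $\mathbb{F}_2^n$, $g=f\circ A$, $\|g\|=\mathcal{T}(f)$, and $g$ is given by its algebraic normal form), outputs such a flat in time polynomial in the size of the input.
   Context: Every $f\colon\mathbb{F}_2^n\to\mathbb{F}_2$ is uniquely a multilinear polynomial over $\mathbb{F}_2$, its algebraic normal form (ANF): $f(x)=\sum_{S\subseteq[n]}c_S\prod_{j\in S}x_j$ with $c_S\in\{0,1\}$ and $[n]=\{1,\dots,n\}$. The sparsity $\|f\|$ is the number of $S\subseteq[n]$ with $c_S=1$. The algebraic thickness is $\mathcal{T}(f)=\min_{A\in\mathcal{A}_n}\|f\circ A\|$, where $\mathcal{A}_n$ is the set of affine bijections $\mathbb{F}_2^n\to\mathbb{F}_2^n$. A $k$-dimensional flat is a (nonempty) affine subspace of $\mathbb{F}_2^n$ of dimension $k$. An input function $f$ is represented by a pair $(g,A)$ with $A\in\mathcal{A}_n$, $g=f\circ A$ given by its ANF, and $\|g\|=\mathcal{T}(f)$; this representation uses a number of bits polynomial in $\mathcal{T}(f)+n^2$. "Efficiently" means in time polynomial in the size of the input. -}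

module Defs where

open import Algebra.Definitions.RawSemiring using () renaming (_^_ to pow)
open import Data.Bool.Base using (Bool; true; false; _xor_; _∧_; if_then_else_)
open import Data.Fin.Subset using (Subset)
open import Data.Integer.Base using (+_)
open import Data.List.Base as List using (List; []; _∷_; _++_; length; filterᵇ)
open import Data.Nat.Base as ℕ using (ℕ; zero; suc)
open import Data.Product.Base using (_×_; Σ; ∃; ∃₂)
open import Data.Rational.Base as ℚ using (ℚ; 0ℚ; _/_)
open import Data.Sum.Base using (_⊎_)
open import Data.Vec.Base as Vec using (Vec; []; _∷_; zipWith; replicate; foldr′; toList)
open import Function.Base using (_∘_)
open import Function.Bundles using (_⇔_)
open import Function.Definitions using (Bijective)
open import Relation.Binary.PropositionalEquality.Core using (_≡_)
open import Relation.Nullary.Negation.Core using (¬_)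

------------------------------------------------------------------------
-- Real numbers

-- Arithmetic is defined on raw pairs of sets of rationals; IsReal singles
-- out the Dedekind cuts.  The side conditions stated at the partial
-- operations below are those under which they map reals to reals.

record Cut : Set₁ where
  field
    lower upper : ℚ → Set

open Cut public

record IsReal (x : Cut) : Set where
  field
    lower-inhabited : ∃ (lower x)
    upper-inhabited : ∃ (upper x)
    lower-rounded   : ∀ q → lower x q ⇔ (∃ λ r → (q ℚ.< r) × lower x r)
    upper-rounded   : ∀ r → upper x r ⇔ (∃ λ q → (q ℚ.< r) × upper x q)
    disjoint        : ∀ q → ¬ (lower x q × upper x q)
    located         : ∀ {q r} → q ℚ.< r → lower x q ⊎ upper x r

infix  4 _≤ᴿ_ _<ᴿ_ _≈ᴿ_
infixl 6 _-ᴿ_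
infixr 7 _·ᴿ_
infixr 8 _^ᴿ_

_≤ᴿ_ _<ᴿ_ _≈ᴿ_ : Cut → Cut → Set
x ≤ᴿ y = ∀ q → lower x q → lower y q
x <ᴿ y = ∃ λ q → upper x q × lower y q
x ≈ᴿ y = ∀ q → (lower x q ⇔ lower y q) × (upper x q ⇔ upper y q)

fromℚ : ℚ → Cut
fromℚ p .lower q = q ℚ.< p
fromℚ p .upper q = p ℚ.< q

ℕ→ℚ : ℕ → ℚ
ℕ→ℚ n = + n / 1

fromℕ : ℕ → Cut
fromℕ n = fromℚ (ℕ→ℚ n)

_-ᴿ_ : Cut → Cut → Cut
(x -ᴿ y) .lower r = ∃₂ λ a b → lower x a × upper y b × r ≡ a ℚ.- b
(x -ᴿ y) .upper r = ∃₂ λ a b → upper x a × lower y b × r ≡ a ℚ.- b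

-- For 0 < p.
_·ᴿ_ : ℚ → Cut → Cut
(p ·ᴿ x) .lower r = ∃ λ a → lower x a × r ≡ p ℚ.* a
(p ·ᴿ x) .upper r = ∃ λ a → upper x a × r ≡ p ℚ.* a

-- For 0 ≤ x.
√_ : Cut → Cut
(√ x) .lower r = (r ℚ.< 0ℚ) ⊎ lower x (r ℚ.* r)
(√ x) .upper r = (0ℚ ℚ.< r) × upper x (r ℚ.* r)

_^ℚ_ : ℚ → ℕ → ℚ
_^ℚ_ = pow ℚ.+-*-rawSemiring

-- For 0 < s; in particular 0 ^ᴿ s is 0.  For 0 ≤ r and natural numbers
-- p, q > 0, the inequality r < n ^ (p / q) means r ^ q < n ^ p.
_^ᴿ_ : ℕ → Cut → Cut
(n ^ᴿ s) .lower r = (r ℚ.< 0ℚ) ⊎ ∃₂ λ p q →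
  lower s (+ suc p / suc q) × (r ^ℚ suc q) ℚ.< ℕ→ℚ (n ℕ.^ suc p)
(n ^ᴿ s) .upper r = (0ℚ ℚ.< r) × ∃₂ λ p q →
  upper s (+ suc p / suc q) × ℕ→ℚ (n ℕ.^ suc p) ℚ.< (r ^ℚ suc q)

------------------------------------------------------------------------
-- Linear algebra over 𝔽₂

𝔽₂ : Set
𝔽₂ = Bool

𝔽₂^ : ℕ → Set
𝔽₂^ = Vec 𝔽₂

infixl 6 _⊕_

𝟎 : ∀ {n} → 𝔽₂^ n
𝟎 = replicate _ false

_⊕_ : ∀ {n} → 𝔽₂^ n → 𝔽₂^ n → 𝔽₂^ n
_⊕_ = zipWith _xor_

_∙_ : ∀ {n} → 𝔽₂^ n → 𝔽₂^ n → 𝔽₂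
u ∙ v = foldr′ _xor_ false (zipWith _∧_ u v)

combination : ∀ {n k} → 𝔽₂^ k → Vec (𝔽₂^ n) k → 𝔽₂^ n
combination cs vs = foldr′ _⊕_ 𝟎 (zipWith (λ c → Vec.map (c ∧_)) cs vs)

affineMap : ∀ {n} → Vec (𝔽₂^ n) n → 𝔽₂^ n → 𝔽₂^ n → 𝔽₂^ n
affineMap rows b x = Vec.map (_∙ x) rows ⊕ b

record AffineBijection (n : ℕ) : Set where
  field
    matrix    : Vec (𝔽₂^ n) n
    shift     : 𝔽₂^ n
    bijective : Bijective _≡_ _≡_ (affineMap matrix shift)

  apply : 𝔽₂^ n → 𝔽₂^ n
  apply = affineMap matrix shift

open AffineBijection public using (apply)

-- A k-dimensional flat, presented by a point and a basis of its direction.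
record Flat (n k : ℕ) : Set where
  field
    point       : 𝔽₂^ n
    basis       : Vec (𝔽₂^ n) k
    independent : ∀ cs → combination cs basis ≡ 𝟎 → cs ≡ 𝟎

infix 4 _∈ᶠ_

_∈ᶠ_ : ∀ {n k} → 𝔽₂^ n → Flat n k → Set
x ∈ᶠ E = ∃ λ cs → x ≡ Flat.point E ⊕ combination cs (Flat.basis E)

ConstantOn : ∀ {n k} → (𝔽₂^ n → 𝔽₂) → Flat n k → Set
ConstantOn f E = ∃ λ b → ∀ x → x ∈ᶠ E → f x ≡ b

------------------------------------------------------------------------
-- Algebraic normal form, sparsity and algebraic thickness

monomial : ∀ {n} → Subset n → 𝔽₂^ n → 𝔽₂
monomial S x = foldr′ _∧_ true (zipWith (λ j∈S xⱼ → if j∈S then xⱼ else true) S x)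

subsets : ∀ n → List (Subset n)
subsets zero    = [] ∷ []
subsets (suc n) = List.map (false ∷_) (subsets n) ++ List.map (true ∷_) (subsets n)

Coefficients : ℕ → Set
Coefficients n = Subset n → 𝔽₂

IsANF : ∀ {n} → Coefficients n → (𝔽₂^ n → 𝔽₂) → Set
IsANF {n} c f =
  ∀ x → f x ≡ List.foldr _xor_ false (List.map (λ S → c S ∧ monomial S x) (subsets n))

support : ∀ {n} → Coefficients n → List (Subset n)
support c = filterᵇ c (subsets _)

HasSparsity : ∀ {n} → (𝔽₂^ n → 𝔽₂) → ℕ → Set
HasSparsity f s = ∃ λ c → IsANF c f × length (support c) ≡ s

HasThickness : ∀ {n} → (𝔽₂^ n → 𝔽₂) → ℕ → Set
HasThickness {n} f t =
  (Σ (AffineBijection n) λ A → HasSparsity (f ∘ apply A) t) ×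
  (∀ (A : AffineBijection n) s → HasSparsity (f ∘ apply A) s → t ℕ.≤ s)

------------------------------------------------------------------------
-- Polynomial-time computation

-- Jones' language I: WHILE programs with a single variable ranging over
-- binary trees, here written as functions of that variable.

data Tree : Set where
  leaf : Tree
  node : Tree → Tree → Tree

size : Tree → ℕ
size leaf       = 1
size (node l r) = suc (size l ℕ.+ size r)

infixr 5 _⨾_

data Program : Set where
  nil input left right : Program
  pair                 : Program → Program → Program
  _⨾_                  : Program → Program → Program
  cond                 : (test yes no : Program) → Program
  while                : (test body : Program) → Program

infix 4 _∶_⇓_within_

-- p ∶ x ⇓ y within t: on x, the program p halts with result y after
-- exactly t steps.  A leaf is false in tests and any node is true.  Every
-- rule is a constant-time operation on a heap of cons cells (subtrees are
-- shared, each step allocates at most one cell), so for outputs of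
-- polynomial size polynomial time agrees with that of Turing machines.
data _∶_⇓_within_ : Program → Tree → Tree → ℕ → Set where

  nil⇓ : ∀ {x} → nil ∶ x ⇓ leaf within 1

  input⇓ : ∀ {x} → input ∶ x ⇓ x within 1

  left-leaf⇓ : left ∶ leaf ⇓ leaf within 1

  left-node⇓ : ∀ {l r} → left ∶ node l r ⇓ l within 1

  right-leaf⇓ : right ∶ leaf ⇓ leaf within 1

  right-node⇓ : ∀ {l r} → right ∶ node l r ⇓ r within 1

  pair⇓ : ∀ {p q x y z s t} →
    p ∶ x ⇓ y within s →
    q ∶ x ⇓ z within t →
    pair p q ∶ x ⇓ node y z within suc (s ℕ.+ t)

  ⨾⇓ : ∀ {p q x y z s t} →
    p ∶ x ⇓ y within s →
    q ∶ y ⇓ z within t →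
    p ⨾ q ∶ x ⇓ z within suc (s ℕ.+ t)

  cond-true⇓ : ∀ {c p q x l r y s t} →
    c ∶ x ⇓ node l r within s →
    p ∶ x ⇓ y within t →
    cond c p q ∶ x ⇓ y within suc (s ℕ.+ t)

  cond-false⇓ : ∀ {c p q x y s t} →
    c ∶ x ⇓ leaf within s →
    q ∶ x ⇓ y within t →
    cond c p q ∶ x ⇓ y within suc (s ℕ.+ t)

  while-true⇓ : ∀ {c p x l r y z s t u} →
    c ∶ x ⇓ node l r within s →
    p ∶ x ⇓ y within t →
    while c p ∶ y ⇓ z within u →
    while c p ∶ x ⇓ z within suc (s ℕ.+ t ℕ.+ u)

  while-false⇓ : ∀ {c p x s} →
    c ∶ x ⇓ leaf within s →
    while c p ∶ x ⇓ x within suc s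

encodeBit : 𝔽₂ → Tree
encodeBit false = leaf
encodeBit true  = node leaf leaf

encodeList : ∀ {A : Set} → (A → Tree) → List A → Tree
encodeList enc []       = leaf
encodeList enc (x ∷ xs) = node (enc x) (encodeList enc xs)

encodeVector : ∀ {n} → 𝔽₂^ n → Tree
encodeVector v = encodeList encodeBit (toList v)

-- The pair (g , A), where ms lists the monomials of g, each as the
-- characteristic vector of its set of variables.
encodeInput : ∀ {n} → List (Subset n) → AffineBijection n → Tree
encodeInput ms A =
  node (encodeList encodeVector ms)
       (node (encodeList encodeVector (toList (AffineBijection.matrix A)))
             (encodeVector (AffineBijection.shift A)))

encodeFlat : ∀ {n k} → Flat n k → Tree
encodeFlat E =
  node (encodeVector (Flat.point E))
       (encodeList encodeVector (toList (Flat.basis E)))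

{-# OPTIONS --safe #-}
module Submission where

-- For each monomial of g of degree at least 3, take three of its variables
-- as an edge of a 3-uniform hypergraph on [n].  Deleting vertices of maximum
-- degree until no edge is left keeps m ≥ (8/15) √(2n³/(3T)) variables: with
-- f(D) = ∏ᵢ 2i/(2i+1), i ≤ D, one has m ≥ (3/2) f(D) (n - T/D) for all D ≥ 1,
-- since a deletion does not decrease the bounds with D at most the maximum
-- degree, and those bounds imply the others (a Caro–Wei argument).  On the
-- span of the kept unit vectors g is quadratic, so its second difference is
-- an alternating form there, and Gram–Schmidt finds an isotropic subspace of
-- dimension at least m/2: put the first vector into the basis, intersect the
-- span of the others with its orthogonal complement, and repeat.  On that
-- subspace g is affine, hence constant on a hyperplane of it, and applying A
-- gives the flat.  Each of these steps is a fold over lists of bit vectors.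
--
-- The constants leave room for cheap estimates: only D = ⌊3T/n⌋ is used, and
-- D ≥ 3 because ε < 2 gives n ≤ T.

open import Defs
open import Data.Bool.Base using (Bool; true; false; if_then_else_; _xor_; _∧_; not)
open import Data.Bool.Properties
  using (xor-assoc; xor-comm; xor-identityʳ; xor-same; ∧-distribˡ-xor; ∧-zeroʳ)
open import Data.Bool.Solver using (module xor-∧-Solver)
open import Data.Empty using (⊥; ⊥-elim)
open import Data.Fin.Subset using (Subset; ∣_∣)
open import Data.List.Base as List
  using (List; []; _∷_; _++_; foldl; foldr; reverse; length; filterᵇ; allFin)
open import Data.List.Membership.Propositional using (_∈_; _∉_)
open import Data.List.Properties
  using (++-assoc; ++-identityʳ; length-map; length-tabulate; map-is-foldr; map-tabulate; map-∘;
         reverse-foldl; reverse-involutive; unfold-reverse; zipWith-zeroʳ)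
open import Data.List.Relation.Binary.Permutation.Propositional
  using (_↭_; refl; prep; swap; ↭-refl; ↭-sym) renaming (trans to compose)
open import Data.List.Relation.Binary.Permutation.Propositional.Properties
  using (↭-length; All-resp-↭; ∈-resp-↭)
open import Data.List.Relation.Unary.All as All using (All; []; _∷_)
open import Data.List.Relation.Unary.AllPairs using ([]; _∷_)
open import Data.List.Relation.Unary.Any using (here; there)
open import Data.List.Relation.Unary.Unique.Propositional using (Unique)
open import Data.List.Relation.Unary.Unique.Propositional.Properties using (allFin⁺; filter⁺)
open import Data.Nat.Base as ℕ
  using (ℕ; zero; suc; _+_; _*_; _^_; _∸_; _≤_; _<_; z≤n; s≤s; s≤s⁻¹; NonZero; >-nonZero)
open import Data.Nat.DivMod using (_%_; m≡m%n+[m/n]*n; m%n<n; m*n/n≡m; /-monoˡ-≤; m/n*n≤m)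
open import Data.Nat.ListAction using (sum)
open import Data.Nat.Properties
open import Data.Nat.Tactic.RingSolver using (solve-∀)
open import Data.Product.Base using (_×_; Σ; ∃; ∃₂; _,_; proj₁; proj₂)
open import Data.Sum.Base using (_⊎_; inj₁; inj₂)
open import Data.Unit.Base using (⊤; tt)
open import Data.Vec.Base as Vec using (Vec; []; _∷_; lookup; toList; fromList)
open import Data.Vec.Properties as Vec
  using (zipWith-assoc; zipWith-comm; zipWith-identityˡ; zipWith-identityʳ; toList∘fromList)
open import Function.Base using (_∘_; flip; id)
open import Function.Bundles using (Equivalence)
open import Relation.Binary.Definitions using (tri<; tri≈; tri>)
open import Relation.Binary.PropositionalEquality
  using (_≡_; _≢_; refl; sym; trans; cong; cong₂; subst; subst₂; module ≡-Reasoning)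
open import Relation.Nullary.Decidable.Core using (T?; yes; no)
open import Relation.Nullary.Negation.Core using (¬_)

-- The factors 2i/(2i+1) are those of the Caro-Tuza bound for 3-uniform hypergraphs: f(D) is the
-- integral of (1 - x^2)^D over [0,1], the chance that in a random order a vertex comes last in none
-- of D edges meeting only in it. A bound in terms of the average degree is not linear in n and T,
-- which makes induction over deletions awkward; the family of linear bounds, one for each D,
-- reduces it to cross-multiplied inequalities between natural numbers.
--
-- As T = n^(3-ε), half of (8/15) √(2n³/(3T)) is (4/15) √((2/3) n^ε). Squared, the claim becomes 32
-- n³ ≤ 675 T (k+3)², with 32/675 = (4/15)² (2/3). Passing to the hyperplane costs 1 of the 3 that
-- are subtracted.
--
-- The program handles lists of bits, whereas correctness is best proved for vectors of fixed length
-- and variables in `Fin n`. So the algorithm is written once, for arbitrary types of vectors,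
-- vertices and edges, and is shown to commute with maps between representations. Its running time
-- comes from closure properties of polynomial-time functions; explicit programs occur only in their
-- proofs.

private variable
  A E : Set
  n   : ℕ

-- Polynomial-time functions

infixl 6 _⊞_
infixl 7 _⊠_
infixl 8 _∘ₚ_

data Polynomial : Set where
  con     : ℕ → Polynomial
  var     : Polynomial
  _⊞_ _⊠_ : Polynomial → Polynomial → Polynomial

eval : Polynomial → ℕ → ℕ
eval (con c) s = c
eval var     s = s
eval (p ⊞ q) s = eval p s + eval q s
eval (p ⊠ q) s = eval p s * eval q s

_∘ₚ_ : Polynomial → Polynomial → Polynomial
con c   ∘ₚ r = con c
var     ∘ₚ r = r
(p ⊞ q) ∘ₚ r = (p ∘ₚ r) ⊞ (q ∘ₚ r)
(p ⊠ q) ∘ₚ r = (p ∘ₚ r) ⊠ (q ∘ₚ r)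

eval-∘ₚ : ∀ p q s → eval (p ∘ₚ q) s ≡ eval p (eval q s)
eval-∘ₚ (con c) r s = refl
eval-∘ₚ var     r s = refl
eval-∘ₚ (p ⊞ q) r s = cong₂ _+_ (eval-∘ₚ p r s) (eval-∘ₚ q r s)
eval-∘ₚ (p ⊠ q) r s = cong₂ _*_ (eval-∘ₚ p r s) (eval-∘ₚ q r s)

eval-mono : ∀ p {s t} → s ≤ t → eval p s ≤ eval p t
eval-mono (con c) s≤t = ≤-refl
eval-mono var     s≤t = s≤t
eval-mono (p ⊞ q) s≤t = +-mono-≤ (eval-mono p s≤t) (eval-mono q s≤t)
eval-mono (p ⊠ q) s≤t = *-mono-≤ (eval-mono p s≤t) (eval-mono q s≤t)

eval-≤-∘ₚ : ∀ p q {s t} → t ≤ eval q s → eval p t ≤ eval (p ∘ₚ q) s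
eval-≤-∘ₚ p q {s} t≤ = ≤-trans (eval-mono p t≤) (≤-reflexive (sym (eval-∘ₚ p q s)))

-- For s ≥ 1 both powers in a sum are at most `s ^ (i + j)`, so exponents may be added for sums as
-- well as for products.
eval-≤-monomial : ∀ p → ∃₂ λ c d → ∀ s → 1 ≤ s → eval p s ≤ c * s ^ d
eval-≤-monomial (con c) = c , 0 , λ s _ → ≤-reflexive (sym (*-identityʳ c))
eval-≤-monomial var     = 1 , 1 , λ s _ → ≤-reflexive (sym (trans (*-identityˡ _) (*-identityʳ s)))
eval-≤-monomial (p ⊞ q) with eval-≤-monomial p | eval-≤-monomial q
... | a , i , p≤ | b , j , q≤ = a + b , i + j , λ { s@(suc _) 1≤s → begin
  eval p s + eval q s              ≤⟨ +-mono-≤ (p≤ s 1≤s) (q≤ s 1≤s) ⟩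
  a * s ^ i + b * s ^ j            ≤⟨ +-mono-≤ (*-monoʳ-≤ a (^-monoʳ-≤ s (m≤m+n i j)))
                                               (*-monoʳ-≤ b (^-monoʳ-≤ s (m≤n+m j i))) ⟩
  a * s ^ (i + j) + b * s ^ (i + j) ≡⟨ *-distribʳ-+ (s ^ (i + j)) a b ⟨
  (a + b) * s ^ (i + j)            ∎ }
  where open ≤-Reasoning
eval-≤-monomial (p ⊠ q) with eval-≤-monomial p | eval-≤-monomial q
... | a , i , p≤ | b , j , q≤ = a * b , i + j , λ s 1≤s → begin
  eval p s * eval q s            ≤⟨ *-mono-≤ (p≤ s 1≤s) (q≤ s 1≤s) ⟩
  (a * s ^ i) * (b * s ^ j)      ≡⟨ [m*n]*[o*p]≡[m*o]*[n*p] a (s ^ i) b (s ^ j) ⟩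
  (a * b) * (s ^ i * s ^ j)      ≡⟨ cong (a * b *_) (^-distribˡ-+-* s i j) ⟨
  (a * b) * s ^ (i + j)          ∎
  where open ≤-Reasoning

-- Data types, their encodings as trees and their weights

infixr 4 _⊗_

data Ty : Set where
  bit  : Ty
  _⊗_  : Ty → Ty → Ty
  list : Ty → Ty

⟦_⟧ : Ty → Set
⟦ bit ⟧    = Bool
⟦ σ ⊗ τ ⟧  = ⟦ σ ⟧ × ⟦ τ ⟧
⟦ list σ ⟧ = List ⟦ σ ⟧

enc : ∀ {τ} → ⟦ τ ⟧ → Tree
enc {bit}            = encodeBit
enc {σ ⊗ τ} (x , y)  = node (enc x) (enc y)
enc {list σ}         = encodeList enc

-- The size of the encoding with every bit counted as 1, so that bitwise
-- operations do not increase it.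
wt : ∀ {τ} → ⟦ τ ⟧ → ℕ
wt {bit}             _        = 1
wt {σ ⊗ τ}           (x , y)  = suc (wt x + wt y)
wt {list σ}          []       = 1
wt {list σ}          (x ∷ xs) = suc (wt x + wt xs)

wt≤size : ∀ {τ} (x : ⟦ τ ⟧) → wt x ≤ size (enc x)
wt≤size {bit}    false    = s≤s z≤n
wt≤size {bit}    true     = s≤s z≤n
wt≤size {σ ⊗ τ}  (x , y)  = s≤s (+-mono-≤ (wt≤size x) (wt≤size y))
wt≤size {list σ} []       = s≤s z≤n
wt≤size {list σ} (x ∷ xs) = s≤s (+-mono-≤ (wt≤size x) (wt≤size xs))

1≤wt : ∀ {τ} (x : ⟦ τ ⟧) → 1 ≤ wt x
1≤wt {bit}    x        = s≤s z≤n
1≤wt {σ ⊗ τ}  x        = s≤s z≤n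
1≤wt {list σ} []       = s≤s z≤n
1≤wt {list σ} (x ∷ xs) = s≤s z≤n

length≤wt : ∀ {σ} (xs : List ⟦ σ ⟧) → length xs ≤ wt {list σ} xs
length≤wt []       = z≤n
length≤wt (x ∷ xs) = s≤s (≤-trans (length≤wt xs) (m≤n+m _ (wt x)))

wt-prefix : ∀ {σ} (xs ys : List ⟦ σ ⟧) → wt {list σ} xs ≤ wt {list σ} (xs ++ ys)
wt-prefix []       ys = 1≤wt ys
wt-prefix (x ∷ xs) ys = s≤s (+-monoʳ-≤ (wt x) (wt-prefix xs ys))

-- The bound `grows` on the result is carried along because the time of a composite depends on the
-- size of the intermediate value.
record FP {σ τ : Ty} (f : ⟦ σ ⟧ → ⟦ τ ⟧) : Set where
  field
    prog       : Program
    time space : Polynomial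
    runs       : ∀ x → ∃ λ t → (prog ∶ enc x ⇓ enc (f x) within t) × t ≤ eval time (wt x)
    grows      : ∀ x → wt (f x) ≤ eval space (wt x)

open FP

private variable
  Γ σ τ υ : Ty

-- Closure properties of polynomial-time functions

FP-ext : {f g : ⟦ σ ⟧ → ⟦ τ ⟧} → FP f → (∀ x → f x ≡ g x) → FP g
FP-ext {f = f} {g} F f≗g = record
  { prog = prog F ; time = time F ; space = space F
  ; runs  = λ x → let t , r , t≤ = runs F x in
      t , subst (λ y → prog F ∶ enc x ⇓ enc y within t) (f≗g x) r , t≤
  ; grows = λ x → subst (λ y → wt y ≤ eval (space F) (wt x)) (f≗g x) (grows F x)
  }

fstᶠ : FP {σ ⊗ τ} {σ} proj₁
fstᶠ = record
  { prog = left ; time = con 1 ; space = var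
  ; runs = λ x → 1 , left-node⇓ , ≤-refl
  ; grows = λ (x , y) → ≤-trans (m≤m+n (wt x) (wt y)) (n≤1+n _) }

sndᶠ : FP {σ ⊗ τ} {τ} proj₂
sndᶠ = record
  { prog = right ; time = con 1 ; space = var
  ; runs = λ x → 1 , right-node⇓ , ≤-refl
  ; grows = λ (x , y) → ≤-trans (m≤n+m (wt y) (wt x)) (n≤1+n _) }

infixr 9 _∘ᶠ_

_∘ᶠ_ : {f : ⟦ σ ⟧ → ⟦ τ ⟧} {g : ⟦ τ ⟧ → ⟦ υ ⟧} → FP g → FP f → FP {σ} {υ} (λ x → g (f x))
_∘ᶠ_ {f = f} G F = record
  { prog  = prog F ⨾ prog G
  ; time  = con 1 ⊞ (time F ⊞ (time G ∘ₚ space F))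
  ; space = space G ∘ₚ space F
  ; runs  = λ x → let s , p , s≤ = runs F x ; t , q , t≤ = runs G (f x) in
      suc (s + t) , ⨾⇓ p q ,
      s≤s (+-mono-≤ s≤ (≤-trans t≤ (eval-≤-∘ₚ (time G) (space F) (grows F x))))
  ; grows = λ x → ≤-trans (grows G (f x)) (eval-≤-∘ₚ (space G) (space F) (grows F x))
  }

infixr 4 _,ᶠ_

_,ᶠ_ : {f : ⟦ Γ ⟧ → ⟦ σ ⟧} {g : ⟦ Γ ⟧ → ⟦ τ ⟧} → FP f → FP g → FP {Γ} {σ ⊗ τ} (λ x → f x , g x)
F ,ᶠ G = record
  { prog  = pair (prog F) (prog G)
  ; time  = con 1 ⊞ (time F ⊞ time G)
  ; space = con 1 ⊞ (space F ⊞ space G)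
  ; runs  = λ x → let s , p , s≤ = runs F x ; t , q , t≤ = runs G x in
      suc (s + t) , pair⇓ p q , s≤s (+-mono-≤ s≤ t≤)
  ; grows = λ x → s≤s (+-mono-≤ (grows F x) (grows G x))
  }

nilᶠ : FP {Γ} {list σ} (λ _ → [])
nilᶠ = record
  { prog = nil ; time = con 1 ; space = con 1
  ; runs = λ x → 1 , nil⇓ , ≤-refl ; grows = λ x → ≤-refl }

infixr 5 _∷ᶠ_

-- A nonempty list and the pair of its head and tail have the same tree and the same weight, so the
-- fields of the pairing serve unchanged.
_∷ᶠ_ : {f : ⟦ Γ ⟧ → ⟦ σ ⟧} {g : ⟦ Γ ⟧ → List ⟦ σ ⟧} → FP f → FP g → FP {Γ} {list σ} (λ x → f x ∷ g x)
F ∷ᶠ G = record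
  { prog = prog H ; time = time H ; space = space H ; runs = runs H ; grows = grows H }
  where H = F ,ᶠ G

falseᶠ : FP {Γ} {bit} (λ _ → false)
falseᶠ = record
  { prog = nil ; time = con 1 ; space = con 1
  ; runs = λ x → 1 , nil⇓ , ≤-refl ; grows = λ x → ≤-refl }

trueᶠ : FP {Γ} {bit} (λ _ → true)
trueᶠ = record
  { prog = pair nil nil ; time = con 3 ; space = con 1
  ; runs = λ x → 3 , pair⇓ nil⇓ nil⇓ , ≤-refl ; grows = λ x → ≤-refl }

ifᶠ_then_else_ : {b : ⟦ Γ ⟧ → Bool} {f g : ⟦ Γ ⟧ → ⟦ τ ⟧} →
  FP b → FP f → FP g → FP {Γ} {τ} (λ x → if b x then f x else g x)
ifᶠ_then_else_ {b = b} {f} {g} B F G = record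
  { prog  = cond (prog B) (prog F) (prog G)
  ; time  = con 1 ⊞ (time B ⊞ (time F ⊞ time G))
  ; space = space F ⊞ space G
  ; runs  = λ x → run x (b x) (runs B x)
  ; grows = λ x → grow x (b x)
  }
  where
  run : ∀ x c → (∃ λ t → (prog B ∶ enc x ⇓ enc {bit} c within t) × t ≤ eval (time B) (wt x)) →
    ∃ λ t → (cond (prog B) (prog F) (prog G) ∶ enc x ⇓ enc (if c then f x else g x) within t) ×
      t ≤ suc (eval (time B) (wt x) + (eval (time F) (wt x) + eval (time G) (wt x)))
  run x true (s , p , s≤) = let t , q , t≤ = runs F x in
    suc (s + t) , cond-true⇓ p q , s≤s (+-mono-≤ s≤ (≤-trans t≤ (m≤m+n _ _)))
  run x false (s , p , s≤) = let t , q , t≤ = runs G x in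
    suc (s + t) , cond-false⇓ p q , s≤s (+-mono-≤ s≤ (≤-trans t≤ (m≤n+m _ _)))
  grow : ∀ x c → wt (if c then f x else g x) ≤ eval (space F) (wt x) + eval (space G) (wt x)
  grow x true  = ≤-trans (grows F x) (m≤m+n _ _)
  grow x false = ≤-trans (grows G x) (m≤n+m _ _)

uncons : ∀ {A B : Set} → List A → B → (A × List A → B) → B
uncons []       n c = n
uncons (x ∷ xs) n c = c (x , xs)

-- The tree of a nonempty list already is the tree of the pair of head and tail, so a second run of
-- `prog L`, paired with the input, produces the argument of `prog G`.
unconsᶠ : {l : ⟦ Γ ⟧ → List ⟦ σ ⟧} {f : ⟦ Γ ⟧ → ⟦ τ ⟧} {g : ⟦ (σ ⊗ list σ) ⊗ Γ ⟧ → ⟦ τ ⟧} →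
  FP l → FP f → FP g → FP {Γ} {τ} (λ x → uncons (l x) (f x) (λ p → g (p , x)))
unconsᶠ {Γ} {σ} {τ} {l} {f} {g} L F G = record
  { prog  = cond (prog L) (pair (prog L) input ⨾ prog G) (prog F)
  ; time  = con 1 ⊞ (time L ⊞ (time F ⊞ (con 1 ⊞ ((con 1 ⊞ (time L ⊞ con 1)) ⊞ (time G ∘ₚ size₊)))))
  ; space = space F ⊞ (space G ∘ₚ size₊)
  ; runs  = λ x → run x (l x) (runs L x) (grows L x)
  ; grows = λ x → grow x (l x) (grows L x)
  }
  where
  size₊ = con 1 ⊞ (space L ⊞ var)
  run : ∀ x (k : List ⟦ σ ⟧) →
    (∃ λ t → (prog L ∶ enc x ⇓ enc {list σ} k within t) × t ≤ eval (time L) (wt x)) →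
    wt {list σ} k ≤ eval (space L) (wt x) →
    ∃ λ t → (cond (prog L) (pair (prog L) input ⨾ prog G) (prog F) ∶ enc x ⇓
               enc (uncons k (f x) (λ p → g (p , x))) within t) ×
      t ≤ suc (eval (time L) (wt x) + (eval (time F) (wt x) +
            (suc (suc (eval (time L) (wt x) + 1) + eval (time G ∘ₚ size₊) (wt x)))))
  run x [] (s , p , s≤) k≤ = let t , q , t≤ = runs F x in
    suc (s + t) , cond-false⇓ p q , s≤s (+-mono-≤ s≤ (≤-trans t≤ (m≤m+n _ _)))
  run x (y ∷ ys) (s , p , s≤) k≤ = let t , q , t≤ = runs G ((y , ys) , x) in
    suc (s + suc (suc (s + 1) + t)) , cond-true⇓ p (⨾⇓ (pair⇓ p input⇓) q) ,
    s≤s (+-mono-≤ s≤ (≤-trans (s≤s (+-mono-≤ (s≤s (+-monoˡ-≤ 1 s≤))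
      (≤-trans t≤ (eval-≤-∘ₚ (time G) size₊ (s≤s (+-monoˡ-≤ (wt x) k≤)))))) (m≤n+m _ _)))
  grow : ∀ x (k : List ⟦ σ ⟧) → wt {list σ} k ≤ eval (space L) (wt x) →
    wt (uncons k (f x) (λ p → g (p , x))) ≤ eval (space F) (wt x) + eval (space G ∘ₚ size₊) (wt x)
  grow x []       k≤ = ≤-trans (grows F x) (m≤m+n _ _)
  grow x (y ∷ ys) k≤ = ≤-trans (≤-trans (grows G _)
    (eval-≤-∘ₚ (space G) size₊ (s≤s (+-monoˡ-≤ (wt x) k≤)))) (m≤n+m _ _)

-- An iteration is polynomial as soon as its intermediate states are; they are
-- the results of the same iteration on the prefixes of the list.
foldlᶠ : {l : ⟦ Γ ⟧ → List ⟦ σ ⟧} {s : ⟦ Γ ⟧ → ⟦ τ ⟧} {step : ⟦ Γ ⊗ σ ⊗ τ ⟧ → ⟦ τ ⟧} →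
  FP step → FP s → FP l → (B : Polynomial) →
  (∀ x (ys : List ⟦ σ ⟧) → wt (foldl (λ a y → step (x , y , a)) (s x) ys) ≤ eval B (wt x + wt {list σ} ys)) →
  FP {Γ} {τ} (λ x → foldl (λ a y → step (x , y , a)) (s x) (l x))
foldlᶠ {Γ} {σ} {τ} {l} {s} {step} P S L B bounded = record
  { prog  = pair input (pair (prog L) (prog S)) ⨾ (while test body ⨾ (right ⨾ right))
  ; time  = con 1 ⊞ ((con 1 ⊞ (con 1 ⊞ (con 1 ⊞ (time L ⊞ time S)))) ⊞
              (con 1 ⊞ ((con 4 ⊞ space L ⊠ (con 24 ⊞ (time P ∘ₚ size₊))) ⊞ con 3)))
  ; space = B ∘ₚ (var ⊞ space L)
  ; runs  = run
  ; grows = λ x → final≤ x (l x) (grows L x)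
  }
  where
  -- The loop variable holds `x`, the unread rest of the list and the accumulator; the loop ends
  -- when the rest is a leaf.
  test = right ⨾ left
  body = pair left (pair (right ⨾ (left ⨾ right))
    (pair left (pair (right ⨾ (left ⨾ left)) (right ⨾ right)) ⨾ prog P))

  size₊ = con 1 ⊞ (var ⊞ (con 1 ⊞ (space L ⊞ (B ∘ₚ (var ⊞ space L)))))

  fold : ⟦ Γ ⟧ → ⟦ τ ⟧ → List ⟦ σ ⟧ → ⟦ τ ⟧
  fold x = foldl (λ a y → step (x , y , a))

  final≤ : ∀ x (ys : List ⟦ σ ⟧) → wt {list σ} ys ≤ eval (space L) (wt x) →
    wt (fold x (s x) ys) ≤ eval (B ∘ₚ (var ⊞ space L)) (wt x)
  final≤ x ys ys≤ = ≤-trans (bounded x ys) (eval-≤-∘ₚ B (var ⊞ space L) (+-monoʳ-≤ (wt x) ys≤))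

  -- `M` bounds all accumulators met on the way and `C` the time of a step on them. A round takes 24
  -- further steps: 1 for the rule, 3 for the test, 20 for taking the triple apart and rebuilding
  -- it. The final, failing test takes 4.
  loop : ∀ x M C a ys →
    (∀ us vs → us ++ vs ≡ ys → wt (fold x a us) ≤ M) →
    (∀ y b → wt y ≤ wt {list σ} ys → wt b ≤ M → eval (time P) (wt {Γ ⊗ σ ⊗ τ} (x , y , b)) ≤ C) →
    ∃ λ t → (while test body ∶ enc {Γ ⊗ list σ ⊗ τ} (x , ys , a) ⇓
              enc {Γ ⊗ list σ ⊗ τ} (x , [] , fold x a ys) within t) ×
      t ≤ 4 + length ys * (24 + C)
  loop x M C a [] small cheap = 4 , while-false⇓ (⨾⇓ right-node⇓ left-node⇓) , ≤-refl
  loop x M C a (y ∷ ys) small cheap =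
    let t , p , t≤ = runs P (x , y , a)
        u , q , u≤ = loop x M C (step (x , y , a)) ys
          (λ us vs eq → small (y ∷ us) vs (cong (y ∷_) eq))
          (λ z b z≤ → cheap z b (≤-trans z≤ (≤-trans (m≤n+m _ (wt y)) (n≤1+n _))))
    in _ ,
       while-true⇓ (⨾⇓ right-node⇓ left-node⇓)
         (pair⇓ left-node⇓ (pair⇓ (⨾⇓ right-node⇓ (⨾⇓ left-node⇓ right-node⇓))
           (⨾⇓ (pair⇓ left-node⇓ (pair⇓ (⨾⇓ right-node⇓ (⨾⇓ left-node⇓ left-node⇓))
             (⨾⇓ right-node⇓ right-node⇓))) p)))
         q ,
       ≤-trans (s≤s (+-mono-≤ (+-monoʳ-≤ 23 (≤-trans t≤
           (cheap y a (≤-trans (m≤m+n _ _) (n≤1+n _)) (small [] (y ∷ ys) refl)))) u≤))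
         (≤-reflexive (rearrange C (length ys * (24 + C))))
    where
    rearrange : ∀ c m → (24 + c) + (4 + m) ≡ 4 + ((24 + c) + m)
    rearrange = solve-∀

  run : ∀ x → ∃ λ t →
    (pair input (pair (prog L) (prog S)) ⨾ (while test body ⨾ (right ⨾ right)) ∶ enc x ⇓
      enc (fold x (s x) (l x)) within t) × t ≤ _
  run x =
    let t₁ , p₁ , t₁≤ = runs L x
        t₂ , p₂ , t₂≤ = runs S x
        N   = eval (space L) (wt x)
        M   = eval (B ∘ₚ (var ⊞ space L)) (wt x)
        C   = eval (time P ∘ₚ size₊) (wt x)
        t₃ , p₃ , t₃≤ = loop x M C (s x) (l x)
          (λ us vs eq → final≤ x us (≤-trans (wt-prefix us vs)
            (subst (λ ys → wt {list σ} ys ≤ N) (sym eq) (grows L x))))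
          (λ y b y≤ b≤ → eval-≤-∘ₚ (time P) size₊ (s≤s (+-monoʳ-≤ (wt x)
            (s≤s (+-mono-≤ (≤-trans y≤ (grows L x)) b≤)))))
    in _ , ⨾⇓ (pair⇓ input⇓ (pair⇓ p₁ p₂)) (⨾⇓ p₃ (⨾⇓ right-node⇓ right-node⇓)) ,
       s≤s (+-mono-≤ (s≤s (s≤s (s≤s (+-mono-≤ t₁≤ t₂≤)))) (s≤s (+-monoˡ-≤ 3
         (≤-trans t₃≤ (+-monoʳ-≤ 4 (*-monoˡ-≤ (24 + C)
           (≤-trans (length≤wt (l x)) (grows L x))))))))

foldl-additive : {A S : Set} (f : S → A → S) (μ : S → ℕ) (ν : A → ℕ) (k N : ℕ) →
  (∀ a y → ν y ≤ N → μ (f a y) ≤ k + μ a) →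
  ∀ a (ys : List A) → (∀ us y vs → us ++ y ∷ vs ≡ ys → ν y ≤ N) →
  μ (foldl f a ys) ≤ length ys * k + μ a
foldl-additive f μ ν k N step a []       ν≤ = ≤-refl
foldl-additive f μ ν k N step a (y ∷ ys) ν≤ = begin
  μ (foldl f (f a y) ys)        ≤⟨ foldl-additive f μ ν k N step (f a y) ys
                                     (λ us z vs eq → ν≤ (y ∷ us) z vs (cong (y ∷_) eq)) ⟩
  length ys * k + μ (f a y)     ≤⟨ +-monoʳ-≤ _ (step a y (ν≤ [] y ys refl)) ⟩
  length ys * k + (k + μ a)     ≡⟨ rearrange k (length ys * k) (μ a) ⟩
  k + length ys * k + μ a       ∎
  where
  open ≤-Reasoning
  rearrange : ∀ k m n → m + (k + n) ≡ k + m + n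
  rearrange = solve-∀

wt-member : ∀ {σ} (us : List ⟦ σ ⟧) y vs → wt y ≤ wt {list σ} (us ++ y ∷ vs)
wt-member []       y vs = ≤-trans (m≤m+n _ _) (n≤1+n _)
wt-member (u ∷ us) y vs = ≤-trans (wt-member us y vs) (≤-trans (m≤n+m _ (wt u)) (n≤1+n _))

-- If the growth in one step does not depend on the accumulator, the growths add up to at most the
-- number of steps times a polynomial. Growth by a factor in each step would not be covered.
foldl⁺ᶠ : {l : ⟦ Γ ⟧ → List ⟦ σ ⟧} {s : ⟦ Γ ⟧ → ⟦ τ ⟧} {step : ⟦ Γ ⊗ σ ⊗ τ ⟧ → ⟦ τ ⟧} →
  FP step → FP s → FP l → (B : Polynomial) →
  (∀ x y a → wt (step (x , y , a)) ≤ eval B (wt x + wt y) + wt a) →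
  FP {Γ} {τ} (λ x → foldl (λ a y → step (x , y , a)) (s x) (l x))
foldl⁺ᶠ {σ = σ} {s = s} {step} P S L B additive = foldlᶠ P S L (var ⊠ B ⊞ space S) λ x ys →
  ≤-trans
    (foldl-additive (λ a y → step (x , y , a)) wt wt (eval B (wt x + wt {list σ} ys)) (wt {list σ} ys)
      (λ a y y≤ → ≤-trans (additive x y a) (+-monoˡ-≤ (wt a) (eval-mono B (+-monoʳ-≤ (wt x) y≤))))
      (s x) ys λ { us y vs refl → wt-member us y vs })
    (+-mono-≤ (*-monoˡ-≤ _ (≤-trans (length≤wt ys) (m≤n+m _ (wt x))))
              (≤-trans (grows S x) (eval-mono (space S) (m≤m+n _ _))))

reverseᶠ : {l : ⟦ Γ ⟧ → List ⟦ σ ⟧} → FP l → FP {Γ} {list σ} (λ x → reverse (l x))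
reverseᶠ L = foldl⁺ᶠ (fstᶠ ∘ᶠ sndᶠ ∷ᶠ sndᶠ ∘ᶠ sndᶠ) nilᶠ L (con 1 ⊞ var)
  λ x y a → s≤s (+-monoˡ-≤ (wt a) (m≤n+m (wt y) (wt x)))

wt-reverse : (ys : List ⟦ σ ⟧) → wt {list σ} (reverse ys) ≡ wt {list σ} ys
wt-reverse {σ} ys = suc-injective (trans (onto [] ys) (+-comm _ 1))
  where
  rearrange : ∀ a b c → a + suc (b + c) ≡ suc (b + a) + c
  rearrange = solve-∀
  onto : ∀ as (ys : List ⟦ σ ⟧) →
    suc (wt {list σ} (foldl (flip _∷_) as ys)) ≡ wt {list σ} ys + wt {list σ} as
  onto as []       = refl
  onto as (y ∷ ys) = trans (onto (y ∷ as) ys) (rearrange (wt {list σ} ys) (wt y) (wt {list σ} as))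

-- The loop reads a list from the front, so a right fold is run as a left fold over the reversed
-- list, which has the same weight.
foldrᶠ : {l : ⟦ Γ ⟧ → List ⟦ σ ⟧} {s : ⟦ Γ ⟧ → ⟦ τ ⟧} {step : ⟦ Γ ⊗ σ ⊗ τ ⟧ → ⟦ τ ⟧} →
  FP step → FP s → FP l → (B : Polynomial) →
  (∀ x (ys : List ⟦ σ ⟧) → wt (foldr (λ y a → step (x , y , a)) (s x) ys) ≤ eval B (wt x + wt {list σ} ys)) →
  FP {Γ} {τ} (λ x → foldr (λ y a → step (x , y , a)) (s x) (l x))
foldrᶠ {Γ} {σ} {τ} {l} {s} {step} P S L B bounded = FP-ext
  (foldlᶠ P S (reverseᶠ L) B λ x ys → subst₂ (λ r w → wt r ≤ eval B (wt x + w))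
    (trans (sym (reverse-foldl (λ a y → step (x , y , a)) (s x) (reverse ys)))
           (cong (foldl (λ a y → step (x , y , a)) (s x)) (reverse-involutive ys)))
    (wt-reverse ys) (bounded x (reverse ys)))
  λ x → reverse-foldl (λ a y → step (x , y , a)) (s x) (l x)

foldr⁺ᶠ : {l : ⟦ Γ ⟧ → List ⟦ σ ⟧} {s : ⟦ Γ ⟧ → ⟦ τ ⟧} {step : ⟦ Γ ⊗ σ ⊗ τ ⟧ → ⟦ τ ⟧} →
  FP step → FP s → FP l → (B : Polynomial) →
  (∀ x y a → wt (step (x , y , a)) ≤ eval B (wt x + wt y) + wt a) →
  FP {Γ} {τ} (λ x → foldr (λ y a → step (x , y , a)) (s x) (l x))
foldr⁺ᶠ {l = l} {s} {step} P S L B additive = FP-ext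
  (foldl⁺ᶠ P S (reverseᶠ L) B additive)
  λ x → reverse-foldl (λ a y → step (x , y , a)) (s x) (l x)

mapᶠ : {l : ⟦ Γ ⟧ → List ⟦ σ ⟧} {f : ⟦ Γ ⊗ σ ⟧ → ⟦ τ ⟧} →
  FP f → FP l → FP {Γ} {list τ} (λ x → List.map (λ y → f (x , y)) (l x))
mapᶠ {l = l} {f} F L = FP-ext
  (foldr⁺ᶠ (F ∘ᶠ (fstᶠ ,ᶠ fstᶠ ∘ᶠ sndᶠ) ∷ᶠ sndᶠ ∘ᶠ sndᶠ) nilᶠ L (con 1 ⊞ (space F ∘ₚ (con 1 ⊞ var)))
    λ x y a → s≤s (+-monoˡ-≤ (wt a) (≤-trans (grows F (x , y)) (eval-≤-∘ₚ (space F) (con 1 ⊞ var) {wt x + wt y} ≤-refl))))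
  λ x → sym (map-is-foldr (l x))

filterᶠ : {l : ⟦ Γ ⟧ → List ⟦ σ ⟧} {p : ⟦ Γ ⊗ σ ⟧ → Bool} →
  FP p → FP l → FP {Γ} {list σ} (λ x → filterᵇ (λ y → p (x , y)) (l x))
filterᶠ {σ = σ} {l = l} {p} P L = FP-ext
  (foldr⁺ᶠ (ifᶠ P ∘ᶠ (fstᶠ ,ᶠ fstᶠ ∘ᶠ sndᶠ) then fstᶠ ∘ᶠ sndᶠ ∷ᶠ sndᶠ ∘ᶠ sndᶠ else (sndᶠ ∘ᶠ sndᶠ))
    nilᶠ L (con 1 ⊞ var) (λ x y a → grow (p (x , y)) (wt x) y a))
  λ x → foldr-filterᵇ (λ y → p (x , y)) (l x)
  where
  grow : ∀ b n (y : ⟦ σ ⟧) a → wt {list σ} (if b then y ∷ a else a) ≤ suc (n + wt y) + wt {list σ} a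
  grow true  n y a = s≤s (+-monoˡ-≤ (wt {list σ} a) (m≤n+m (wt y) n))
  grow false n y a = m≤n+m _ (suc (n + wt y))
  foldr-filterᵇ : ∀ {A : Set} (q : A → Bool) (ys : List A) →
    foldr (λ y a → if q y then y ∷ a else a) [] ys ≡ filterᵇ q ys
  foldr-filterᵇ q []       = refl
  foldr-filterᵇ q (y ∷ ys) with q y
  ... | true  = cong (y ∷_) (foldr-filterᵇ q ys)
  ... | false = foldr-filterᵇ q ys

bool₂ᶠ : (f : Bool → Bool → Bool) {a b : ⟦ Γ ⟧ → Bool} →
  FP a → FP b → FP {Γ} {bit} (λ x → f (a x) (b x))
bool₂ᶠ {Γ} f {a} {b} A B = FP-ext
  (ifᶠ A then ifᶠ B then constᶠ (f true true) else constᶠ (f true false)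
         else (ifᶠ B then constᶠ (f false true) else constᶠ (f false false)))
  λ x → table (a x) (b x)
  where
  constᶠ : ∀ c → FP {Γ} {bit} (λ _ → c)
  constᶠ true  = trueᶠ
  constᶠ false = falseᶠ
  table : ∀ a b → (if a then (if b then f true true else f true false)
                       else (if b then f false true else f false false)) ≡ f a b
  table true  true  = refl
  table true  false = refl
  table false true  = refl
  table false false = refl

-- The fold over the first list carries the unread part of the second and the reversed output. Each
-- round moves one bit from the former to the latter, so the state does not grow.
zipBitsᶠ : (f : Bool → Bool → Bool) {u v : ⟦ Γ ⟧ → List Bool} →
  FP u → FP v → FP {Γ} {list bit} (λ x → List.zipWith f (u x) (v x))
zipBitsᶠ {Γ} f {u} {v} U V = FP-ext
  (reverseᶠ (sndᶠ ∘ᶠ foldl⁺ᶠ {τ = list bit ⊗ list bit}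
    (unconsᶠ (fstᶠ ∘ᶠ sndᶠ ∘ᶠ sndᶠ) (sndᶠ ∘ᶠ sndᶠ)
      (sndᶠ ∘ᶠ fstᶠ ,ᶠ
       bool₂ᶠ f (fstᶠ ∘ᶠ sndᶠ ∘ᶠ sndᶠ) (fstᶠ ∘ᶠ fstᶠ) ∷ᶠ sndᶠ ∘ᶠ sndᶠ ∘ᶠ sndᶠ ∘ᶠ sndᶠ))
    (V ,ᶠ nilᶠ) U (con 0) λ { x y ([] , out) → ≤-refl
                            ; x y (b ∷ bs , out) → ≤-reflexive (rearrange (wt {list bit} bs) (wt {list bit} out)) }))
  λ x → onto (u x) (v x) []
  where
  rearrange : ∀ m n → suc (m + suc (suc n)) ≡ suc (suc (suc m) + n)
  rearrange = solve-∀
  onto : ∀ us vs out →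
    reverse (proj₂ (foldl (λ s y → uncons (proj₁ s) s (λ p → proj₂ p , f y (proj₁ p) ∷ proj₂ s)) (vs , out) us))
      ≡ reverse out ++ List.zipWith f us vs
  onto []       vs       out = sym (++-identityʳ (reverse out))
  onto (y ∷ us) []       out = trans (onto us [] out)
    (cong (reverse out ++_) (zipWith-zeroʳ f us))
  onto (y ∷ us) (b ∷ vs) out = trans (onto us vs (f y b ∷ out))
    (trans (cong (_++ List.zipWith f us vs) (unfold-reverse (f y b) out))
           (++-assoc (reverse out) (f y b ∷ []) (List.zipWith f us vs)))

-- The algorithm, for vectors in any representation

module _ {A : Set} (_+ᵥ_ : A → A → A) where

  -- The first list of the state holds the pivot: a list with at most one entry stands for an
  -- optional vector.
  elimStep : (A → Bool) → A → List A × List A → List A × List A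
  elimStep φ x (p , out) =
    if φ x then uncons p (x ∷ [] , out) (λ q → p , (x +ᵥ proj₁ q) ∷ out) else (p , x ∷ out)

  eliminate : (A → Bool) → List A → List A × List A
  eliminate φ = foldr (elimStep φ) ([] , [])

  -- The pivot is the last vector with φ = 1; it is dropped after having been
  -- added to the other such vectors.
  kernel : (A → Bool) → List A → List A
  kernel φ xs = proj₂ (eliminate φ xs)

  -- The first list only bounds the number of rounds.
  isotropic : (A → A → Bool) → List A → List A → List A
  isotropic β []       ws       = []
  isotropic β (_ ∷ fs) []       = []
  isotropic β (_ ∷ fs) (w ∷ ws) = w ∷ isotropic β fs (kernel (β w) ws)

  -- x +ᵥ x stands for the zero vector, whose length is not known here.
  polarity : (A → Bool) → A → A → Bool
  polarity ev x y = (ev (x +ᵥ y) xor ev x) xor (ev y xor ev (x +ᵥ x))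

  constantDirections : (A → Bool) → List A → List A
  constantDirections ev xs =
    kernel (λ v → ev v xor ev (v +ᵥ v)) (isotropic (polarity ev) xs xs)

-- The data types have no numbers, so lengths are compared by removing an entry of `xs` for every
-- entry of `ys` and testing whether any is left.
longer : {B C : Set} → List B → List C → Bool
longer xs ys = uncons (foldl (λ r _ → uncons r [] proj₂) xs ys) false (λ _ → true)

module _ {A E : Set} (_∈ₑ_ : A → E → Bool) where

  selectStep : List E → A → A × List A → A × List A
  selectStep es x (b , os) =
    if longer (filterᵇ (x ∈ₑ_) es) (filterᵇ (b ∈ₑ_) es) then (x , b ∷ os) else (b , x ∷ os)

  select : List E → A → List A → A × List A
  select es x = foldr (selectStep es) (x , [])

  greedyStep : List A × List E → List A × List E
  greedyStep (ws , es) = uncons es (ws , es) λ _ → uncons ws (ws , es) λ p →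
    proj₂ (select es (proj₁ p) (proj₂ p)) ,
    filterᵇ (λ e → not (proj₁ (select es (proj₁ p) (proj₂ p)) ∈ₑ e)) es

  -- The vertex list also supplies the rounds: each round deletes a vertex, until no edge is left
  -- and the state no longer changes.
  independentSet : List A → List E → List A
  independentSet ws es = proj₁ (foldl (λ s _ → greedyStep s) (ws , es) ws)

firstThree : {A E : Set} → (A → A → A → E) → List A → List E → List E
firstThree mk as es = uncons as es λ p → uncons (proj₂ p) es λ q → uncons (proj₂ q) es λ r →
  mk (proj₁ p) (proj₁ q) (proj₁ r) ∷ es

edges : {A M E : Set} → (A → M → Bool) → (A → A → A → E) → List A → List M → List E
edges _∈ₘ_ mk as = foldr (λ m → firstThree mk (filterᵇ (_∈ₘ m) as)) []

unitsStep : List Bool × List (List Bool) → List Bool × List (List Bool)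
unitsStep (z , us) = false ∷ z , (true ∷ z) ∷ List.map (false ∷_) us

-- Only the length of the argument is read; it provides n in unary. The zero vector is carried along
-- to build the next unit vector.
units : List Bool → List Bool × List (List Bool)
units = foldr (λ _ → unitsStep) ([] , [])

infixl 6 _⊕ᴸ_
infix  7 _∙ᴸ_

_⊕ᴸ_ : List Bool → List Bool → List Bool
_⊕ᴸ_ = List.zipWith _xor_

_∙ᴸ_ : List Bool → List Bool → Bool
u ∙ᴸ v = foldr _xor_ false (List.zipWith _∧_ u v)

monomialᴸ : List Bool → List Bool → Bool
monomialᴸ S v = foldr _∧_ true (List.zipWith (λ s x → if s then x else true) S v)

evaluateᴸ : List (List Bool) → List Bool → Bool
evaluateᴸ ms v = foldr _xor_ false (List.map (λ S → monomialᴸ S v) ms)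

-- A variable is represented by its unit vector, monomials and edges by characteristic vectors;
-- incidence is then the inner product, and the edge on three variables is their sum.
keptᴸ : List (List Bool) → List Bool → List (List Bool)
keptᴸ ms b = independentSet _∙ᴸ_ (proj₂ (units b))
  (edges _∙ᴸ_ (λ x y z → x ⊕ᴸ (y ⊕ᴸ z)) (proj₂ (units b)) ms)

-- The point is the image of 0 under the affine map, and directions are moved by its linear part
-- alone.
flatᴸ : List (List Bool) × List (List Bool) × List Bool → List Bool × List (List Bool)
flatᴸ (ms , rows , b) =
  b , List.map (λ v → List.map (_∙ᴸ v) rows) (constantDirections _⊕ᴸ_ (evaluateᴸ ms) (keptᴸ ms b))

-- Running time of the algorithm

bits : Ty
bits = list bit

⊕ᶠ : {u v : ⟦ Γ ⟧ → List Bool} → FP u → FP v → FP {Γ} {bits} (λ x → u x ⊕ᴸ v x)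
⊕ᶠ = zipBitsᶠ _xor_

wt-⊕ : ∀ u v → wt {bits} (u ⊕ᴸ v) ≤ wt {bits} u
wt-⊕ []      v       = ≤-refl
wt-⊕ (a ∷ u) []      = s≤s z≤n
wt-⊕ (a ∷ u) (b ∷ v) = s≤s (s≤s (wt-⊕ u v))

∙ᶠ : {u v : ⟦ Γ ⟧ → List Bool} → FP u → FP v → FP {Γ} {bit} (λ x → u x ∙ᴸ v x)
∙ᶠ U V = foldr⁺ᶠ (bool₂ᶠ _xor_ (fstᶠ ∘ᶠ sndᶠ) (sndᶠ ∘ᶠ sndᶠ)) falseᶠ (zipBitsᶠ _∧_ U V)
  (con 0) λ _ _ _ → ≤-refl

monomialᶠ : {u v : ⟦ Γ ⟧ → List Bool} → FP u → FP v → FP {Γ} {bit} (λ x → monomialᴸ (u x) (v x))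
monomialᶠ U V = foldr⁺ᶠ (bool₂ᶠ _∧_ (fstᶠ ∘ᶠ sndᶠ) (sndᶠ ∘ᶠ sndᶠ)) trueᶠ
  (zipBitsᶠ (λ s x → if s then x else true) U V) (con 0) λ _ _ _ → ≤-refl

evaluateᶠ : {ms : ⟦ Γ ⟧ → List (List Bool)} {v : ⟦ Γ ⟧ → List Bool} →
  FP ms → FP v → FP {Γ} {bit} (λ x → evaluateᴸ (ms x) (v x))
evaluateᶠ MS V = foldr⁺ᶠ (bool₂ᶠ _xor_ (fstᶠ ∘ᶠ sndᶠ) (sndᶠ ∘ᶠ sndᶠ)) falseᶠ
  (mapᶠ (monomialᶠ sndᶠ (V ∘ᶠ fstᶠ)) MS) (con 0) λ _ _ _ → ≤-refl

wt-elimStep : ∀ φ x (p out : List (List Bool)) →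
  wt {list bits ⊗ list bits} (elimStep _⊕ᴸ_ φ x (p , out)) ≤
  suc (wt {bits} x) + wt {list bits ⊗ list bits} (p , out)
wt-elimStep φ x p out with φ x
wt-elimStep φ x []      out | true = ≤-reflexive (rearrange (wt {bits} x) (wt {list bits} out))
  where
  rearrange : ∀ m n → suc (suc (m + 1) + n) ≡ suc m + suc (1 + n)
  rearrange = solve-∀
wt-elimStep φ x (y ∷ p) out | true = ≤-trans
  (s≤s (+-monoʳ-≤ (wt {list bits} (y ∷ p)) (s≤s (+-monoˡ-≤ (wt {list bits} out) (wt-⊕ x y)))))
  (≤-reflexive (rearrange (wt {list bits} (y ∷ p)) (wt {bits} x) (wt {list bits} out)))
  where
  rearrange : ∀ l m n → suc (l + suc (m + n)) ≡ suc m + suc (l + n)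
  rearrange = solve-∀
wt-elimStep φ x p       out | false =
  ≤-reflexive (rearrange (wt {list bits} p) (wt {bits} x) (wt {list bits} out))
  where
  rearrange : ∀ l m n → suc (l + suc (m + n)) ≡ suc m + suc (l + n)
  rearrange = solve-∀

wt-eliminate : ∀ φ (xs : List (List Bool)) →
  wt {list bits ⊗ list bits} (eliminate _⊕ᴸ_ φ xs) ≤ 2 + wt {list bits} xs
wt-eliminate φ []       = ≤-refl
wt-eliminate φ (x ∷ xs) = ≤-trans (wt-elimStep φ x _ _)
  (≤-trans (+-monoʳ-≤ (suc (wt {bits} x)) (wt-eliminate φ xs))
    (≤-reflexive (rearrange (wt {bits} x) (wt {list bits} xs))))
  where
  rearrange : ∀ m n → suc m + (2 + n) ≡ 2 + suc (m + n)
  rearrange = solve-∀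

wt-kernel : ∀ φ (xs : List (List Bool)) → wt {list bits} (kernel _⊕ᴸ_ φ xs) ≤ wt {list bits} xs
wt-kernel φ xs = s≤s⁻¹ (s≤s⁻¹ (≤-trans (s≤s (+-monoˡ-≤ (wt {list bits} (kernel _⊕ᴸ_ φ xs))
  (1≤wt {list bits} (proj₁ (eliminate _⊕ᴸ_ φ xs))))) (wt-eliminate φ xs)))

kernelᶠ : {φ : ⟦ Γ ⊗ bits ⟧ → Bool} {l : ⟦ Γ ⟧ → List (List Bool)} →
  FP φ → FP l → FP {Γ} {list bits} (λ x → kernel _⊕ᴸ_ (λ v → φ (x , v)) (l x))
kernelᶠ {Γ} {φ} Φ L = sndᶠ ∘ᶠ foldr⁺ᶠ {τ = list bits ⊗ list bits}
  (ifᶠ Φ ∘ᶠ (fstᶠ ,ᶠ vector)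
   then unconsᶠ pivot ((vector ∷ᶠ nilᶠ) ,ᶠ out)
     (pivot ∘ᶠ sndᶠ ,ᶠ (⊕ᶠ (vector ∘ᶠ sndᶠ) (fstᶠ ∘ᶠ fstᶠ) ∷ᶠ out ∘ᶠ sndᶠ))
   else (pivot ,ᶠ (vector ∷ᶠ out)))
  (nilᶠ ,ᶠ nilᶠ) L (con 1 ⊞ var)
  λ x y (p , out) → ≤-trans (wt-elimStep (λ v → φ (x , v)) y p out)
    (+-monoˡ-≤ _ (s≤s (m≤n+m (wt {bits} y) (wt x))))
  where
  vector : FP {Γ ⊗ bits ⊗ list bits ⊗ list bits} {bits} _
  vector = fstᶠ ∘ᶠ sndᶠ
  pivot out : FP {Γ ⊗ bits ⊗ list bits ⊗ list bits} {list bits} _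
  pivot = fstᶠ ∘ᶠ sndᶠ ∘ᶠ sndᶠ
  out   = sndᶠ ∘ᶠ sndᶠ ∘ᶠ sndᶠ

-- The recursion becomes a left fold that collects the basis in reverse. A round moves one vector
-- into the basis and replaces the rest by a kernel of no greater weight, hence the growth bound
-- `con 0`.
isotropicᶠ : {β : ⟦ Γ ⊗ bits ⊗ bits ⟧ → Bool} {l : ⟦ Γ ⟧ → List (List Bool)} →
  FP β → FP l → FP {Γ} {list bits} (λ x → isotropic _⊕ᴸ_ (λ v w → β (x , v , w)) (l x) (l x))
isotropicᶠ {Γ} {β} {l} B L = FP-ext (reverseᶠ (sndᶠ ∘ᶠ foldl⁺ᶠ {τ = list bits ⊗ list bits}
  (unconsᶠ (fstᶠ ∘ᶠ sndᶠ ∘ᶠ sndᶠ) (sndᶠ ∘ᶠ sndᶠ)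
    (kernelᶠ (B ∘ᶠ (fstᶠ ∘ᶠ sndᶠ ∘ᶠ fstᶠ ,ᶠ fstᶠ ∘ᶠ fstᶠ ∘ᶠ fstᶠ ,ᶠ sndᶠ)) (sndᶠ ∘ᶠ fstᶠ) ,ᶠ
     (fstᶠ ∘ᶠ fstᶠ ∷ᶠ sndᶠ ∘ᶠ sndᶠ ∘ᶠ sndᶠ ∘ᶠ sndᶠ)))
  (L ,ᶠ nilᶠ) L (con 0)
  λ { x y ([] , vs)     → ≤-refl
    ; x y (w ∷ ws , vs) → ≤-trans
        (s≤s (+-monoˡ-≤ _ (wt-kernel (λ u → β (x , w , u)) ws)))
        (≤-reflexive (rearrange (wt {list bits} ws) (wt {bits} w) (wt {list bits} vs))) }))
  λ x → loop (λ v w → β (x , v , w)) (l x) (l x) []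
  where
  rearrange : ∀ l m n → suc (l + suc (m + n)) ≡ suc (suc (m + l) + n)
  rearrange = solve-∀
  loop : ∀ (γ : List Bool → List Bool → Bool) fs ws vs →
    reverse (proj₂ (foldl (λ s _ → uncons (proj₁ s) s
        (λ p → kernel _⊕ᴸ_ (γ (proj₁ p)) (proj₂ p) , proj₁ p ∷ proj₂ s)) (ws , vs) fs))
      ≡ reverse vs ++ isotropic _⊕ᴸ_ γ fs ws
  loop γ []       ws       vs = sym (++-identityʳ (reverse vs))
  loop γ (f ∷ fs) []       vs = trans (loop γ fs [] vs) (cong (reverse vs ++_) (none fs))
    where
    none : ∀ fs → isotropic _⊕ᴸ_ γ fs [] ≡ []
    none []       = refl
    none (_ ∷ fs) = refl
  loop γ (f ∷ fs) (w ∷ ws) vs = trans (loop γ fs _ (w ∷ vs))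
    (trans (cong (_++ isotropic _⊕ᴸ_ γ fs (kernel _⊕ᴸ_ (γ w) ws)) (unfold-reverse w vs))
           (++-assoc (reverse vs) (w ∷ []) _))

constantDirectionsᶠ : {ms l : ⟦ Γ ⟧ → List (List Bool)} → FP ms → FP l →
  FP {Γ} {list bits} (λ x → constantDirections _⊕ᴸ_ (evaluateᴸ (ms x)) (l x))
constantDirectionsᶠ MS L = kernelᶠ
  (bool₂ᶠ _xor_ (evaluateᶠ (MS ∘ᶠ fstᶠ) sndᶠ) (evaluateᶠ (MS ∘ᶠ fstᶠ) (⊕ᶠ sndᶠ sndᶠ)))
  (isotropicᶠ
    (bool₂ᶠ _xor_
      (bool₂ᶠ _xor_ (evaluateᶠ (MS ∘ᶠ fstᶠ) (⊕ᶠ v w)) (evaluateᶠ (MS ∘ᶠ fstᶠ) v))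
      (bool₂ᶠ _xor_ (evaluateᶠ (MS ∘ᶠ fstᶠ) w) (evaluateᶠ (MS ∘ᶠ fstᶠ) (⊕ᶠ v v))))
    L)
  where
  v = fstᶠ ∘ᶠ sndᶠ
  w = sndᶠ ∘ᶠ sndᶠ

longerᶠ : {l : ⟦ Γ ⟧ → List ⟦ σ ⟧} {r : ⟦ Γ ⟧ → List ⟦ τ ⟧} →
  FP l → FP r → FP {Γ} {bit} (λ x → longer (l x) (r x))
longerᶠ {σ = σ} L R = unconsᶠ
  (foldl⁺ᶠ (unconsᶠ (sndᶠ ∘ᶠ sndᶠ) nilᶠ (sndᶠ ∘ᶠ fstᶠ)) L R (con 0)
    λ { x y [] → ≤-refl ; x y (z ∷ zs) → ≤-trans (m≤n+m _ (wt z)) (n≤1+n _) })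
  falseᶠ trueᶠ

wt-filterᵇ : ∀ {σ} (p : ⟦ σ ⟧ → Bool) xs → wt {list σ} (filterᵇ p xs) ≤ wt {list σ} xs
wt-filterᵇ p []       = ≤-refl
wt-filterᵇ p (x ∷ xs) with p x
... | true  = s≤s (+-monoʳ-≤ (wt x) (wt-filterᵇ p xs))
... | false = ≤-trans (wt-filterᵇ p xs) (≤-trans (m≤n+m _ (wt x)) (n≤1+n _))

wt-selectStep : ∀ (es : List (List Bool)) x b os →
  wt {bits ⊗ list bits} (selectStep _∙ᴸ_ es x (b , os)) ≤ suc (wt {bits} x) + wt {bits ⊗ list bits} (b , os)
wt-selectStep es x b os with longer (filterᵇ (x ∙ᴸ_) es) (filterᵇ (b ∙ᴸ_) es)
... | true  = ≤-refl
... | false = ≤-reflexive (rearrange (wt {bits} b) (wt {bits} x) (wt {list bits} os))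
  where
  rearrange : ∀ l m n → suc (l + suc (m + n)) ≡ suc m + suc (l + n)
  rearrange = solve-∀

wt-select : ∀ (es : List (List Bool)) x xs →
  wt {bits ⊗ list bits} (select _∙ᴸ_ es x xs) ≤ wt {list bits} (x ∷ xs)
wt-select es x []       = ≤-refl
wt-select es x (y ∷ xs) = ≤-trans (wt-selectStep es y _ _)
  (≤-trans (+-monoʳ-≤ (suc (wt {bits} y)) (wt-select es x xs))
    (≤-reflexive (rearrange (wt {bits} x) (wt {bits} y) (wt {list bits} xs))))
  where
  rearrange : ∀ l m n → suc m + suc (l + n) ≡ suc (l + suc (m + n))
  rearrange = solve-∀

selectᶠ : {es l : ⟦ Γ ⟧ → List (List Bool)} {x : ⟦ Γ ⟧ → List Bool} →
  FP es → FP x → FP l → FP {Γ} {bits ⊗ list bits} (λ γ → select _∙ᴸ_ (es γ) (x γ) (l γ))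
selectᶠ {Γ} {es} ES X L = foldr⁺ᶠ {τ = bits ⊗ list bits}
  (ifᶠ longerᶠ (filterᶠ (∙ᶠ (vertex ∘ᶠ fstᶠ) sndᶠ) (ES ∘ᶠ fstᶠ))
               (filterᶠ (∙ᶠ (best ∘ᶠ fstᶠ) sndᶠ) (ES ∘ᶠ fstᶠ))
   then (vertex ,ᶠ (best ∷ᶠ others)) else (best ,ᶠ (vertex ∷ᶠ others)))
  (X ,ᶠ nilᶠ) L (con 1 ⊞ var)
  λ γ y (b , os) → ≤-trans (wt-selectStep (es γ) y b os)
    (+-monoˡ-≤ _ (s≤s (m≤n+m (wt {bits} y) (wt γ))))
  where
  vertex best : FP {Γ ⊗ bits ⊗ bits ⊗ list bits} {bits} _
  vertex = fstᶠ ∘ᶠ sndᶠ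
  best   = fstᶠ ∘ᶠ sndᶠ ∘ᶠ sndᶠ
  others : FP {Γ ⊗ bits ⊗ bits ⊗ list bits} {list bits} _
  others = sndᶠ ∘ᶠ sndᶠ ∘ᶠ sndᶠ

independentSetᶠ : {l es : ⟦ Γ ⟧ → List (List Bool)} → FP l → FP es →
  FP {Γ} {list bits} (λ γ → independentSet _∙ᴸ_ (l γ) (es γ))
independentSetᶠ {Γ} L ES = fstᶠ ∘ᶠ foldl⁺ᶠ {τ = list bits ⊗ list bits}
  (unconsᶠ (sndᶠ ∘ᶠ sndᶠ ∘ᶠ sndᶠ) (sndᶠ ∘ᶠ sndᶠ)
    (unconsᶠ (fstᶠ ∘ᶠ sndᶠ ∘ᶠ sndᶠ ∘ᶠ sndᶠ) (sndᶠ ∘ᶠ sndᶠ ∘ᶠ sndᶠ)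
      (sndᶠ ∘ᶠ selected ,ᶠ
       filterᶠ (bool₂ᶠ (λ c _ → not c) (∙ᶠ (fstᶠ ∘ᶠ selected ∘ᶠ fstᶠ) sndᶠ) falseᶠ) es)))
  (L ,ᶠ ES) L (con 0)
  λ { x y (ws , []) → ≤-refl
    ; x y ([] , es@(_ ∷ _)) → ≤-refl
    ; x y (w ∷ ws , es@(_ ∷ _)) → s≤s (+-mono-≤
        (≤-trans (≤-trans (m≤n+m _ (wt {bits} (proj₁ (select _∙ᴸ_ es w ws)))) (n≤1+n _))
                 (wt-select es w ws))
        (wt-filterᵇ (λ e → not (proj₁ (select _∙ᴸ_ es w ws) ∙ᴸ e)) es)) }
  where
  es = sndᶠ ∘ᶠ sndᶠ ∘ᶠ sndᶠ ∘ᶠ sndᶠ ∘ᶠ sndᶠ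
  selected = selectᶠ es (fstᶠ ∘ᶠ fstᶠ) (sndᶠ ∘ᶠ fstᶠ)

edgesᶠ : {l ms : ⟦ Γ ⟧ → List (List Bool)} → FP l → FP ms →
  FP {Γ} {list bits} (λ γ → edges _∙ᴸ_ (λ x y z → x ⊕ᴸ (y ⊕ᴸ z)) (l γ) (ms γ))
edgesᶠ {Γ} {l} L MS = foldr⁺ᶠ
  (unconsᶠ (filterᶠ (∙ᶠ sndᶠ (fstᶠ ∘ᶠ sndᶠ ∘ᶠ fstᶠ)) (L ∘ᶠ fstᶠ)) (sndᶠ ∘ᶠ sndᶠ)
    (unconsᶠ (sndᶠ ∘ᶠ fstᶠ) (sndᶠ ∘ᶠ sndᶠ ∘ᶠ sndᶠ)
      (unconsᶠ (sndᶠ ∘ᶠ fstᶠ) (sndᶠ ∘ᶠ sndᶠ ∘ᶠ sndᶠ ∘ᶠ sndᶠ)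
        (⊕ᶠ (fstᶠ ∘ᶠ fstᶠ ∘ᶠ sndᶠ ∘ᶠ sndᶠ) (⊕ᶠ (fstᶠ ∘ᶠ fstᶠ ∘ᶠ sndᶠ) (fstᶠ ∘ᶠ fstᶠ)) ∷ᶠ
         sndᶠ ∘ᶠ sndᶠ ∘ᶠ sndᶠ ∘ᶠ sndᶠ ∘ᶠ sndᶠ))))
  nilᶠ MS (con 1 ⊞ (space L ∘ₚ var) )
  λ γ m es → grow (filterᵇ (_∙ᴸ m) (l γ)) es (≤-trans (wt-filterᵇ _ (l γ))
    (≤-trans (grows L γ) (≤-trans (eval-mono (space L) (m≤m+n (wt γ) _)) (eval-≤-∘ₚ (space L) var ≤-refl))))
  where
  grow : ∀ {N} as es → wt {list bits} as ≤ N →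
    wt {list bits} (firstThree (λ x y z → x ⊕ᴸ (y ⊕ᴸ z)) as es) ≤ suc N + wt {list bits} es
  grow {N} []              es as≤ = m≤n+m _ (suc N)
  grow {N} (_ ∷ [])        es as≤ = m≤n+m _ (suc N)
  grow {N} (_ ∷ _ ∷ [])    es as≤ = m≤n+m _ (suc N)
  grow {N} (a ∷ b ∷ c ∷ _) es as≤ = s≤s (+-monoˡ-≤ (wt {list bits} es)
    (≤-trans (wt-⊕ a _) (≤-trans (≤-trans (m≤m+n _ _) (n≤1+n _)) as≤)))

wt-map-∷ : ∀ b (us : List (List Bool)) →
  wt {list bits} (List.map (b ∷_) us) ≡ 2 * length us + wt {list bits} us
wt-map-∷ b []       = refl
wt-map-∷ b (u ∷ us) = trans (cong (λ w → suc (wt {bits} (b ∷ u) + w)) (wt-map-∷ b us))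
  (rearrange (wt {bits} u) (length us) (wt {list bits} us))
  where
  rearrange : ∀ l m n → suc (2 + l + (2 * m + n)) ≡ 2 * suc m + suc (l + n)
  rearrange = solve-∀

-- A step of `units` lengthens every vector collected so far, so its growth depends on the
-- accumulator and the additive criterion does not apply; exact weights replace it.
units-size : ∀ bs → (wt {bits} (proj₁ (units bs)) ≡ 1 + 2 * length bs) ×
  (length (proj₂ (units bs)) ≡ length bs) ×
  (wt {list bits} (proj₂ (units bs)) ≡ 1 + 2 * length bs * suc (length bs))
units-size []       = refl , refl , refl
units-size (_ ∷ bs) with units bs | units-size bs
... | z , us | z≡ , us≡ , wt≡ =
  trans (cong (2 +_) z≡) (rearrange₁ (length bs)) ,
  cong suc (trans (length-map (false ∷_) us) us≡) ,
  trans (cong₂ (λ a b → suc (suc (suc a) + b)) z≡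
    (trans (wt-map-∷ false us) (cong₂ (λ a b → 2 * a + b) us≡ wt≡)))
    (rearrange₂ (length bs))
  where
  rearrange₁ : ∀ n → 2 + (1 + 2 * n) ≡ 1 + 2 * suc n
  rearrange₁ = solve-∀
  rearrange₂ : ∀ n → suc (suc (suc (1 + 2 * n)) + (2 * n + (1 + 2 * n * suc n))) ≡ 1 + 2 * suc n * suc (suc n)
  rearrange₂ = solve-∀

unitsᶠ : {b : ⟦ Γ ⟧ → List Bool} → FP b → FP {Γ} {bits ⊗ list bits} (λ γ → units (b γ))
unitsᶠ B = foldrᶠ
  (falseᶠ ∷ᶠ fstᶠ ∘ᶠ sndᶠ ∘ᶠ sndᶠ ,ᶠ
   ((trueᶠ ∷ᶠ fstᶠ ∘ᶠ sndᶠ ∘ᶠ sndᶠ) ∷ᶠ mapᶠ (falseᶠ ∷ᶠ sndᶠ) (sndᶠ ∘ᶠ sndᶠ ∘ᶠ sndᶠ)))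
  (nilᶠ ,ᶠ nilᶠ) B (con 1 ⊞ ((con 1 ⊞ con 2 ⊠ var) ⊞ (con 1 ⊞ con 2 ⊠ var ⊠ (con 1 ⊞ var))))
  λ γ bs → let z≡ , _ , wt≡ = units-size bs ; n≤ = ≤-trans (length≤wt {bit} bs) (m≤n+m _ (wt γ)) in
    s≤s (+-mono-≤ (≤-trans (≤-reflexive z≡) (s≤s (*-monoʳ-≤ 2 n≤)))
      (≤-trans (≤-reflexive wt≡) (s≤s (*-mono-≤ (*-monoʳ-≤ 2 n≤) (s≤s n≤)))))

flatᶠ : FP {list bits ⊗ list bits ⊗ bits} {bits ⊗ list bits} flatᴸ
flatᶠ = sndᶠ ∘ᶠ sndᶠ ,ᶠ
  mapᶠ (mapᶠ (∙ᶠ sndᶠ (sndᶠ ∘ᶠ fstᶠ)) (fstᶠ ∘ᶠ sndᶠ ∘ᶠ fstᶠ))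
    (constantDirectionsᶠ fstᶠ (independentSetᶠ us (edgesᶠ us fstᶠ)))
  where
  us = sndᶠ ∘ᶠ unitsᶠ (sndᶠ ∘ᶠ sndᶠ)

-- The quality of greedy vertex deletion

evens odds : ℕ → ℕ
evens zero    = 1
evens (suc d) = 2 * (suc d * evens d)
odds zero    = 1
odds (suc d) = (3 + 2 * d) * odds d

-- m ≥ (3/2) f(D) (n - T/D) where D = suc d and f(D) = evens D / odds D.  As D
-- varies, the right-hand sides are the linear pieces of the interpolation of
-- n f(3T/n), in the average degree 3T/n, at integral degrees.
Large : ℕ → ℕ → ℕ → Set
Large m n T = ∀ d →
  3 * (evens (suc d) * (suc d * n)) ≤ 2 * (suc d * (odds (suc d) * m)) + 3 * (evens (suc d) * T)

-- The product f starts with the factor 2/3 and all later factors are below 1. Hence (3/2) f(D) n ≤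
-- n, which is what an edgeless hypergraph requires.
3*evens≤2*odds : ∀ d → 3 * evens (suc d) ≤ 2 * odds (suc d)
3*evens≤2*odds zero    = ≤-refl
3*evens≤2*odds (suc d) = begin
  3 * (2 * (suc (suc d) * e))           ≡⟨ l d e ⟩
  (4 + 2 * d) * (3 * e)                 ≤⟨ *-mono-≤ (+-monoˡ-≤ (2 * d) (n≤1+n 4)) (3*evens≤2*odds d) ⟩
  (5 + 2 * d) * (2 * o)                 ≡⟨ r d o ⟩
  2 * ((3 + 2 * suc d) * o)             ∎
  where
  open ≤-Reasoning
  e = evens (suc d)
  o = odds (suc d)
  l : ∀ d e → 3 * (2 * (suc (suc d) * e)) ≡ (4 + 2 * d) * (3 * e)
  l = solve-∀
  r : ∀ d o → (5 + 2 * d) * (2 * o) ≡ 2 * ((3 + 2 * suc d) * o)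
  r = solve-∀

Large-edgeless : ∀ n → Large n n 0
Large-edgeless n d = begin
  3 * (evens (suc d) * (suc d * n))            ≡⟨ l (evens (suc d)) (suc d) n ⟩
  (3 * evens (suc d)) * (suc d * n)            ≤⟨ *-monoˡ-≤ (suc d * n) (3*evens≤2*odds d) ⟩
  (2 * odds (suc d)) * (suc d * n)             ≡⟨ r (odds (suc d)) (suc d) n ⟩
  2 * (suc d * (odds (suc d) * n))             ≤⟨ m≤m+n _ _ ⟩
  2 * (suc d * (odds (suc d) * n)) + 3 * (evens (suc d) * 0) ∎
  where
  open ≤-Reasoning
  l : ∀ e d n → 3 * (e * (d * n)) ≡ (3 * e) * (d * n)
  l = solve-∀
  r : ∀ o d n → (2 * o) * (d * n) ≡ 2 * (d * (o * n))
  r = solve-∀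

-- The linear bounds for D and D + 1 agree at average degree D, and at smaller average degrees the
-- steeper one, for D, is the stronger.
Large-next : ∀ d m n T → 3 * T ≤ suc d * n →
  3 * (evens (suc d) * (suc d * n)) ≤ 2 * (suc d * (odds (suc d) * m)) + 3 * (evens (suc d) * T) →
  3 * (evens (suc (suc d)) * (suc (suc d) * n)) ≤
    2 * (suc (suc d) * (odds (suc (suc d)) * m)) + 3 * (evens (suc (suc d)) * T)
-- The factor `a` clears denominators, and `rest` is added to both sides so that no subtraction
-- occurs.
Large-next d m n T sparse large = *-cancelˡ-≤ a (+-cancelʳ-≤ rest _ _ (begin
  a * (3 * (2 * (b * p) * (b * n))) + rest   ≡⟨ l a p n T ⟩
  b * (main + p * (3 * (3 * T)))             ≤⟨ *-monoʳ-≤ b (+-monoʳ-≤ main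
                                                  (*-monoʳ-≤ p (*-monoʳ-≤ 3 sparse))) ⟩
  b * (main + p * (3 * (a * n)))             ≡⟨ c a p n T ⟩
  b * ((3 + 2 * a) * (3 * (p * (a * n))) + 6 * (a * (p * T)))
                                             ≤⟨ *-monoʳ-≤ b (+-monoˡ-≤ _
                                                  (*-monoʳ-≤ (3 + 2 * a) large)) ⟩
  b * ((3 + 2 * a) * (2 * (a * (q * m)) + 3 * (p * T)) + 6 * (a * (p * T)))
                                             ≡⟨ r a p q m T ⟩
  a * (2 * (b * ((3 + 2 * a) * q * m)) + 3 * (2 * (b * p) * T)) + rest ∎))
  where
  open ≤-Reasoning
  a = suc d
  b = suc a
  p = evens a
  q = odds a
  rest = b * ((3 + 2 * a) * (3 * (p * T)))
  main = 6 * (p * (a * (b * n))) + 6 * (a * (p * T))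
  l : ∀ a p n T → a * (3 * (2 * (suc a * p) * (suc a * n))) + suc a * ((3 + 2 * a) * (3 * (p * T)))
    ≡ suc a * (6 * (p * (a * (suc a * n))) + 6 * (a * (p * T)) + p * (3 * (3 * T)))
  l = solve-∀
  c : ∀ a p n T → suc a * (6 * (p * (a * (suc a * n))) + 6 * (a * (p * T)) + p * (3 * (a * n)))
    ≡ suc a * ((3 + 2 * a) * (3 * (p * (a * n))) + 6 * (a * (p * T)))
  c = solve-∀
  r : ∀ a p q m T →
    suc a * ((3 + 2 * a) * (2 * (a * (q * m)) + 3 * (p * T)) + 6 * (a * (p * T)))
    ≡ a * (2 * (suc a * ((3 + 2 * a) * q * m)) + 3 * (2 * (suc a * p) * T))
      + suc a * ((3 + 2 * a) * (3 * (p * T)))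
  r = solve-∀

-- Deleting a vertex of maximum degree Δ: the D-th bound survives directly if
-- D ≤ Δ, and otherwise it follows from the previous one because the average
-- degree is at most Δ.
Large-delete : ∀ {m n T} Δ → 1 ≤ Δ → 3 * (T + Δ) ≤ Δ * suc n → Large m n T → Large m (suc n) (T + Δ)
Large-delete {m} {n} {T} Δ 1≤Δ average large = go
  where
  open ≤-Reasoning
  l : ∀ e d n → 3 * (e * (d * suc n)) ≡ 3 * (e * (d * n)) + 3 * (e * d)
  l = solve-∀
  r : ∀ x e T Δ → x + 3 * (e * T) + 3 * (e * Δ) ≡ x + 3 * (e * (T + Δ))
  r = solve-∀
  go : Large m (suc n) (T + Δ)
  go d with suc d ≤? Δ
  ... | yes d≤ = begin
    3 * (evens (suc d) * (suc d * suc n))                           ≡⟨ l (evens (suc d)) (suc d) n ⟩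
    3 * (evens (suc d) * (suc d * n)) + 3 * (evens (suc d) * suc d) ≤⟨ +-mono-≤ (large d)
                                                                  (*-monoʳ-≤ 3 (*-monoʳ-≤ (evens (suc d)) d≤)) ⟩
    x + 3 * (evens (suc d) * T) + 3 * (evens (suc d) * Δ)           ≡⟨ r x (evens (suc d)) T Δ ⟩
    x + 3 * (evens (suc d) * (T + Δ)) ∎
    where x = 2 * (suc d * (odds (suc d) * m))
  go zero    | no ≰ with () ← ≰ 1≤Δ
  go (suc d) | no ≰ = Large-next d m (suc n) (T + Δ)
    (≤-trans average (*-monoˡ-≤ (suc n) (≤-pred (≰⇒> ≰)))) (go d)

Large-mono : ∀ {m n T U} → T ≤ U → Large m n T → Large m n U
Large-mono T≤U large d = ≤-trans (large d) (+-monoʳ-≤ (2 * (suc d * (odds (suc d) * _)))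
  (*-monoʳ-≤ 3 (*-monoʳ-≤ (evens (suc d)) T≤U)))

-- f(D)² D ≥ 5/8; this holds for D ≥ 3, as f(D)² D is increasing.
record Ratio (D p q : ℕ) : Set where
  constructor ratio
  field ratio≥ : 5 * (q * q) ≤ 8 * (D * (p * p))

Ratio-step : ∀ {D p q} → Ratio D p q → Ratio (suc D) (2 * (suc D * p)) ((3 + 2 * D) * q)
Ratio-step {D} {p} {q} (ratio h) = ratio (begin
  5 * ((3 + 2 * D) * q * ((3 + 2 * D) * q))           ≡⟨ l 5 D q ⟩
  (3 + 2 * D) * (3 + 2 * D) * (5 * (q * q))           ≤⟨ *-monoʳ-≤ ((3 + 2 * D) * (3 + 2 * D)) h ⟩
  -- The added term comes from 4(D+1)³ = D(2D+3)² + 3D + 4.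
  (3 + 2 * D) * (3 + 2 * D) * (8 * (D * (p * p)))    ≤⟨ m≤m+n _ (8 * ((3 * D + 4) * (p * p))) ⟩
  (3 + 2 * D) * (3 + 2 * D) * (8 * (D * (p * p))) + 8 * ((3 * D + 4) * (p * p)) ≡⟨ r 8 D p ⟩
  8 * (suc D * (2 * (suc D * p) * (2 * (suc D * p)))) ∎)
  where
  open ≤-Reasoning
  l : ∀ c D q → c * ((3 + 2 * D) * q * ((3 + 2 * D) * q)) ≡ (3 + 2 * D) * (3 + 2 * D) * (c * (q * q))
  l = solve-∀
  r : ∀ c D p → (3 + 2 * D) * (3 + 2 * D) * (c * (D * (p * p))) + c * ((3 * D + 4) * (p * p))
    ≡ c * (suc D * (2 * (suc D * p) * (2 * (suc D * p))))
  r = solve-∀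

Ratio-evens-odds : ∀ d → Ratio (3 + d) (evens (3 + d)) (odds (3 + d))
-- Here f(3) = 48/105 and 3 f(3)² = 0.626..., just above 5/8, whereas 2 f(2)² = 0.568... is below
-- it.
Ratio-evens-odds zero    = ratio (≤ᵇ⇒≤ (5 * (105 * 105)) (8 * (3 * (48 * 48))) tt)
Ratio-evens-odds (suc d) = Ratio-step (Ratio-evens-odds d)

1≤odds : ∀ d → 1 ≤ odds d
1≤odds zero    = ≤-refl
1≤odds (suc d) = *-mono-≤ {1} {3 + 2 * d} (s≤s z≤n) (1≤odds d)

-- Put N = Dn and X = 3T. The linear bound says m ≥ f(D) (3N - X) / (2D), and X (3N - X)² decreases
-- for X between N and 3N. As D ≥ 3, X is at most 4N/3, where 3X (3N - X)² is 100N³/9 and so at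
-- least 11N³. Together with 5/8 from `Ratio` this gives 55 = 11 · 5 and 288 = 8 · 3 · 3 · 2 · 2.
bound-at : ∀ {D p q n m T} → 3 ≤ D → 1 ≤ q → Ratio D p q → D * n ≤ 3 * T → 3 * T ≤ D * n + n →
  3 * (p * (D * n)) ≤ 2 * (D * (q * m)) + 3 * (p * T) → 55 * (n * (n * n)) ≤ 288 * (T * (m * m))
bound-at {D} {p} {q} {n} {m} {T} 3≤D 1≤q (ratio ratio≥) N≤X X≤ linear₀ =
  *-cancelˡ-≤ (D * q * (D * q)) {{nz}} (begin
    D * q * (D * q) * (11 * 5 * (n * (n * n)))
      ≡⟨ l₁ 11 5 D q n ⟩
    11 * (D * D * (n * (n * n))) * (5 * (q * q))
      ≤⟨ *-monoʳ-≤ (11 * (D * D * (n * (n * n)))) ratio≥ ⟩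
    11 * (D * D * (n * (n * n))) * (8 * (D * (p * p)))
      ≡⟨ l₂ 11 8 D p n ⟩
    8 * (p * p) * (11 * (N * (N * N)))
      ≤⟨ *-monoʳ-≤ (8 * (p * p)) cubic ⟩
    8 * (p * p) * (3 * (X * (s * s)))
      ≡⟨ l₃ 8 3 p X s ⟩
    8 * 3 * X * (p * s * (p * s))
      ≤⟨ *-monoʳ-≤ (8 * 3 * X) (*-mono-≤ linear linear) ⟩
    8 * 3 * (3 * T) * (2 * (D * (q * m)) * (2 * (D * (q * m))))
      ≡⟨ l₄ 8 3 2 T D q m ⟩
    D * q * (D * q) * (8 * 3 * 3 * 2 * 2 * (T * (m * m))) ∎)
    where
    open ≤-Reasoning
    X = 3 * T
    N = D * n
    u = X ∸ N
    X≡ : X ≡ N + u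
    X≡ = sym (m+[n∸m]≡n N≤X)
    u≤n : u ≤ n
    u≤n = +-cancelˡ-≤ N u n (≤-trans (≤-reflexive (sym X≡)) X≤)
    3u≤N : 3 * u ≤ N
    3u≤N = *-mono-≤ 3≤D u≤n
    v = N ∸ 3 * u
    N≡ : N ≡ 3 * u + v
    N≡ = sym (m+[n∸m]≡n 3u≤N)
    X≡′ : X ≡ 4 * u + v
    X≡′ = trans X≡ (trans (cong (_+ u) N≡) (e u v))
      where
      e : ∀ u v → 3 * u + v + u ≡ 4 * u + v
      e = solve-∀
    -- This is 3N - X, expressed without subtraction by u = X - N and v = N - 3u.
    s = 5 * u + 2 * v
    nz : NonZero (D * q * (D * q))
    nz = >-nonZero (*-mono-≤ {1} {D * q} 1≤Dq 1≤Dq)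
      where 1≤Dq = *-mono-≤ {1} {D} (≤-trans (s≤s z≤n) 3≤D) 1≤q
    linear : p * s ≤ 2 * (D * (q * m))
    linear = +-cancelʳ-≤ (p * X) _ _ (begin
      p * s + p * X             ≡⟨ cong (λ x → p * s + p * x) X≡′ ⟩
      p * s + p * (4 * u + v)   ≡⟨ e₁ p u v ⟩
      3 * (p * (3 * u + v))     ≡⟨ cong (λ x → 3 * (p * x)) N≡ ⟨
      3 * (p * N)               ≤⟨ linear₀ ⟩
      2 * (D * (q * m)) + 3 * (p * T) ≡⟨ cong (2 * (D * (q * m)) +_) (e₂ p T) ⟩
      2 * (D * (q * m)) + p * X ∎)
      where
      e₁ : ∀ p u v → p * (5 * u + 2 * v) + p * (4 * u + v) ≡ 3 * (p * (3 * u + v))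
      e₁ = solve-∀
      e₂ : ∀ p T → 3 * (p * T) ≡ p * (3 * T)
      e₂ = solve-∀
    cubic : 11 * (N * (N * N)) ≤ 3 * (X * (s * s))
    cubic = begin
      11 * (N * (N * N))
        ≡⟨ cong (λ x → 11 * (x * (x * x))) N≡ ⟩
      11 * ((3 * u + v) * ((3 * u + v) * (3 * u + v)))
        ≤⟨ m≤m+n _ (3 * (u * (u * u)) + 18 * (u * (u * v)) + 9 * (u * (v * v)) + v * (v * v)) ⟩
      11 * ((3 * u + v) * ((3 * u + v) * (3 * u + v))) +
        (3 * (u * (u * u)) + 18 * (u * (u * v)) + 9 * (u * (v * v)) + v * (v * v))
        ≡⟨ e u v ⟩
      3 * ((4 * u + v) * (s * s))
        ≡⟨ cong (λ x → 3 * (x * (s * s))) X≡′ ⟨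
      3 * (X * (s * s)) ∎
      where
      e : ∀ u v → 11 * ((3 * u + v) * ((3 * u + v) * (3 * u + v))) +
          (3 * (u * (u * u)) + 18 * (u * (u * v)) + 9 * (u * (v * v)) + v * (v * v))
        ≡ 3 * ((4 * u + v) * ((5 * u + 2 * v) * (5 * u + 2 * v)))
      e = solve-∀
    l₁ : ∀ a b D q n → D * q * (D * q) * (a * b * (n * (n * n))) ≡
      a * (D * D * (n * (n * n))) * (b * (q * q))
    l₁ = solve-∀
    l₂ : ∀ a b D p n → a * (D * D * (n * (n * n))) * (b * (D * (p * p))) ≡
      b * (p * p) * (a * (D * n * (D * n * (D * n))))
    l₂ = solve-∀
    l₃ : ∀ a b p X s → a * (p * p) * (b * (X * (s * s))) ≡ a * b * X * (p * s * (p * s))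
    l₃ = solve-∀
    l₄ : ∀ a b c T D q m → a * b * (b * T) * (c * (D * (q * m)) * (c * (D * (q * m)))) ≡
      D * q * (D * q) * (a * b * b * c * c * (T * (m * m)))
    l₄ = solve-∀

Large⇒bound : ∀ {m n T} → n ≤ T → Large m n T → 55 * (n * (n * n)) ≤ 288 * (T * (m * m))
Large⇒bound {m} {zero}      {T} n≤T large = z≤n
Large⇒bound {m} {n@(suc _)} {T} n≤T large
  with 3 * T ℕ./ n in D≡ | ≤-trans (≤-reflexive (sym (m*n/n≡m 3 n))) (/-monoˡ-≤ n (*-monoʳ-≤ 3 n≤T))
... | suc (suc (suc d)) | s≤s (s≤s (s≤s _)) = bound-at {n = n} {m} {T} (s≤s (s≤s (s≤s z≤n))) (1≤odds (3 + d)) (Ratio-evens-odds d)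
  (≤-trans (≤-reflexive (cong (_* n) (sym D≡))) (m/n*n≤m X n))
  (begin
    X                   ≡⟨ m≡m%n+[m/n]*n X n ⟩
    X % n + X ℕ./ n * n   ≡⟨ cong (λ e → X % n + e * n) D≡ ⟩
    X % n + (3 + d) * n ≤⟨ +-monoˡ-≤ _ (<⇒≤ (m%n<n X n)) ⟩
    n + (3 + d) * n     ≡⟨ +-comm n _ ⟩
    (3 + d) * n + n     ∎)
  -- `Large` is indexed by D - 1. The piece for D interpolates between the average degrees D - 1 and
  -- D; here it is extended to the next interval, which contains 3T/n.
  (large (2 + d))
  where
  open ≤-Reasoning
  X = 3 * T

-- After weakening m ≤ 2(k+1) to m ≤ 2(k+3), only the constants have to be compared: 32 · 288 · 4 =
-- 36864 is at most 55 · 675 = 37125.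
Large⇒dimension : ∀ {m n T} k → n ≤ T → Large m n T → m ≤ 2 * suc k →
  32 * (n * (n * n)) ≤ 675 * (T * ((k + 3) * (k + 3)))
Large⇒dimension {m} {n} {T} k n≤T large m≤ = *-cancelˡ-≤ 55 (begin
  55 * (32 * (n * (n * n)))                  ≡⟨ exchange 55 32 (n * (n * n)) ⟩
  32 * (55 * (n * (n * n)))                  ≤⟨ *-monoʳ-≤ 32 (Large⇒bound n≤T large) ⟩
  32 * (288 * (T * (m * m)))                 ≤⟨ *-monoʳ-≤ 32 (*-monoʳ-≤ 288 (*-monoʳ-≤ T (*-mono-≤ m≤′ m≤′))) ⟩
  32 * (288 * (T * (2 * K * (2 * K))))       ≡⟨ collect 32 288 2 T K ⟩
  32 * 288 * 2 * 2 * (T * (K * K))           ≤⟨ *-monoˡ-≤ (T * (K * K)) (≤ᵇ⇒≤ (32 * 288 * 2 * 2) (55 * 675) tt) ⟩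
  55 * 675 * (T * (K * K))                   ≡⟨ *-assoc 55 675 (T * (K * K)) ⟩
  55 * (675 * (T * (K * K)))                 ∎)
  where
  open ≤-Reasoning
  K = k + 3
  m≤′ : m ≤ 2 * K
  m≤′ = ≤-trans m≤ (*-monoʳ-≤ 2 (≤-trans (≤-reflexive (+-comm 1 k)) (+-monoʳ-≤ k (s≤s z≤n))))
  exchange : ∀ a b x → a * (b * x) ≡ b * (a * x)
  exchange = solve-∀
  collect : ∀ a b c T K → a * (b * (T * (c * K * (c * K)))) ≡ a * b * c * c * (T * (K * K))
  collect = solve-∀

-- Linear algebra over 𝔽₂

open import Data.Fin.Base using (Fin; zero; suc)

⊕-assoc : (x y z : 𝔽₂^ n) → x ⊕ y ⊕ z ≡ x ⊕ (y ⊕ z)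
⊕-assoc = zipWith-assoc xor-assoc

⊕-comm : (x y : 𝔽₂^ n) → x ⊕ y ≡ y ⊕ x
⊕-comm = zipWith-comm xor-comm

⊕-identityˡ : (x : 𝔽₂^ n) → 𝟎 ⊕ x ≡ x
⊕-identityˡ = zipWith-identityˡ (λ _ → refl)

⊕-identityʳ : (x : 𝔽₂^ n) → x ⊕ 𝟎 ≡ x
⊕-identityʳ = zipWith-identityʳ xor-identityʳ

⊕-self : (x : 𝔽₂^ n) → x ⊕ x ≡ 𝟎
⊕-self []      = refl
⊕-self (a ∷ x) = cong₂ _∷_ (xor-same a) (⊕-self x)

⊕-cancelʳ : (x y : 𝔽₂^ n) → x ⊕ y ⊕ y ≡ x
⊕-cancelʳ x y = trans (⊕-assoc x y y) (trans (cong (x ⊕_) (⊕-self y)) (⊕-identityʳ x))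

record IsSubspace (Q : 𝔽₂^ n → Set) : Set where
  field
    zero-closed : Q 𝟎
    ⊕-closed    : ∀ {x y} → Q x → Q y → Q (x ⊕ y)

open IsSubspace

-- Over 𝔽₂ a linear combination is the sum of a sublist, and a derivation records which vectors are
-- taken.
data Span {n} : List (𝔽₂^ n) → 𝔽₂^ n → Set where
  stop : Span [] 𝟎
  skip : ∀ {v vs x} → Span vs x → Span (v ∷ vs) x
  use  : ∀ {v vs x} → Span vs x → Span (v ∷ vs) (v ⊕ x)

Span-least : ∀ {Q : 𝔽₂^ n → Set} {vs} → IsSubspace Q → All Q vs → ∀ {x} → Span vs x → Q x
Span-least sub []       stop     = zero-closed sub
Span-least sub (q ∷ qs) (skip s) = Span-least sub qs s
Span-least sub (q ∷ qs) (use s)  = ⊕-closed sub q (Span-least sub qs s)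

Span-isSubspace : (vs : List (𝔽₂^ n)) → IsSubspace (Span vs)
Span-isSubspace vs = record { zero-closed = 𝟎∈ vs ; ⊕-closed = add }
  where
  𝟎∈ : (vs : List (𝔽₂^ n)) → Span vs 𝟎
  𝟎∈ []       = stop
  𝟎∈ (v ∷ vs) = skip (𝟎∈ vs)
  add : ∀ {vs : List (𝔽₂^ n)} {x y} → Span vs x → Span vs y → Span vs (x ⊕ y)
  add stop     stop     = subst (Span []) (sym (⊕-self 𝟎)) stop
  add (skip s) (skip t) = skip (add s t)
  add (use {v} {x = x} s) (skip {x = y} t) =
    subst (Span _) (sym (⊕-assoc v x y)) (use (add s t))
  add (skip {x = x} s) (use {v} {x = y} t) = subst (Span _)
    (trans (sym (⊕-assoc v x y)) (trans (cong (_⊕ y) (⊕-comm v x)) (⊕-assoc x v y)))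
    (use (add s t))
  add (use {v} {x = x} s) (use {x = y} t) = subst (Span _)
    (sym (trans (cong (_⊕ (v ⊕ y)) (⊕-comm v x)) (trans (sym (⊕-assoc (x ⊕ v) v y))
      (cong (_⊕ y) (⊕-cancelʳ x v)))))
    (skip (add s t))

Span-members : (vs : List (𝔽₂^ n)) → All (Span vs) vs
Span-members []       = []
Span-members (v ∷ vs) =
  subst (Span (v ∷ vs)) (⊕-identityʳ v) (use (zero-closed (Span-isSubspace vs))) ∷
  All.map skip (Span-members vs)

Span-⊆ : ∀ {us vs : List (𝔽₂^ n)} {x} → All (Span vs) us → Span us x → Span vs x
Span-⊆ {vs = vs} us⊆ = Span-least (Span-isSubspace vs) us⊆

Independent : List (𝔽₂^ n) → Set
Independent []       = ⊤
Independent (v ∷ vs) = ¬ Span vs v × Independent vs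

-- Additivity is relative to `Q` because the polar form of the polynomial is known to be bilinear
-- only on the coordinate subspace where the polynomial is quadratic.
AdditiveOn : (𝔽₂^ n → Set) → (𝔽₂^ n → 𝔽₂) → Set
AdditiveOn Q φ = ∀ {x y} → Q x → Q y → φ (x ⊕ y) ≡ φ x xor φ y

additive-zero : ∀ {Q : 𝔽₂^ n → Set} {φ} → IsSubspace Q → AdditiveOn Q φ → φ 𝟎 ≡ false
additive-zero {φ = φ} sub add = trans (cong φ (sym (⊕-self 𝟎)))
  (trans (add (zero-closed sub) (zero-closed sub)) (xor-same (φ 𝟎)))

zero-on-Span : ∀ {Q : 𝔽₂^ n → Set} {φ vs} → IsSubspace Q → AdditiveOn Q φ →
  All Q vs → All (λ v → φ v ≡ false) vs → ∀ {x} → Span vs x → φ x ≡ false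
zero-on-Span {Q = Q} {φ} {vs} sub add qs zs s =
  proj₂ (Span-least {Q = λ x → Q x × φ x ≡ false} both (All.zip (qs , zs)) s)
  where
  both : IsSubspace (λ x → Q x × φ x ≡ false)
  both = record
    { zero-closed = zero-closed sub , additive-zero {φ = φ} sub add
    ; ⊕-closed    = λ (qx , zx) (qy , zy) → ⊕-closed sub qx qy , trans (add qx qy) (cong₂ _xor_ zx zy) }

record IsKernel (φ : 𝔽₂^ n → 𝔽₂) (vs : List (𝔽₂^ n)) (pout : List (𝔽₂^ n) × List (𝔽₂^ n)) : Set where
  pivot = proj₁ pout
  out   = proj₂ pout
  field
    vanishes     : All (λ v → φ v ≡ false) out
    pivot-one    : All (λ v → φ v ≡ true) pivot
    spanned      : All (Span vs) out
    pivot-spanned : All (Span vs) pivot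
    independent  : Independent vs → Independent out
    pivot≤1      : length pivot ≤ 1
    dimension    : length vs ≡ length pivot + length out

open IsKernel

elimStep-isKernel : ∀ {Q : 𝔽₂^ n → Set} {φ x vs} → IsSubspace Q → AdditiveOn Q φ → Q x → All Q vs →
  ∀ p out → IsKernel φ vs (p , out) → IsKernel φ (x ∷ vs) (elimStep _⊕_ φ x (p , out))
elimStep-isKernel {φ = φ} {x} {vs} sub add q qs p out K with φ x in φx
... | false = record
  { vanishes      = φx ∷ vanishes K
  ; pivot-one     = pivot-one K
  ; spanned       = x∈ ∷ All.map skip (spanned K)
  ; pivot-spanned = All.map skip (pivot-spanned K)
  ; independent   = λ (x∉ , ind) → (λ s → x∉ (Span-⊆ (spanned K) s)) , independent K ind
  ; pivot≤1       = pivot≤1 K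
  ; dimension     = trans (cong suc (dimension K)) (sym (+-suc (length p) (length out)))
  }
  where x∈ = All.head (Span-members (x ∷ vs))
elimStep-isKernel {x = x} {vs} sub add q qs [] out K | true = record
  { vanishes      = vanishes K
  ; pivot-one     = φx ∷ []
  ; spanned       = All.map skip (spanned K)
  ; pivot-spanned = All.head (Span-members (x ∷ vs)) ∷ []
  ; independent   = λ (_ , ind) → independent K ind
  ; pivot≤1       = s≤s z≤n
  ; dimension     = cong suc (dimension K)
  }
elimStep-isKernel {x = x} {vs} sub add q qs (y ∷ p) out K | true = record
  { vanishes      = trans (add q (Span-least sub qs y∈)) (cong₂ _xor_ φx (All.head (pivot-one K))) ∷ vanishes K
  ; pivot-one     = pivot-one K
  ; spanned       = use y∈ ∷ All.map skip (spanned K)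
  ; pivot-spanned = All.map skip (pivot-spanned K)
  -- If `x ⊕ y` were in the span of the earlier output, adding the pivot `y` would put `x` into the
  -- span of `vs`.
  ; independent   = λ (x∉ , ind) →
      (λ s → x∉ (subst (Span vs) (⊕-cancelʳ x y) (⊕-closed (Span-isSubspace vs) (Span-⊆ (spanned K) s) y∈))) ,
      independent K ind
  ; pivot≤1       = pivot≤1 K
  ; dimension     = trans (cong suc (dimension K)) (sym (+-suc (length (y ∷ p)) (length out)))
  }
  where y∈ = All.head (pivot-spanned K)

eliminate-isKernel : ∀ {Q : 𝔽₂^ n → Set} {φ vs} → IsSubspace Q → AdditiveOn Q φ → All Q vs →
  IsKernel φ vs (eliminate _⊕_ φ vs)
eliminate-isKernel sub add [] = record
  { vanishes = [] ; pivot-one = [] ; spanned = [] ; pivot-spanned = []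
  ; independent = λ _ → tt ; pivot≤1 = z≤n ; dimension = refl }
eliminate-isKernel sub add (q ∷ qs) =
  elimStep-isKernel sub add q qs _ _ (eliminate-isKernel sub add qs)

module _ {Q : 𝔽₂^ n → Set} {φ : 𝔽₂^ n → 𝔽₂} {vs : List (𝔽₂^ n)}
         (sub : IsSubspace Q) (add : AdditiveOn Q φ) (vs⊆ : All Q vs) where

  private K = eliminate-isKernel {φ = φ} sub add vs⊆

  kernel-vanishes : All (λ v → φ v ≡ false) (kernel _⊕_ φ vs)
  kernel-vanishes = vanishes K

  kernel-spanned : All (Span vs) (kernel _⊕_ φ vs)
  kernel-spanned = spanned K

  kernel-independent : Independent vs → Independent (kernel _⊕_ φ vs)
  kernel-independent = independent K

  kernel-≥ : length vs ≤ suc (length (kernel _⊕_ φ vs))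
  kernel-≥ = ≤-trans (≤-reflexive (dimension K)) (+-monoˡ-≤ _ (pivot≤1 K))

  kernel-≤ : length (kernel _⊕_ φ vs) ≤ length vs
  kernel-≤ = ≤-trans (m≤n+m _ _) (≤-reflexive (sym (dimension K)))

module _ {Q : 𝔽₂^ n → Set} {β : 𝔽₂^ n → 𝔽₂^ n → 𝔽₂} (sub : IsSubspace Q)
         (β-sym : ∀ x y → β x y ≡ β y x) (β-self : ∀ x → β x x ≡ false)
         (β-add : ∀ {x} → Q x → AdditiveOn Q (β x)) where

  record IsIsotropic (ws vs : List (𝔽₂^ n)) : Set where
    field
      orthogonal  : All (λ v → All (λ w → β v w ≡ false) vs) vs
      spanned     : All (Span ws) vs
      independent : Independent vs
      dimension   : length ws ≤ 2 * length vs

  open IsIsotropic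

  isotropic-isIsotropic : ∀ fs ws → length ws ≤ length fs → All Q ws → Independent ws →
    IsIsotropic ws (isotropic _⊕_ β fs ws)
  isotropic-isIsotropic []       []       _ _ _ = record
    { orthogonal = [] ; spanned = [] ; independent = tt ; dimension = z≤n }
  isotropic-isIsotropic (_ ∷ fs) []       _ _ _ = record
    { orthogonal = [] ; spanned = [] ; independent = tt ; dimension = z≤n }
  isotropic-isIsotropic (_ ∷ fs) (w ∷ ws) (s≤s len) (q ∷ qs) (w∉ , ind) = record
    { orthogonal  = (β-self w ∷ w⊥) ∷ All.zipWith (λ (⊥w , ⊥vs) → trans (β-sym _ w) ⊥w ∷ ⊥vs) (w⊥ , orthogonal R)
    ; spanned     = All.head (Span-members (w ∷ ws)) ∷ All.map skip ⊆ws
    ; independent = (λ s → w∉ (Span-⊆ ⊆ws s)) , independent R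
    -- A round spends at most two dimensions, that of `w` and that of a dropped pivot, and gains one
    -- basis vector.
    ; dimension   = ≤-trans (s≤s (≤-trans (kernel-≥ sub (β-add q) qs) (s≤s (dimension R))))
                      (≤-reflexive (sym (*-suc 2 (length vs))))
    }
    where
    W  = kernel _⊕_ (β w) ws
    vs = isotropic _⊕_ β fs W
    R : IsIsotropic W vs
    R = isotropic-isIsotropic fs W (≤-trans (kernel-≤ sub (β-add q) qs) len)
          (All.map (Span-least sub qs) (kernel-spanned sub (β-add q) qs))
          (kernel-independent sub (β-add q) qs ind)
    w⊥ : All (λ v → β w v ≡ false) vs
    w⊥ = All.map (zero-on-Span sub (β-add q)
           (All.map (Span-least sub qs) (kernel-spanned sub (β-add q) qs))
           (kernel-vanishes sub (β-add q) qs)) (spanned R)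
    ⊆ws : All (Span ws) vs
    ⊆ws = All.map (Span-⊆ (kernel-spanned sub (β-add q) qs)) (spanned R)

  orthogonal-on-Span : ∀ {vs} → All Q vs → All (λ v → All (λ w → β v w ≡ false) vs) vs →
    ∀ {x y} → Span vs x → Span vs y → β x y ≡ false
  orthogonal-on-Span {vs} qs ⊥vs {x} {y} s t = trans (β-sym x y)
    (zero-on-Span sub (β-add (Span-least sub qs t)) qs
      (All.zipWith (λ {v} (q , ⊥v) → trans (β-sym y v) (zero-on-Span sub (β-add q) qs ⊥v t)) (qs , ⊥vs)) s)

module _ {Q : 𝔽₂^ n → Set} {g : 𝔽₂^ n → 𝔽₂} (sub : IsSubspace Q)
         (quadratic : ∀ {x} → Q x → AdditiveOn Q (polarity _⊕_ g x)) where

  private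
    β = polarity _⊕_ g
    λ₀ : 𝔽₂^ n → 𝔽₂
    λ₀ v = g v xor g (v ⊕ v)

    β-sym : ∀ x y → β x y ≡ β y x
    β-sym x y = trans (cong₂ (λ u v → (g u xor g x) xor (g y xor g v)) (⊕-comm x y)
        (trans (⊕-self x) (sym (⊕-self y))))
      (exchange (g (y ⊕ x)) (g x) (g y) (g (y ⊕ y)))
      where
      open xor-∧-Solver
      exchange : ∀ a b c d → (a xor b) xor (c xor d) ≡ (a xor c) xor (b xor d)
      exchange = solve 4 (λ a b c d → (a :+ b) :+ (c :+ d) := (a :+ c) :+ (b :+ d)) refl

    β-self : ∀ x → β x x ≡ false
    β-self x = trans (cong ((g (x ⊕ x) xor g x) xor_) (xor-comm (g x) (g (x ⊕ x))))
      (xor-same (g (x ⊕ x) xor g x))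

    -- As `v ⊕ v` is always the zero vector, `λ₀` is `g` without its constant term, and its failure
    -- to be additive is exactly the polar form.
    λ₀-additive : ∀ {x y} → β x y ≡ false → λ₀ (x ⊕ y) ≡ λ₀ x xor λ₀ y
    λ₀-additive {x} {y} β≡ = begin
      g (x ⊕ y) xor g (x ⊕ y ⊕ (x ⊕ y))
        ≡⟨ cong (λ z → g (x ⊕ y) xor g z) (trans (⊕-self (x ⊕ y)) (sym (⊕-self x))) ⟩
      g (x ⊕ y) xor o
        ≡⟨ regroup (g (x ⊕ y)) (g x) (g y) o ⟩
      β x y xor ((g x xor o) xor (g y xor o))
        ≡⟨ cong (_xor ((g x xor o) xor (g y xor o))) β≡ ⟩
      (g x xor o) xor (g y xor o)
        ≡⟨ cong (λ z → (g x xor o) xor (g y xor g z)) (trans (⊕-self x) (sym (⊕-self y))) ⟩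
      λ₀ x xor λ₀ y ∎
      where
      open ≡-Reasoning
      o = g (x ⊕ x)
      regroup : ∀ a b c o → a xor o ≡ ((a xor b) xor (c xor o)) xor ((b xor o) xor (c xor o))
      regroup = solve 4 (λ a b c o → a :+ o := ((a :+ b) :+ (c :+ o)) :+ ((b :+ o) :+ (c :+ o))) refl
        where open xor-∧-Solver

  module _ {ws : List (𝔽₂^ n)} (ws⊆ : All Q ws) (ind : Independent ws) where

    private
      vs = isotropic _⊕_ β ws ws
      R  = isotropic-isIsotropic sub β-sym β-self quadratic ws ws ≤-refl ws⊆ ind
      module R = IsIsotropic R
      vs⊆ : All Q vs
      vs⊆ = All.map (Span-least sub ws⊆) R.spanned
      λ₀-add : AdditiveOn (Span vs) λ₀
      λ₀-add s t = λ₀-additive (orthogonal-on-Span sub β-sym β-self quadratic vs⊆ R.orthogonal s t)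

    constantDirections-independent : Independent (constantDirections _⊕_ g ws)
    constantDirections-independent =
      kernel-independent (Span-isSubspace vs) λ₀-add (Span-members vs) R.independent

    constantDirections-constant : ∀ {x} → Span (constantDirections _⊕_ g ws) x → g x ≡ g 𝟎
    constantDirections-constant {x} s = trans (equal (g x) (g (x ⊕ x))
        (zero-on-Span (Span-isSubspace vs) λ₀-add
          (kernel-spanned (Span-isSubspace vs) λ₀-add (Span-members vs))
          (kernel-vanishes (Span-isSubspace vs) λ₀-add (Span-members vs)) s))
      (cong g (⊕-self x))
      where
      equal : ∀ a b → a xor b ≡ false → a ≡ b
      equal true  true  _ = refl
      equal false false _ = refl

    constantDirections-dimension : length ws ≤ 2 * suc (length (constantDirections _⊕_ g ws))
    constantDirections-dimension = ≤-trans R.dimension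
      (*-monoʳ-≤ 2 (kernel-≥ (Span-isSubspace vs) λ₀-add (Span-members vs)))

-- Quadratic polynomials

evaluate : List (Subset n) → 𝔽₂^ n → 𝔽₂
evaluate ms x = foldr _xor_ false (List.map (λ S → monomial S x) ms)

monomial-constant : (S : Subset n) → ∣ S ∣ ≤ 0 → ∀ x → monomial S x ≡ true
monomial-constant []          d≤ []      = refl
monomial-constant (false ∷ S) d≤ (a ∷ x) = monomial-constant S d≤ x

monomial-affine : (S : Subset n) → ∣ S ∣ ≤ 1 → ∀ x y →
  monomial S (x ⊕ y) ≡ (monomial S x xor monomial S y) xor monomial S 𝟎
monomial-affine []          d≤       []      []      = refl
monomial-affine (false ∷ S) d≤       (a ∷ x) (b ∷ y) = monomial-affine S d≤ x y
monomial-affine (true ∷ S)  (s≤s d≤) (a ∷ x) (b ∷ y)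
  rewrite monomial-constant S d≤ (x ⊕ y) | monomial-constant S d≤ x | monomial-constant S d≤ y =
  solve 2 (λ a b → (a :+ b) :* con true := (a :* con true :+ b :* con true) :+ con false) refl a b
  where open xor-∧-Solver

-- Splitting off a variable of `S` leaves a monomial of degree at most 1, whose values at sums are
-- sums of its values X, Y, Z, O at `x`, `y`, `z` and 0. An identity of Boolean polynomials remains.
monomial-quadratic : (S : Subset n) → ∣ S ∣ ≤ 2 → ∀ x y z →
  polarity _⊕_ (monomial S) x (y ⊕ z) ≡ polarity _⊕_ (monomial S) x y xor polarity _⊕_ (monomial S) x z
monomial-quadratic []          d≤       []      []      []      = refl
monomial-quadratic (false ∷ S) d≤       (a ∷ x) (b ∷ y) (c ∷ z) = monomial-quadratic S d≤ x y z
monomial-quadratic (true ∷ S)  (s≤s d≤) (a ∷ x) (b ∷ y) (c ∷ z)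
  rewrite ⊕-self x | monomial-affine S d≤ x (y ⊕ z) | monomial-affine S d≤ y z
        | monomial-affine S d≤ x y | monomial-affine S d≤ x z | xor-same a =
  solve 7 (λ a b c X Y Z O →
      ((a :+ (b :+ c)) :* (X :+ (Y :+ Z :+ O) :+ O) :+ a :* X) :+ ((b :+ c) :* (Y :+ Z :+ O) :+ con false) :=
      (((a :+ b) :* (X :+ Y :+ O) :+ a :* X) :+ (b :* Y :+ con false)) :+
      (((a :+ c) :* (X :+ Z :+ O) :+ a :* X) :+ (c :* Z :+ con false)))
    refl a b c (monomial S x) (monomial S y) (monomial S z) (monomial S 𝟎)
  where open xor-∧-Solver

monomial-zero : (S : Subset n) (x : 𝔽₂^ n) (i : Fin n) →
  lookup S i ≡ true → lookup x i ≡ false → monomial S x ≡ false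
monomial-zero (true ∷ S) (false ∷ x) zero    refl refl = refl
monomial-zero (s ∷ S)    (a ∷ x)     (suc i) Si   xi   =
  trans (cong ((if s then a else true) ∧_) (monomial-zero S x i Si xi)) (∧-zeroʳ _)

VanishesOutside : (Fin n → Set) → 𝔽₂^ n → Set
VanishesOutside P x = ∀ i → ¬ P i → lookup x i ≡ false

VanishesOutside-isSubspace : (P : Fin n → Set) → IsSubspace (VanishesOutside P)
VanishesOutside-isSubspace P = record
  { zero-closed = λ i _ → Vec.lookup-replicate i false
  ; ⊕-closed    = λ {x} {y} x0 y0 i ¬p →
      trans (Vec.lookup-zipWith _xor_ i x y) (cong₂ _xor_ (x0 i ¬p) (y0 i ¬p)) }

-- A monomial with a variable outside `P` is zero on the whole coordinate subspace, so only degrees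
-- at most 2 contribute there; polarity is linear in the polynomial, which allows treating monomials
-- one by one.
evaluate-quadratic : (P : Fin n → Set) (ms : List (Subset n)) →
  All (λ S → ∣ S ∣ ≤ 2 ⊎ ∃ λ i → lookup S i ≡ true × ¬ P i) ms →
  ∀ {x} → VanishesOutside P x → AdditiveOn (VanishesOutside P) (polarity _⊕_ (evaluate ms) x)
evaluate-quadratic P []       []           qx qy qz = refl
evaluate-quadratic P (S ∷ ms) (low ∷ lows) {x} qx {y} {z} qy qz = begin
  β (S ∷ ms) x (y ⊕ z)
    ≡⟨ split x (y ⊕ z) ⟩
  μ x (y ⊕ z) xor β ms x (y ⊕ z)
    ≡⟨ cong₂ _xor_ (head low) (evaluate-quadratic P ms lows qx qy qz) ⟩
  (μ x y xor μ x z) xor (β ms x y xor β ms x z)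
    ≡⟨ exchange (μ x y) (μ x z) (β ms x y) (β ms x z) ⟩
  (μ x y xor β ms x y) xor (μ x z xor β ms x z)
    ≡⟨ cong₂ _xor_ (split x y) (split x z) ⟨
  β (S ∷ ms) x y xor β (S ∷ ms) x z ∎
  where
  open ≡-Reasoning
  open xor-∧-Solver
  β = λ ms → polarity _⊕_ (evaluate ms)
  μ = polarity _⊕_ (monomial S)
  exchange : ∀ a b c d → (a xor b) xor (c xor d) ≡ (a xor c) xor (b xor d)
  exchange = solve 4 (λ a b c d → (a :+ b) :+ (c :+ d) := (a :+ c) :+ (b :+ d)) refl
  split : ∀ x y → β (S ∷ ms) x y ≡ μ x y xor β ms x y
  split x y = solve 8 (λ a b c d e f g h →
      ((a :+ b) :+ (c :+ d)) :+ ((e :+ f) :+ (g :+ h)) :=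
      ((a :+ c) :+ (e :+ g)) :+ ((b :+ d) :+ (f :+ h))) refl
    (monomial S (x ⊕ y)) (evaluate ms (x ⊕ y)) (monomial S x) (evaluate ms x)
    (monomial S y) (evaluate ms y) (monomial S (x ⊕ x)) (evaluate ms (x ⊕ x))
  closed : ∀ {v w} → VanishesOutside P v → VanishesOutside P w → VanishesOutside P (v ⊕ w)
  closed {v} {w} = ⊕-closed (VanishesOutside-isSubspace P) {v} {w}
  head : (∣ S ∣ ≤ 2 ⊎ ∃ λ i → lookup S i ≡ true × ¬ P i) → μ x (y ⊕ z) ≡ μ x y xor μ x z
  head (inj₁ d≤)            = monomial-quadratic S d≤ x y z
  head (inj₂ (i , Si , ¬p)) = trans (none x (y ⊕ z) qx (closed {y} {z} qy qz))
    (sym (cong₂ _xor_ (none x y qx qy) (none x z qx qz)))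
    where
    off : ∀ w → VanishesOutside P w → monomial S w ≡ false
    off w qw = monomial-zero S w i Si (qw i ¬p)
    none : ∀ v w → VanishesOutside P v → VanishesOutside P w → μ v w ≡ false
    none v w qv qw = cong₂ _xor_ (cong₂ _xor_ (off (v ⊕ w) (closed {v} {w} qv qw)) (off v qv))
                                 (cong₂ _xor_ (off w qw) (off (v ⊕ v) (closed {v} {v} qv qv)))

-- Counting

count : (A → Bool) → List A → ℕ
count p xs = length (filterᵇ p xs)

bitℕ : Bool → ℕ
bitℕ b = if b then 1 else 0

count-∷ : ∀ (p : A → Bool) x xs → count p (x ∷ xs) ≡ bitℕ (p x) + count p xs
count-∷ p x xs with p x
... | true  = refl
... | false = refl

count-↭ : ∀ (p : A → Bool) {xs ys} → xs ↭ ys → count p xs ≡ count p ys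
count-↭ p refl = refl
count-↭ p {x ∷ xs} {x ∷ ys} (prep x r) =
  trans (count-∷ p x xs) (trans (cong (bitℕ (p x) +_) (count-↭ p r)) (sym (count-∷ p x ys)))
count-↭ p {x ∷ y ∷ xs} {y ∷ x ∷ ys} (swap x y r) = begin
  count p (x ∷ y ∷ xs)                        ≡⟨ trans (count-∷ p x (y ∷ xs)) (cong (bitℕ (p x) +_) (count-∷ p y xs)) ⟩
  bitℕ (p x) + (bitℕ (p y) + count p xs)      ≡⟨ +-assoc-comm (bitℕ (p x)) (bitℕ (p y)) (count p xs) ⟩
  bitℕ (p y) + (bitℕ (p x) + count p xs)      ≡⟨ cong (λ c → bitℕ (p y) + (bitℕ (p x) + c)) (count-↭ p r) ⟩
  bitℕ (p y) + (bitℕ (p x) + count p ys)      ≡⟨ trans (count-∷ p y (x ∷ ys)) (cong (bitℕ (p y) +_) (count-∷ p x ys)) ⟨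
  count p (y ∷ x ∷ ys)                        ∎
  where
  open ≡-Reasoning
  +-assoc-comm : ∀ a b c → a + (b + c) ≡ b + (a + c)
  +-assoc-comm = solve-∀
count-↭ p (compose r s) = trans (count-↭ p r) (count-↭ p s)

count-cong : ∀ {p q : A → Bool} → (∀ x → p x ≡ q x) → ∀ xs → count p xs ≡ count q xs
count-cong eq [] = refl
count-cong {p = p} {q} eq (x ∷ xs) = trans (count-∷ p x xs)
  (trans (cong₂ _+_ (cong bitℕ (eq x)) (count-cong eq xs)) (sym (count-∷ q x xs)))

count-map : ∀ {B : Set} (p : B → Bool) (f : A → B) xs → count p (List.map f xs) ≡ count (p ∘ f) xs
count-map p f []       = refl
count-map p f (x ∷ xs) = trans (count-∷ p (f x) (List.map f xs))
  (trans (cong (bitℕ (p (f x)) +_) (count-map p f xs)) (sym (count-∷ (p ∘ f) x xs)))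

count-xor : ∀ {p q : A → Bool} → (∀ x → p x ≡ true → q x ≡ false) →
  ∀ xs → count (λ x → p x xor q x) xs ≡ count p xs + count q xs
count-xor disj [] = refl
count-xor {p = p} {q} disj (x ∷ xs) = begin
  count (λ x → p x xor q x) (x ∷ xs)                        ≡⟨ count-∷ (λ x → p x xor q x) x xs ⟩
  bitℕ (p x xor q x) + count (λ x → p x xor q x) xs         ≡⟨ cong₂ _+_ (disjoint (p x) (q x) (disj x)) (count-xor disj xs) ⟩
  (bitℕ (p x) + bitℕ (q x)) + (count p xs + count q xs)     ≡⟨ exchange (bitℕ (p x)) (bitℕ (q x)) (count p xs) (count q xs) ⟩
  (bitℕ (p x) + count p xs) + (bitℕ (q x) + count q xs)     ≡⟨ cong₂ _+_ (count-∷ p x xs) (count-∷ q x xs) ⟨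
  count p (x ∷ xs) + count q (x ∷ xs)                       ∎
  where
  open ≡-Reasoning
  exchange : ∀ a b c d → (a + b) + (c + d) ≡ (a + c) + (b + d)
  exchange = solve-∀
  disjoint : ∀ a b → (a ≡ true → b ≡ false) → bitℕ (a xor b) ≡ bitℕ a + bitℕ b
  disjoint false b     _ = refl
  disjoint true  false _ = refl
  disjoint true  true  h with () ← h refl

length-filter-not : ∀ (p : A → Bool) xs → length xs ≡ length (filterᵇ (not ∘ p) xs) + count p xs
length-filter-not p [] = refl
length-filter-not p (x ∷ xs) with p x
... | true  = trans (cong suc (length-filter-not p xs)) (sym (+-suc _ _))
... | false = cong suc (length-filter-not p xs)

All-filterᵇ : ∀ {P : A → Set} (p : A → Bool) {xs} → All P xs → All (λ x → P x × p x ≡ true) (filterᵇ p xs)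
All-filterᵇ p [] = []
All-filterᵇ p {x ∷ xs} (px ∷ pxs) with p x in eq
... | true  = (px , eq) ∷ All-filterᵇ p pxs
... | false = All-filterᵇ p pxs

All-unfilter : ∀ {P : A → Set} (p : A → Bool) xs → (∀ x → p x ≡ true → P x) →
  All P (filterᵇ (not ∘ p) xs) → All P xs
All-unfilter p [] hit rest = []
All-unfilter p (x ∷ xs) hit rest with p x in eq
... | true  = hit x eq ∷ All-unfilter p xs hit rest
All-unfilter p (x ∷ xs) hit (px ∷ rest) | false = px ∷ All-unfilter p xs hit rest

Unique-resp-↭ : ∀ {xs ys : List A} → xs ↭ ys → Unique xs → Unique ys
Unique-resp-↭ refl         u                        = u
Unique-resp-↭ (prep x r)   (x∉ ∷ u)                 = All-resp-↭ r x∉ ∷ Unique-resp-↭ r u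
Unique-resp-↭ (swap x y r) ((x≢y ∷ x∉) ∷ (y∉ ∷ u)) =
  ((x≢y ∘ sym) ∷ All-resp-↭ r y∉) ∷ All-resp-↭ r x∉ ∷ Unique-resp-↭ r u
Unique-resp-↭ (compose r s)  u                        = Unique-resp-↭ s (Unique-resp-↭ r u)

-- Greedy vertex deletion

longer-true : (xs : List A) (ys : List E) → longer xs ys ≡ true → length ys ≤ length xs
longer-true xs       []       _  = z≤n
longer-true []       (y ∷ ys) eq = ⊥-elim (never ys eq)
  where
  never : (ys : List E) → longer {A} [] ys ≡ true → ⊥
  never []       ()
  never (y ∷ ys) eq = never ys eq
longer-true (x ∷ xs) (y ∷ ys) eq = s≤s (longer-true xs ys eq)

longer-false : (xs : List A) (ys : List E) → longer xs ys ≡ false → length xs ≤ length ys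
longer-false []       ys       _  = z≤n
longer-false (x ∷ xs) []       ()
longer-false (x ∷ xs) (y ∷ ys) eq = s≤s (longer-false xs ys eq)

module _ (_∈ₑ_ : A → E → Bool) where

  degree : A → List E → ℕ
  degree x es = count (x ∈ₑ_) es

  edgeSize : List A → E → ℕ
  edgeSize ws e = count (_∈ₑ e) ws

  select-↭ : ∀ es x xs → let b , os = select _∈ₑ_ es x xs in x ∷ xs ↭ b ∷ os
  select-↭ es x []       = ↭-refl
  select-↭ es x (y ∷ xs) with select _∈ₑ_ es x xs | select-↭ es x xs
  ... | b , os | r with longer (filterᵇ (y ∈ₑ_) es) (filterᵇ (b ∈ₑ_) es)
  ... | true  = compose (swap x y ↭-refl) (prep y r)
  ... | false = compose (swap x y ↭-refl) (compose (prep y r) (swap y b ↭-refl))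

  select-max : ∀ es x xs → let b , os = select _∈ₑ_ es x xs in
    All (λ y → degree y es ≤ degree b es) (b ∷ os)
  select-max es x []       = ≤-refl ∷ []
  select-max es x (y ∷ xs) with select _∈ₑ_ es x xs | select-max es x xs
  ... | b , os | max with longer (filterᵇ (y ∈ₑ_) es) (filterᵇ (b ∈ₑ_) es) in eq
  ... | true  = ≤-refl ∷ All.map (λ d≤ → ≤-trans d≤ (longer-true (filterᵇ (y ∈ₑ_) es) (filterᵇ (b ∈ₑ_) es) eq)) max
  ... | false with b≤ ∷ os≤ ← max = b≤ ∷ longer-false (filterᵇ (y ∈ₑ_) es) (filterᵇ (b ∈ₑ_) es) eq ∷ os≤

  sumSizes : List A → List E → ℕ
  sumSizes ws es = sum (List.map (edgeSize ws) es)

  -- Double counting of incidences, one vertex at a time: the edge sizes sum to 3 times the number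
  -- of edges and the degrees to at most Δ times the number of vertices.
  sumSizes-∷ : ∀ x ws es → sumSizes (x ∷ ws) es ≡ degree x es + sumSizes ws es
  sumSizes-∷ x ws []       = refl
  sumSizes-∷ x ws (e ∷ es) = begin
    edgeSize (x ∷ ws) e + sumSizes (x ∷ ws) es
      ≡⟨ cong₂ _+_ (count-∷ (_∈ₑ e) x ws) (sumSizes-∷ x ws es) ⟩
    (bitℕ (x ∈ₑ e) + edgeSize ws e) + (degree x es + sumSizes ws es)
      ≡⟨ exchange (bitℕ (x ∈ₑ e)) (edgeSize ws e) (degree x es) (sumSizes ws es) ⟩
    (bitℕ (x ∈ₑ e) + degree x es) + (edgeSize ws e + sumSizes ws es)
      ≡⟨ cong (_+ _) (count-∷ (x ∈ₑ_) e es) ⟨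
    degree x (e ∷ es) + sumSizes ws (e ∷ es) ∎
    where
    open ≡-Reasoning
    exchange : ∀ a b c d → (a + b) + (c + d) ≡ (a + c) + (b + d)
    exchange = solve-∀

  sumSizes-≤ : ∀ ws es {Δ} → All (λ x → degree x es ≤ Δ) ws → sumSizes ws es ≤ Δ * length ws
  sumSizes-≤ [] es [] = ≤-trans (≤-reflexive (none es)) z≤n
    where
    none : ∀ es → sumSizes [] es ≡ 0
    none []       = refl
    none (e ∷ es) = none es
  sumSizes-≤ (x ∷ ws) es {Δ} (d≤ ∷ ds≤) = ≤-trans (≤-reflexive (sumSizes-∷ x ws es))
    (≤-trans (+-mono-≤ d≤ (sumSizes-≤ ws es ds≤)) (≤-reflexive (sym (*-suc Δ (length ws)))))

  sumSizes-uniform : ∀ ws {es} → All (λ e → edgeSize ws e ≡ 3) es → sumSizes ws es ≡ 3 * length es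
  sumSizes-uniform ws []            = refl
  sumSizes-uniform ws {_ ∷ es} (eq ∷ eqs) = trans (cong₂ _+_ eq (sumSizes-uniform ws eqs)) (sym (*-suc 3 (length es)))

  record IsLargeIndependent (ws : List A) (es : List E) (is : List A) : Set where
    field
      large       : Large (length is) (length ws) (length es)
      unique      : Unique is
      included    : ∀ {x} → x ∈ is → x ∈ ws
      independent : All (λ e → ∃ λ x → (x ∈ₑ e ≡ true) × x ∉ is) es

  open IsLargeIndependent

  private
    run : List A → List A → List E → List A
    run fs ws es = proj₁ (foldl (λ s _ → greedyStep _∈ₑ_ s) (ws , es) fs)

    run-edgeless : ∀ fs ws → run fs ws [] ≡ ws
    run-edgeless []       ws = refl
    run-edgeless (_ ∷ fs) ws = run-edgeless fs ws

    edgeless : ∀ {ws} → Unique ws → IsLargeIndependent ws [] ws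
    edgeless {ws} u = record
      { large = Large-edgeless (length ws) ; unique = u ; included = λ x∈ → x∈ ; independent = [] }

    -- Edges through the deleted vertex disappear and the others do not contain it, so 3-uniformity
    -- persists on the remaining vertices. The vertices cannot run out before the edges, since an
    -- edge would then have size 0.
    run-isLargeIndependent : ∀ fs ws es → length ws ≤ length fs → Unique ws →
      All (λ e → edgeSize ws e ≡ 3) es → IsLargeIndependent ws es (run fs ws es)
    run-isLargeIndependent fs ws [] _ u _ =
      subst (IsLargeIndependent ws []) (sym (run-edgeless fs ws)) (edgeless u)
    run-isLargeIndependent []       []       (e ∷ es) _   u (() ∷ _)
    run-isLargeIndependent (f ∷ fs) []       (e ∷ es) _   u (() ∷ _)
    run-isLargeIndependent (f ∷ fs) (w ∷ ws) es@(_ ∷ es⁻) (s≤s len) u uniform =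
      delete (select _∈ₑ_ es w ws) (select-↭ es w ws) (select-max es w ws)
      where
      delete : ∀ s → let b , os = s in w ∷ ws ↭ b ∷ os → All (λ y → degree y es ≤ degree b es) (b ∷ os) →
        IsLargeIndependent (w ∷ ws) es (run fs os (filterᵇ (λ e → not (b ∈ₑ e)) es))
      delete (b , os) r max = step
        where
        Δ   = degree b es
        es′ = filterᵇ (λ e → not (b ∈ₑ e)) es
        |os| : length ws ≡ length os
        |os| = suc-injective (↭-length r)
        R : IsLargeIndependent os es′ (run fs os es′)
        R with Unique-resp-↭ r u
        ... | _ ∷ u′ = run-isLargeIndependent fs os es′ (≤-trans (≤-reflexive (sym |os|)) len) u′
          (All.map (λ {e} (e≡3 , b∉e) → trans (smaller (b ∈ₑ e) b∉e (trans (sym (count-∷ (_∈ₑ e) b os))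
              (trans (sym (count-↭ (_∈ₑ e) r)) e≡3))) refl)
            (All-filterᵇ (λ e → not (b ∈ₑ e)) uniform))
          where
          smaller : ∀ {c m} a → not a ≡ true → bitℕ a + c ≡ m → c ≡ m
          smaller false _ eq = eq
        average : 3 * length es ≤ Δ * suc (length ws)
        average = ≤-trans (≤-reflexive (sym (sumSizes-uniform (w ∷ ws) uniform)))
          (sumSizes-≤ (w ∷ ws) es (All-resp-↭ (↭-sym r) max))
        |es| : length es ≡ length es′ + Δ
        |es| = length-filter-not (b ∈ₑ_) es
        1≤Δ : 1 ≤ Δ
        1≤Δ = positive Δ average
          where
          positive : ∀ d → 3 * suc (length es⁻) ≤ d * suc (length ws) → 1 ≤ d
          positive (suc d) _ = s≤s z≤n
        step : IsLargeIndependent (w ∷ ws) es (run fs os es′)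
        step = record
          { large       = subst (Large (length (run fs os es′)) (suc (length ws))) (sym |es|)
              (Large-delete Δ 1≤Δ (subst (λ t → 3 * t ≤ Δ * suc (length ws)) |es| average)
                (subst (λ m → Large (length (run fs os es′)) m (length es′)) (sym |os|) (large R)))
          ; unique      = unique R
          ; included    = λ x∈ → ∈-resp-↭ (↭-sym r) (there (included R x∈))
          -- A removed edge contains `b`, which is no longer among the vertices and hence is never
          -- kept.
          ; independent = All-unfilter (b ∈ₑ_) es (λ e b∈e → b , b∈e , λ b∈ → b∉os (included R b∈)) (independent R)
          }
          where
          b∉os : b ∉ os
          b∉os b∈ with Unique-resp-↭ r u
          ... | b∉ ∷ _ = All.lookup b∉ b∈ refl

  independentSet-isLargeIndependent : ∀ ws es → Unique ws → All (λ e → edgeSize ws e ≡ 3) es →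
    IsLargeIndependent ws es (independentSet _∈ₑ_ ws es)
  independentSet-isLargeIndependent ws es = run-isLargeIndependent ws ws es ≤-refl

-- The hypergraph of the monomials of degree at least 3

unit : Fin n → 𝔽₂^ n
unit zero    = true ∷ 𝟎
unit (suc i) = false ∷ unit i

lookup-𝟎 : (i : Fin n) → lookup 𝟎 i ≡ false
lookup-𝟎 i = Vec.lookup-replicate i false

lookup-unit : (a i : Fin n) → lookup (unit a) i ≡ true → i ≡ a
lookup-unit zero    zero    _  = refl
lookup-unit zero    (suc i) eq with () ← trans (sym (lookup-𝟎 i)) eq
lookup-unit (suc a) (suc i) eq = cong suc (lookup-unit a i eq)

lookup-unit-≢ : {a i : Fin n} → i ≢ a → lookup (unit a) i ≡ false
lookup-unit-≢ {a = a} {i} i≢a with lookup (unit a) i in eq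
... | false = refl
... | true  = ⊥-elim (i≢a (lookup-unit a i eq))

count-allFin : (p : Fin (suc n) → Bool) → count p (allFin (suc n)) ≡ bitℕ (p zero) + count (p ∘ suc) (allFin n)
count-allFin {n} p = trans (count-∷ p zero _) (cong (bitℕ (p zero) +_)
  (trans (cong (count p) (sym (map-tabulate id suc))) (count-map p suc (allFin n))))

count-unit : (a : Fin n) → count (lookup (unit a)) (allFin n) ≡ 1
count-unit {suc n} zero = trans (count-allFin (lookup (unit {suc n} zero))) (cong suc (none (allFin n)))
  where
  none : ∀ {n} (is : List (Fin n)) → count (lookup 𝟎) is ≡ 0
  none []       = refl
  none (i ∷ is) = trans (count-∷ (lookup 𝟎) i is)
    (cong₂ _+_ (cong bitℕ (lookup-𝟎 i)) (none is))
count-unit (suc a) = trans (count-allFin (lookup (unit (suc a)))) (count-unit a)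

count-lookup : (S : Subset n) → count (lookup S) (allFin n) ≡ ∣ S ∣
count-lookup []          = refl
count-lookup (true ∷ S)  = trans (count-allFin (lookup (true ∷ S))) (cong suc (count-lookup S))
count-lookup (false ∷ S) = trans (count-allFin (lookup (false ∷ S))) (count-lookup S)

triple : Fin n → Fin n → Fin n → 𝔽₂^ n
triple a b c = unit a ⊕ (unit b ⊕ unit c)

lookup-triple : (a b c i : Fin n) →
  lookup (triple a b c) i ≡ lookup (unit a) i xor (lookup (unit b) i xor lookup (unit c) i)
lookup-triple a b c i = trans (Vec.lookup-zipWith _xor_ i (unit a) (unit b ⊕ unit c))
  (cong (lookup (unit a) i xor_) (Vec.lookup-zipWith _xor_ i (unit b) (unit c)))

-- Equal unit vectors would cancel over 𝔽₂; distinctness makes the sum the characteristic vector of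
-- a 3-element set.
count-triple : {a b c : Fin n} → a ≢ b → a ≢ c → b ≢ c → count (lookup (triple a b c)) (allFin n) ≡ 3
count-triple {n} {a} {b} {c} a≢b a≢c b≢c = begin
  count (lookup (triple a b c)) (allFin n)
    ≡⟨ count-cong (lookup-triple a b c) (allFin n) ⟩
  count (λ i → lookup (unit a) i xor (lookup (unit b) i xor lookup (unit c) i)) (allFin n)
    ≡⟨ count-xor (λ i ia → cong₂ _xor_ (off (lookup-unit a i ia) a≢b) (off (lookup-unit a i ia) a≢c)) (allFin n) ⟩
  count (lookup (unit a)) (allFin n) + count (λ i → lookup (unit b) i xor lookup (unit c) i) (allFin n)
    ≡⟨ cong₂ _+_ (count-unit a) (trans (count-xor (λ i ib → off (lookup-unit b i ib) b≢c) (allFin n))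
         (cong₂ _+_ (count-unit b) (count-unit c))) ⟩
  3 ∎
  where
  open ≡-Reasoning
  off : ∀ {i x y} → i ≡ x → x ≢ y → lookup (unit y) i ≡ false
  off refl x≢y = lookup-unit-≢ x≢y

_∈ˢ_ : Fin n → Subset n → Bool
i ∈ˢ S = lookup S i

record HasEdge (es : List (𝔽₂^ n)) (S : Subset n) : Set where
  field
    edge  : 𝔽₂^ n
    edge∈ : edge ∈ es
    edge⊆ : ∀ i → lookup edge i ≡ true → lookup S i ≡ true

record IsHypergraph (ms : List (Subset n)) (es : List (𝔽₂^ n)) : Set where
  field
    uniform : All (λ e → count (_∈ˢ e) (allFin n) ≡ 3) es
    covers  : All (λ S → ∣ S ∣ ≤ 2 ⊎ HasEdge es S) ms
    few     : length es ≤ length ms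

hypergraph : List (Subset n) → List (𝔽₂^ n)
hypergraph {n} ms = edges _∈ˢ_ triple (allFin n) ms

hypergraph-isHypergraph : (ms : List (Subset n)) → IsHypergraph ms (hypergraph ms)
hypergraph-isHypergraph []       = record { uniform = [] ; covers = [] ; few = z≤n }
hypergraph-isHypergraph {n} (S ∷ ms) = extend (filterᵇ (_∈ˢ S) (allFin n))
    (filter⁺ (λ i → T? (i ∈ˢ S)) (allFin⁺ n))
    (All.map proj₂ (All-filterᵇ {P = λ _ → ⊥ → ⊥} (_∈ˢ S) (All.universal (λ _ ()) (allFin n))))
    (≤-reflexive (sym (count-lookup S)))
    (hypergraph-isHypergraph ms)
  where
  open IsHypergraph
  later : ∀ {e es} {T : Subset n} → ∣ T ∣ ≤ 2 ⊎ HasEdge es T → ∣ T ∣ ≤ 2 ⊎ HasEdge (e ∷ es) T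
  later (inj₁ d≤) = inj₁ d≤
  later (inj₂ h)  = inj₂ (record { edge = edge ; edge∈ = there edge∈ ; edge⊆ = edge⊆ })
    where open HasEdge h
  -- `is` lists the variables of `S`. If there are at most two, the degree is at most 2 and no edge
  -- is added.
  extend : ∀ {es} (is : List (Fin n)) → Unique is → All (λ i → i ∈ˢ S ≡ true) is →
    ∣ S ∣ ≤ length is → IsHypergraph ms es → IsHypergraph (S ∷ ms) (firstThree triple is es)
  extend [] u all d≤ H = record
    { uniform = uniform H ; covers = inj₁ (≤-trans d≤ z≤n) ∷ covers H ; few = m≤n⇒m≤1+n (few H) }
  extend (a ∷ []) u all d≤ H = record
    { uniform = uniform H ; covers = inj₁ (≤-trans d≤ (s≤s z≤n)) ∷ covers H ; few = m≤n⇒m≤1+n (few H) }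
  extend (a ∷ b ∷ []) u all d≤ H = record
    { uniform = uniform H ; covers = inj₁ d≤ ∷ covers H ; few = m≤n⇒m≤1+n (few H) }
  extend (a ∷ b ∷ c ∷ _) ((a≢b ∷ a≢c ∷ _) ∷ (b≢c ∷ _) ∷ _) (Sa ∷ Sb ∷ Sc ∷ _) d≤ H = record
    { uniform = count-triple a≢b a≢c b≢c ∷ uniform H
    ; covers  = inj₂ (record { edge = triple a b c ; edge∈ = here refl ; edge⊆ = inside }) ∷
                All.map later (covers H)
    ; few     = s≤s (few H)
    }
    where
    inside : ∀ i → lookup (triple a b c) i ≡ true → lookup S i ≡ true
    inside i eq with lookup (unit a) i in ia | lookup (unit b) i in ib | lookup (unit c) i in ic
                   | trans (sym (lookup-triple a b c i)) eq
    ... | true  | _     | _     | _ = trans (cong (lookup S) (lookup-unit a i ia)) Sa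
    ... | false | true  | _     | _ = trans (cong (lookup S) (lookup-unit b i ib)) Sb
    ... | false | false | true  | _ = trans (cong (lookup S) (lookup-unit c i ic)) Sc

keptVariables : List (Subset n) → List (Fin n)
keptVariables {n} ms = independentSet _∈ˢ_ (allFin n) (hypergraph ms)

module _ (ms : List (Subset n)) where

  private
    H = hypergraph-isHypergraph ms
    I = independentSet-isLargeIndependent _∈ˢ_ (allFin n) (hypergraph ms) (allFin⁺ n) (IsHypergraph.uniform H)

  keptVariables-unique : Unique (keptVariables ms)
  keptVariables-unique = IsLargeIndependent.unique I

  keptVariables-large : Large (length (keptVariables ms)) n (length ms)
  -- Monomials of degree at most 2 yield no edge, so there may be fewer edges than monomials; the
  -- bound weakens as T grows.
  keptVariables-large = Large-mono (IsHypergraph.few H)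
    (subst (λ l → Large (length (keptVariables ms)) l (length (hypergraph ms))) (length-tabulate id)
      (IsLargeIndependent.large I))

  keptVariables-quadratic : All (λ S → ∣ S ∣ ≤ 2 ⊎ ∃ λ i → lookup S i ≡ true × ¬ i ∈ keptVariables ms) ms
  keptVariables-quadratic = All.map killed (IsHypergraph.covers H)
    where
    killed : ∀ {S} → ∣ S ∣ ≤ 2 ⊎ HasEdge (hypergraph ms) S →
      ∣ S ∣ ≤ 2 ⊎ ∃ λ i → lookup S i ≡ true × ¬ i ∈ keptVariables ms
    killed (inj₁ d≤) = inj₁ d≤
    killed (inj₂ h) with i , i∈e , i∉ ← All.lookup (IsLargeIndependent.independent I) (HasEdge.edge∈ h) =
      inj₂ (i , HasEdge.edge⊆ h i i∈e , i∉)

-- The algorithm in two representations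

module _ {A B : Set} {_+ᵃ_ : A → A → A} {_+ᵇ_ : B → B → B} (h : A → B)
         (hom : ∀ x y → h (x +ᵃ y) ≡ h x +ᵇ h y) where

  private
    map₂ : List A × List A → List B × List B
    map₂ (p , q) = List.map h p , List.map h q

  elimStep-map : ∀ {φ ψ} → (∀ x → ψ (h x) ≡ φ x) → ∀ x s →
    elimStep _+ᵇ_ ψ (h x) (map₂ s) ≡ map₂ (elimStep _+ᵃ_ φ x s)
  elimStep-map {φ} {ψ} ψh x (p , out) with ψ (h x) | φ x | ψh x
  ... | false | _ | refl = refl
  elimStep-map ψh x ([] , out)    | true | _ | refl = refl
  elimStep-map ψh x (y ∷ p , out) | true | _ | refl =
    cong (λ z → h y ∷ List.map h p , z ∷ List.map h out) (sym (hom x y))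

  eliminate-map : ∀ {φ ψ} → (∀ x → ψ (h x) ≡ φ x) → ∀ xs →
    eliminate _+ᵇ_ ψ (List.map h xs) ≡ map₂ (eliminate _+ᵃ_ φ xs)
  eliminate-map ψh []       = refl
  eliminate-map {φ} {ψ} ψh (x ∷ xs) =
    trans (cong (elimStep _+ᵇ_ ψ (h x)) (eliminate-map ψh xs)) (elimStep-map {ψ = ψ} ψh x (eliminate _+ᵃ_ φ xs))

  kernel-map : ∀ {φ ψ} → (∀ x → ψ (h x) ≡ φ x) → ∀ xs →
    kernel _+ᵇ_ ψ (List.map h xs) ≡ List.map h (kernel _+ᵃ_ φ xs)
  kernel-map {ψ = ψ} ψh xs = cong proj₂ (eliminate-map {ψ = ψ} ψh xs)

  isotropic-map : ∀ {β γ} → (∀ x y → γ (h x) (h y) ≡ β x y) → ∀ fs ws →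
    isotropic _+ᵇ_ γ (List.map h fs) (List.map h ws) ≡ List.map h (isotropic _+ᵃ_ β fs ws)
  isotropic-map γh []       ws       = refl
  isotropic-map γh (_ ∷ fs) []       = refl
  isotropic-map {γ = γ} γh (_ ∷ fs) (w ∷ ws) = cong (h w ∷_)
    (trans (cong (isotropic _+ᵇ_ γ (List.map h fs)) (kernel-map {ψ = γ (h w)} (γh w) ws)) (isotropic-map {γ = γ} γh fs _))

  -- The algorithm touches vectors only through their sum and the evaluation, so a map compatible
  -- with these two commutes with it. For `toList` this carries results about vectors over to the
  -- bit lists of the program.
  constantDirections-map : ∀ {ev ev′} → (∀ x → ev′ (h x) ≡ ev x) → ∀ ws →
    constantDirections _+ᵇ_ ev′ (List.map h ws) ≡ List.map h (constantDirections _+ᵃ_ ev ws)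
  constantDirections-map {ev} {ev′} evh ws = trans
    (cong (kernel _+ᵇ_ (λ v → ev′ v xor ev′ (v +ᵇ v)))
      (isotropic-map {γ = polarity _+ᵇ_ ev′} (λ x y → cong₂ _xor_ (cong₂ _xor_ (ev⊕ x y) (evh x)) (cong₂ _xor_ (evh y) (ev⊕ x x))) ws ws))
    (kernel-map {ψ = λ v → ev′ v xor ev′ (v +ᵇ v)} (λ v → cong₂ _xor_ (evh v) (ev⊕ v v)) (isotropic _+ᵃ_ (polarity _+ᵃ_ ev) ws ws))
    where
    ev⊕ : ∀ x y → ev′ (h x +ᵇ h y) ≡ ev (x +ᵃ y)
    ev⊕ x y = trans (cong ev′ (sym (hom x y))) (evh (x +ᵃ y))

filterᵇ-map : ∀ {A B : Set} {p : A → Bool} {q : B → Bool} (f : A → B) → (∀ x → q (f x) ≡ p x) →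
  ∀ xs → filterᵇ q (List.map f xs) ≡ List.map f (filterᵇ p xs)
filterᵇ-map f qf [] = refl
filterᵇ-map {p = p} {q} f qf (x ∷ xs) with q (f x) | p x | qf x
... | true  | _ | refl = cong (f x ∷_) (filterᵇ-map f qf xs)
... | false | _ | refl = filterᵇ-map f qf xs

longer-map : ∀ {A B : Set} (f : A → B) xs ys → longer (List.map f xs) (List.map f ys) ≡ longer xs ys
longer-map f []       []       = refl
longer-map f (x ∷ xs) []       = refl
longer-map f []       (y ∷ ys) = longer-map f [] ys
longer-map f (x ∷ xs) (y ∷ ys) = longer-map f xs ys

module _ {A B E F : Set} {_∈ᵃ_ : A → E → Bool} {_∈ᵇ_ : B → F → Bool} (h : A → B) (k : E → F)
         (∈-map : ∀ x e → h x ∈ᵇ k e ≡ x ∈ᵃ e) where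

  private
    map₁ : A × List A → B × List B
    map₁ (b , os) = h b , List.map h os

  selectStep-map : ∀ es x s →
    selectStep _∈ᵇ_ (List.map k es) (h x) (map₁ s) ≡ map₁ (selectStep _∈ᵃ_ es x s)
  selectStep-map es x (b , os) = trans
    (cong (λ c → if c then (h x , h b ∷ List.map h os) else (h b , h x ∷ List.map h os))
      (trans (cong₂ longer (filterᵇ-map k (∈-map x) es) (filterᵇ-map k (∈-map b) es))
               (longer-map k (filterᵇ (x ∈ᵃ_) es) (filterᵇ (b ∈ᵃ_) es))))
    (branch (longer (filterᵇ (x ∈ᵃ_) es) (filterᵇ (b ∈ᵃ_) es)))
    where
    branch : ∀ c → (if c then (h x , h b ∷ List.map h os) else (h b , h x ∷ List.map h os)) ≡
      map₁ (if c then (x , b ∷ os) else (b , x ∷ os))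
    branch true  = refl
    branch false = refl

  select-map : ∀ es x xs →
    select _∈ᵇ_ (List.map k es) (h x) (List.map h xs) ≡ map₁ (select _∈ᵃ_ es x xs)
  select-map es x []       = refl
  select-map es x (y ∷ xs) = trans
    (cong (selectStep _∈ᵇ_ (List.map k es) (h y)) (select-map es x xs)) (selectStep-map es y _)

  private
    map₂ : List A × List E → List B × List F
    map₂ (ws , es) = List.map h ws , List.map k es

  greedyStep-map : ∀ s → greedyStep _∈ᵇ_ (map₂ s) ≡ map₂ (greedyStep _∈ᵃ_ s)
  greedyStep-map (ws     , [])         = refl
  greedyStep-map ([]     , es@(_ ∷ _)) = refl
  greedyStep-map (w ∷ ws , es@(_ ∷ _)) = trans
    (cong (λ s → proj₂ s , filterᵇ (λ e → not (proj₁ s ∈ᵇ e)) (List.map k es)) (select-map es w ws))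
    (cong (List.map h (proj₂ (select _∈ᵃ_ es w ws)) ,_)
      (filterᵇ-map {p = λ e → not (b ∈ᵃ e)} {λ e → not (h b ∈ᵇ e)} k (λ e → cong not (∈-map b e)) es))
    where b = proj₁ (select _∈ᵃ_ es w ws)

  independentSet-map : ∀ ws es →
    independentSet _∈ᵇ_ (List.map h ws) (List.map k es) ≡ List.map h (independentSet _∈ᵃ_ ws es)
  independentSet-map ws es = cong proj₁ (run ws (ws , es))
    where
    run : ∀ fs s → foldl (λ s _ → greedyStep _∈ᵇ_ s) (map₂ s) (List.map h fs) ≡
      map₂ (foldl (λ s _ → greedyStep _∈ᵃ_ s) s fs)
    run []       s = refl
    run (_ ∷ fs) s = trans
      (cong (λ r → foldl (λ s _ → greedyStep _∈ᵇ_ s) r (List.map h fs)) (greedyStep-map s))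
      (run fs (greedyStep _∈ᵃ_ s))

module _ {A B E F M N : Set} {_∈ᵃ_ : A → M → Bool} {_∈ᵇ_ : B → N → Bool}
         {mkᵃ : A → A → A → E} {mkᵇ : B → B → B → F} (h : A → B) (k : E → F) (l : M → N)
         (∈-map : ∀ x m → h x ∈ᵇ l m ≡ x ∈ᵃ m) (mk-map : ∀ x y z → mkᵇ (h x) (h y) (h z) ≡ k (mkᵃ x y z)) where

  firstThree-map : ∀ as es →
    firstThree mkᵇ (List.map h as) (List.map k es) ≡ List.map k (firstThree mkᵃ as es)
  firstThree-map []              es = refl
  firstThree-map (_ ∷ [])        es = refl
  firstThree-map (_ ∷ _ ∷ [])    es = refl
  firstThree-map (a ∷ b ∷ c ∷ _) es = cong (_∷ List.map k es) (mk-map a b c)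

  edges-map : ∀ as ms → edges _∈ᵇ_ mkᵇ (List.map h as) (List.map l ms) ≡ List.map k (edges _∈ᵃ_ mkᵃ as ms)
  edges-map as []       = refl
  edges-map as (m ∷ ms) = trans
    (cong₂ (firstThree mkᵇ) (filterᵇ-map h (λ x → ∈-map x m) as) (edges-map as ms))
    (firstThree-map (filterᵇ (_∈ᵃ m) as) (edges _∈ᵃ_ mkᵃ as ms))

toList-⊕ : (x y : 𝔽₂^ n) → toList (x ⊕ y) ≡ toList x ⊕ᴸ toList y
toList-⊕ []      []      = refl
toList-⊕ (a ∷ x) (b ∷ y) = cong ((a xor b) ∷_) (toList-⊕ x y)

toList-∙ : (x y : 𝔽₂^ n) → toList x ∙ᴸ toList y ≡ x ∙ y
toList-∙ []      []      = refl
toList-∙ (a ∷ x) (b ∷ y) = cong ((a ∧ b) xor_) (toList-∙ x y)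

𝟎-∙ : (x : 𝔽₂^ n) → 𝟎 ∙ x ≡ false
𝟎-∙ []      = refl
𝟎-∙ (a ∷ x) = 𝟎-∙ x

unit-∙ : (i : Fin n) (x : 𝔽₂^ n) → unit i ∙ x ≡ lookup x i
unit-∙ zero    (a ∷ x) = trans (cong (a xor_) (𝟎-∙ x)) (xor-identityʳ a)
unit-∙ (suc i) (a ∷ x) = unit-∙ i x

toList-monomial : (S : Subset n) (x : 𝔽₂^ n) → monomialᴸ (toList S) (toList x) ≡ monomial S x
toList-monomial []      []      = refl
toList-monomial (s ∷ S) (a ∷ x) = cong ((if s then a else true) ∧_) (toList-monomial S x)

toList-evaluate : (ms : List (Subset n)) (x : 𝔽₂^ n) →
  evaluateᴸ (List.map toList ms) (toList x) ≡ evaluate ms x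
toList-evaluate []       x = refl
toList-evaluate (S ∷ ms) x = cong₂ _xor_ (toList-monomial S x) (toList-evaluate ms x)

units-toList : (b : 𝔽₂^ n) → units (toList b) ≡ (toList (𝟎 {n}) , List.map (toList ∘ unit) (allFin n))
units-toList []               = refl
units-toList {suc n} (_ ∷ b) = trans (cong unitsStep (units-toList b))
  (cong (λ us → false ∷ toList (𝟎 {n}) , (true ∷ toList (𝟎 {n})) ∷ us) (begin
    List.map (false ∷_) (List.map (toList ∘ unit) (allFin n))      ≡⟨ map-∘ (allFin n) ⟨
    List.map (toList ∘ unit {suc n} ∘ suc) (allFin n)              ≡⟨ map-∘ (allFin n) ⟩
    List.map (toList ∘ unit) (List.map suc (allFin n))             ≡⟨ cong (List.map (toList ∘ unit)) (map-tabulate id suc) ⟩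
    List.map (toList ∘ unit) (List.tabulate suc)                   ∎))
  where open ≡-Reasoning

directions : List (Subset n) → List (𝔽₂^ n)
directions ms = constantDirections _⊕_ (evaluate ms) (List.map unit (keptVariables ms))

keptᴸ-toList : (ms : List (Subset n)) (b : 𝔽₂^ n) →
  keptᴸ (List.map toList ms) (toList b) ≡ List.map (toList ∘ unit) (keptVariables ms)
keptᴸ-toList {n} ms b rewrite units-toList b = trans
  (cong (independentSet _∙ᴸ_ (List.map (toList ∘ unit) (allFin n)))
    (edges-map (toList ∘ unit) toList toList ∈-map
      (λ x y z → sym (trans (toList-⊕ (unit x) (unit y ⊕ unit z))
        (cong (toList (unit x) ⊕ᴸ_) (toList-⊕ (unit y) (unit z))))) (allFin n) ms))
  (independentSet-map (toList ∘ unit) toList ∈-map (allFin n) (hypergraph ms))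
  where
  ∈-map : (i : Fin n) (x : 𝔽₂^ n) → toList (unit i) ∙ᴸ toList x ≡ lookup x i
  ∈-map i x = trans (toList-∙ (unit i) x) (unit-∙ i x)

directions-toList : (ms : List (Subset n)) (b : 𝔽₂^ n) →
  constantDirections _⊕ᴸ_ (evaluateᴸ (List.map toList ms)) (keptᴸ (List.map toList ms) (toList b))
    ≡ List.map toList (directions ms)
directions-toList ms b = trans
  (cong (constantDirections _⊕ᴸ_ (evaluateᴸ (List.map toList ms)))
    (trans (keptᴸ-toList ms b) (map-∘ (keptVariables ms))))
  (constantDirections-map toList toList-⊕ {ev′ = evaluateᴸ (List.map toList ms)} (toList-evaluate ms) (List.map unit (keptVariables ms)))

-- The flat

-- All vectors in the span of the later units vanish at coordinate `i`, where `unit i` does not.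
units-independent : {is : List (Fin n)} → Unique is → Independent (List.map unit is)
units-vanish : (is : List (Fin n)) → All (VanishesOutside (_∈ is)) (List.map unit is)

units-vanish []       = []
units-vanish (i ∷ is) = (λ j j∉ → lookup-unit-≢ (λ j≡i → j∉ (here j≡i))) ∷
  All.map (λ v j j∉ → v j (j∉ ∘ there)) (units-vanish is)

units-independent []                      = tt
units-independent {is = i ∷ is} (i∉ ∷ u) = outside , units-independent u
  where
  lookup-unit-self : (i : Fin n) → lookup (unit i) i ≡ true
  lookup-unit-self zero    = refl
  lookup-unit-self (suc i) = lookup-unit-self i
  outside : ¬ Span (List.map unit is) (unit i)
  outside s with () ← trans (sym (lookup-unit-self i))
    (Span-least (VanishesOutside-isSubspace (_∈ is)) (units-vanish is) s i (λ i∈ → All.lookup i∉ i∈ refl))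

module _ (ms : List (Subset n)) where

  private
    Q = VanishesOutside (_∈ keptVariables ms)
    sub = VanishesOutside-isSubspace (_∈ keptVariables ms)
    quadratic : ∀ {x} → Q x → AdditiveOn Q (polarity _⊕_ (evaluate ms) x)
    quadratic {x} = evaluate-quadratic (_∈ keptVariables ms) ms (keptVariables-quadratic ms) {x}
    ws⊆ = units-vanish (keptVariables ms)
    ind = units-independent (keptVariables-unique ms)

  directions-independent : Independent (directions ms)
  directions-independent = constantDirections-independent {g = evaluate ms} sub (λ {x} → quadratic {x}) ws⊆ ind

  directions-constant : ∀ {x} → Span (directions ms) x → evaluate ms x ≡ evaluate ms 𝟎
  directions-constant = constantDirections-constant {g = evaluate ms} sub (λ {x} → quadratic {x}) ws⊆ ind

  directions-dimension : n ≤ length ms → let k = length (directions ms) in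
    32 * (n * (n * n)) ≤ 675 * (length ms * ((k + 3) * (k + 3)))
  directions-dimension n≤T = Large⇒dimension (length (directions ms)) n≤T (keptVariables-large ms)
    (≤-trans (≤-reflexive (sym (length-map unit (keptVariables ms))))
      (constantDirections-dimension {g = evaluate ms} sub (λ {x} → quadratic {x}) ws⊆ ind))

∙-⊕ : (r x y : 𝔽₂^ n) → r ∙ (x ⊕ y) ≡ (r ∙ x) xor (r ∙ y)
∙-⊕ []      []      []      = refl
∙-⊕ (r ∷ rs) (a ∷ x) (b ∷ y) = trans (cong₂ _xor_ (∧-distribˡ-xor r a b) (∙-⊕ rs x y))
  (solve 4 (λ a b c d → (a :+ b) :+ (c :+ d) := (a :+ c) :+ (b :+ d)) refl
    (r ∧ a) (r ∧ b) (rs ∙ x) (rs ∙ y))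
  where open xor-∧-Solver

linear : ∀ {m} → Vec (𝔽₂^ n) m → 𝔽₂^ n → 𝔽₂^ m
linear rows x = Vec.map (_∙ x) rows

linear-⊕ : ∀ {m} (rows : Vec (𝔽₂^ n) m) x y → linear rows (x ⊕ y) ≡ linear rows x ⊕ linear rows y
linear-⊕ []         x y = refl
linear-⊕ (r ∷ rows) x y = cong₂ _∷_ (∙-⊕ r x y) (linear-⊕ rows x y)

linear-𝟎 : ∀ {m} (rows : Vec (𝔽₂^ n) m) → linear rows 𝟎 ≡ 𝟎
linear-𝟎 rows = trans (sym (⊕-cancelʳ (linear rows 𝟎) (linear rows 𝟎)))
  (trans (cong (_⊕ linear rows 𝟎) (trans (sym (linear-⊕ rows 𝟎 𝟎)) (cong (linear rows) (⊕-self 𝟎))))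
    (⊕-self (linear rows 𝟎)))

scale-false : (v : 𝔽₂^ n) → Vec.map (false ∧_) v ≡ 𝟎
scale-false v = Vec.map-const v false

-- Flats are presented by coefficient vectors, whereas the algorithm is analysed through `Span`;
-- this passes from one to the other. The last component uses independence: a leading coefficient 1
-- in a zero sum would put `v` into the span of the rest.
combination-image : ∀ {m} (rows : Vec (𝔽₂^ n) m) (vs : List (𝔽₂^ n))
  (cs : 𝔽₂^ (length (List.map (linear rows) vs))) → ∃ λ x → Span vs x ×
    (combination cs (fromList (List.map (linear rows) vs)) ≡ linear rows x) ×
    (Independent vs → x ≡ 𝟎 → cs ≡ 𝟎)
combination-image rows []       []           = 𝟎 , stop , sym (linear-𝟎 rows) , λ _ _ → refl
combination-image rows (v ∷ vs) (false ∷ cs) with combination-image rows vs cs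
... | x , s , eq , zeros = x , skip s ,
  trans (cong₂ _⊕_ (scale-false (linear rows v)) eq) (⊕-identityˡ (linear rows x)) ,
  λ (_ , ind) x≡𝟎 → cong (false ∷_) (zeros ind x≡𝟎)
combination-image rows (v ∷ vs) (true ∷ cs) with combination-image rows vs cs
... | x , s , eq , zeros = v ⊕ x , use s ,
  trans (cong₂ _⊕_ (Vec.map-id (linear rows v)) eq) (sym (linear-⊕ rows v x)) ,
  λ (v∉ , _) v⊕x≡𝟎 → ⊥-elim (v∉ (subst (Span vs)
    (trans (sym (⊕-identityˡ x)) (trans (cong (_⊕ x) (sym v⊕x≡𝟎)) (⊕-cancelʳ v x))) s))

foldr-xor-↭ : {A : Set} (f : A → Bool) {xs ys : List A} → xs ↭ ys →
  foldr _xor_ false (List.map f xs) ≡ foldr _xor_ false (List.map f ys)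
foldr-xor-↭ f refl         = refl
foldr-xor-↭ f (prep x r)   = cong (f x xor_) (foldr-xor-↭ f r)
foldr-xor-↭ f (swap {ys = ys} x y r) = trans (cong (λ b → f x xor (f y xor b)) (foldr-xor-↭ f r))
  (trans (sym (xor-assoc (f x) (f y) rest)) (trans (cong (_xor rest) (xor-comm (f x) (f y))) (xor-assoc (f y) (f x) rest)))
  where rest = foldr _xor_ false (List.map f ys)
foldr-xor-↭ f (compose r s)  = trans (foldr-xor-↭ f r) (foldr-xor-↭ f s)

-- Zero coefficients contribute nothing and exclusive or ignores order, so any listing of the
-- support evaluates to the same function.
IsANF⇒evaluate : ∀ {f : 𝔽₂^ n → 𝔽₂} {g : Coefficients n} {ms} → IsANF g f → ms ↭ support g →
  ∀ x → f x ≡ evaluate ms x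
IsANF⇒evaluate {n} {g = g} {ms} anf r x = trans (anf x)
  (trans (sym (supported (subsets n))) (sym (foldr-xor-↭ (λ S → monomial S x) r)))
  where
  supported : ∀ Ss → foldr _xor_ false (List.map (λ S → monomial S x) (filterᵇ g Ss)) ≡
    foldr _xor_ false (List.map (λ S → g S ∧ monomial S x) Ss)
  supported [] = refl
  supported (S ∷ Ss) with g S
  ... | true  = cong (monomial S x xor_) (supported Ss)
  ... | false = supported Ss

encodeList-map : {A B : Set} {e : A → Tree} {e′ : B → Tree} (f : A → B) → (∀ x → e x ≡ e′ (f x)) →
  ∀ xs → encodeList e xs ≡ encodeList e′ (List.map f xs)
encodeList-map f eq []       = refl
encodeList-map f eq (x ∷ xs) = cong₂ node (eq x) (encodeList-map f eq xs)

inputᴸ : List (Subset n) → AffineBijection n → ⟦ list bits ⊗ list bits ⊗ bits ⟧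
inputᴸ ms A = List.map toList ms , List.map toList (toList matrix) , toList shift
  where open AffineBijection A using (matrix; shift)

encodeInput-inputᴸ : (ms : List (Subset n)) (A : AffineBijection n) → encodeInput ms A ≡ enc (inputᴸ ms A)
encodeInput-inputᴸ ms A = cong₂ (λ s t → node s (node t (encodeVector shift)))
  (encodeList-map toList (λ _ → refl) ms) (encodeList-map toList (λ _ → refl) (toList matrix))
  where open AffineBijection A using (matrix; shift)

module _ (A : AffineBijection n) (ms : List (Subset n)) where

  open AffineBijection A using (matrix; shift; bijective)

  constantFlat : Flat n (length (List.map (linear matrix) (directions ms)))
  constantFlat = record
    { point = shift
    ; basis = fromList (List.map (linear matrix) (directions ms))
    -- The combination is the linear image of some x in the span of the directions; injectivity of
    -- the affine map at x and 0 gives x = 0.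
    ; independent = λ cs eq → let x , _ , lin , zeros = combination-image matrix (directions ms) cs in
        zeros (directions-independent ms) (proj₁ bijective (cong (_⊕ shift)
          (trans (sym lin) (trans eq (sym (linear-𝟎 matrix))))))
    }

  constantFlat-constant : ∀ {f : 𝔽₂^ n → 𝔽₂} → (∀ x → f (apply A x) ≡ evaluate ms x) → ConstantOn f constantFlat
  constantFlat-constant {f} f≡ = evaluate ms 𝟎 , λ { _ (cs , refl) →
    let x , s , lin , _ = combination-image matrix (directions ms) cs in
    trans (cong f (trans (cong (shift ⊕_) lin) (⊕-comm shift (linear matrix x))))
      (trans (f≡ x) (directions-constant ms s)) }

  encodeFlat-constantFlat : encodeFlat constantFlat ≡ enc (flatᴸ (inputᴸ ms A))
  encodeFlat-constantFlat = cong (node (encodeVector shift)) (begin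
    encodeList encodeVector (toList (fromList (List.map (linear matrix) (directions ms))))
      ≡⟨ cong (encodeList encodeVector) (toList∘fromList _) ⟩
    encodeList encodeVector (List.map (linear matrix) (directions ms))
      ≡⟨ encodeList-map toList (λ _ → refl) (List.map (linear matrix) (directions ms)) ⟩
    encodeList (encodeList encodeBit) (List.map toList (List.map (linear matrix) (directions ms)))
      ≡⟨ cong (encodeList (encodeList encodeBit)) (images (directions ms)) ⟩
    encodeList (encodeList encodeBit) (List.map (λ v → List.map (_∙ᴸ v) rowsᴸ) (List.map toList (directions ms)))
      ≡⟨ cong (λ vs → encodeList (encodeList encodeBit) (List.map (λ v → List.map (_∙ᴸ v) rowsᴸ) vs))
           (directions-toList ms shift) ⟨
    encodeList (encodeList encodeBit) (proj₂ (flatᴸ (inputᴸ ms A))) ∎)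
    where
    open ≡-Reasoning
    rowsᴸ = List.map toList (toList matrix)
    image : ∀ {m} (rows : Vec (𝔽₂^ n) m) v →
      toList (linear rows v) ≡ List.map (_∙ᴸ toList v) (List.map toList (toList rows))
    image []         v = refl
    image (r ∷ rows) v = cong₂ _∷_ (sym (toList-∙ r v)) (image rows v)
    images : ∀ vs → List.map toList (List.map (linear matrix) vs) ≡
      List.map (λ v → List.map (_∙ᴸ v) rowsᴸ) (List.map toList vs)
    images []       = refl
    images (v ∷ vs) = cong₂ _∷_ (image matrix v) (images vs)

-- Real exponents

open import Data.Integer.Base as ℤ using (+_)
import Data.Integer.Properties as ℤ
open import Data.Rational.Base as ℚ using (ℚ; 0ℚ; 1ℚ; _/_; toℚᵘ; positive; nonNegative)
import Data.Rational.Properties as ℚ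
open import Data.Rational.Solver using (module +-*-Solver)
open import Data.Rational.Unnormalised.Base as ℚᵘ using (mkℚᵘ; *≡*; *<*)
import Data.Rational.Unnormalised.Properties as ℚᵘ

-- `_/_` reduces to lowest terms; identities between fractions are therefore checked among
-- unnormalised rationals, where the denominator stays visible.
toℚᵘ-/ : ∀ a q → toℚᵘ (+ a / suc q) ℚᵘ.≃ mkℚᵘ (+ a) q
toℚᵘ-/ a q = ℚ.toℚᵘ-fromℚᵘ (mkℚᵘ (+ a) q)

/-+ : ∀ a b q → + a / suc q ℚ.+ + b / suc q ≡ + (a + b) / suc q
/-+ a b q = ℚ.toℚᵘ-injective (begin
  toℚᵘ (+ a / suc q ℚ.+ + b / suc q)              ≈⟨ ℚ.toℚᵘ-homo-+ (+ a / suc q) (+ b / suc q) ⟩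
  toℚᵘ (+ a / suc q) ℚᵘ.+ toℚᵘ (+ b / suc q)      ≈⟨ ℚᵘ.+-cong (toℚᵘ-/ a q) (toℚᵘ-/ b q) ⟩
  mkℚᵘ (+ a) q ℚᵘ.+ mkℚᵘ (+ b) q                  ≈⟨ *≡* (trans (cong (ℤ._* Q) (sym (ℤ.*-distribʳ-+ Q (+ a) (+ b))))
                                                        (ℤ.*-assoc (+ (a + b)) Q Q)) ⟩
  mkℚᵘ (+ (a + b)) q                              ≈⟨ toℚᵘ-/ (a + b) q ⟨
  toℚᵘ (+ (a + b) / suc q)                        ∎)
  where
  open import Relation.Binary.Reasoning.Setoid ℚᵘ.≃-setoid
  Q = + suc q

ℕ→ℚ-/ : ∀ a q → + (a * suc q) / suc q ≡ ℕ→ℚ a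
ℕ→ℚ-/ a q = ℚ.toℚᵘ-injective (ℚᵘ.≃-trans (toℚᵘ-/ (a * suc q) q) (ℚᵘ.≃-trans
  (*≡* (trans (ℤ.*-identityʳ (+ (a * suc q))) (ℤ.pos-* a (suc q)))) (ℚᵘ.≃-sym (toℚᵘ-/ a 0))))

/-<-cancel : ∀ a q b → + a / suc q ℚ.< ℕ→ℚ b → a < b * suc q
/-<-cancel a q b lt with ℚᵘ.<-respʳ-≃ (toℚᵘ-/ b 0) (ℚᵘ.<-respˡ-≃ (toℚᵘ-/ a q) (ℚ.toℚᵘ-mono-< lt))
... | *<* l = ℤ.drop‿+<+ (subst₂ ℤ._<_ (ℤ.*-identityʳ (+ a)) (sym (ℤ.pos-* b (suc q))) l)

ℕ→ℚ-* : ∀ a b → ℕ→ℚ (a * b) ≡ ℕ→ℚ a ℚ.* ℕ→ℚ b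
ℕ→ℚ-* a b = ℚ.toℚᵘ-injective (begin
  toℚᵘ (ℕ→ℚ (a * b))                  ≈⟨ toℚᵘ-/ (a * b) 0 ⟩
  mkℚᵘ (+ (a * b)) 0                  ≈⟨ *≡* (cong (ℤ._* + 1) (ℤ.pos-* a b)) ⟩
  mkℚᵘ (+ a) 0 ℚᵘ.* mkℚᵘ (+ b) 0      ≈⟨ ℚᵘ.*-cong (toℚᵘ-/ a 0) (toℚᵘ-/ b 0) ⟨
  toℚᵘ (ℕ→ℚ a) ℚᵘ.* toℚᵘ (ℕ→ℚ b)      ≈⟨ ℚ.toℚᵘ-homo-* (ℕ→ℚ a) (ℕ→ℚ b) ⟨
  toℚᵘ (ℕ→ℚ a ℚ.* ℕ→ℚ b)              ∎)
  where open import Relation.Binary.Reasoning.Setoid ℚᵘ.≃-setoid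

ℕ→ℚ-^ : ∀ a k → ℕ→ℚ (a ^ k) ≡ ℕ→ℚ a ^ℚ k
ℕ→ℚ-^ a zero    = refl
ℕ→ℚ-^ a (suc k) = trans (ℕ→ℚ-* a (a ^ k)) (cong (ℕ→ℚ a ℚ.*_) (ℕ→ℚ-^ a k))

ℕ→ℚ-mono-< : ∀ {a b} → a < b → ℕ→ℚ a ℚ.< ℕ→ℚ b
ℕ→ℚ-mono-< {a} {b} a<b = ℚ.toℚᵘ-cancel-< (ℚᵘ.<-respˡ-≃ (ℚᵘ.≃-sym (toℚᵘ-/ a 0))
  (ℚᵘ.<-respʳ-≃ (ℚᵘ.≃-sym (toℚᵘ-/ b 0))
    (*<* (subst₂ ℤ._<_ (sym (ℤ.*-identityʳ (+ a))) (sym (ℤ.*-identityʳ (+ b))) (ℤ.+<+ a<b)))))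

ℕ→ℚ-mono-≤ : ∀ {a b} → a ≤ b → ℕ→ℚ a ℚ.≤ ℕ→ℚ b
ℕ→ℚ-mono-≤ {a} {b} a≤b with m≤n⇒m<n∨m≡n a≤b
... | inj₁ a<b  = ℚ.<⇒≤ (ℕ→ℚ-mono-< a<b)
... | inj₂ refl = ℚ.≤-refl

0≤ℕ→ℚ : ∀ a → 0ℚ ℚ.≤ ℕ→ℚ a
0≤ℕ→ℚ a = ℕ→ℚ-mono-≤ {0} {a} z≤n

*-mono-≤ℚ : ∀ {a b c d} → 0ℚ ℚ.≤ a → 0ℚ ℚ.≤ d → a ℚ.≤ b → c ℚ.≤ d → a ℚ.* c ℚ.≤ b ℚ.* d
*-mono-≤ℚ {a} {b} {c} {d} 0≤a 0≤d a≤b c≤d = ℚ.≤-trans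
  (ℚ.*-monoˡ-≤-nonNeg a {{nonNegative 0≤a}} c≤d)
  (ℚ.*-monoʳ-≤-nonNeg d {{nonNegative 0≤d}} a≤b)

0≤* : ∀ {a b} → 0ℚ ℚ.≤ a → 0ℚ ℚ.≤ b → 0ℚ ℚ.≤ a ℚ.* b
0≤* {a} 0≤a 0≤b = ℚ.≤-trans (ℚ.≤-reflexive (sym (ℚ.*-zeroʳ a))) (ℚ.*-monoˡ-≤-nonNeg a {{nonNegative 0≤a}} 0≤b)

0≤^ : ∀ {a} → 0ℚ ℚ.≤ a → ∀ k → 0ℚ ℚ.≤ a ^ℚ k
0≤^ 0≤a zero    = 0≤ℕ→ℚ 1
0≤^ 0≤a (suc k) = 0≤* 0≤a (0≤^ 0≤a k)

^-mono-≤ : ∀ {a b} → 0ℚ ℚ.≤ a → a ℚ.≤ b → ∀ k → a ^ℚ k ℚ.≤ b ^ℚ k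
^-mono-≤ 0≤a a≤b zero    = ℚ.≤-refl
^-mono-≤ 0≤a a≤b (suc k) =
  *-mono-≤ℚ 0≤a (0≤^ (ℚ.≤-trans 0≤a a≤b) k) a≤b (^-mono-≤ 0≤a a≤b k)

^-distrib-* : ∀ a b k → (a ℚ.* b) ^ℚ k ≡ a ^ℚ k ℚ.* b ^ℚ k
^-distrib-* a b zero    = refl
^-distrib-* a b (suc k) = trans (cong (a ℚ.* b ℚ.*_) (^-distrib-* a b k))
  (solve 4 (λ a b x y → a :* b :* (x :* y) := a :* x :* (b :* y)) refl a b (a ^ℚ k) (b ^ℚ k))
  where open +-*-Solver

module _ {n T : ℕ} {ε : Cut} (ε-real : IsReal ε) (ε<2 : ε <ᴿ fromℕ 2)
         (T≈ : fromℕ T ≈ᴿ n ^ᴿ (fromℕ 3 -ᴿ ε)) where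

  open IsReal ε-real

  -- As ε < 2, the exponent 1 lies below 3 - ε. If T were less than n, the rational T would thus
  -- belong to the lower cut of n^(3-ε), that is, of T itself.
  n≤T : n ≤ T
  n≤T with n ≤? T
  ... | yes n≤T = n≤T
  ... | no  n≰T = ⊥-elim (ℚ.<-irrefl refl (Equivalence.from (proj₁ (T≈ (ℕ→ℚ T))) (inj₂ (0 , 0 , one , small))))
    where
    q   = proj₁ ε<2
    one : lower (fromℕ 3 -ᴿ ε) (+ 1 / 1)
    one = 1ℚ ℚ.+ q , q , ℚ.+-monoʳ-< 1ℚ (proj₂ (proj₂ ε<2)) , proj₁ (proj₂ ε<2) ,
      solve 1 (λ q → con 1ℚ := con 1ℚ :+ q :- q) refl q
      where open +-*-Solver
    small : (ℕ→ℚ T ^ℚ 1) ℚ.< ℕ→ℚ (n ^ 1)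
    small = subst₂ ℚ._<_ (sym (ℚ.*-identityʳ (ℕ→ℚ T))) (cong ℕ→ℚ (sym (*-identityʳ n)))
      (ℕ→ℚ-mono-< (≰⇒> n≰T))

  lower<upper : ∀ {a b} → lower ε a → upper ε b → a ℚ.< b
  lower<upper {a} {b} la ub with ℚ.<-cmp a b
  ... | tri< a<b _ _ = a<b
  ... | tri≈ _ refl _ = ⊥-elim (disjoint a (la , ub))
  ... | tri> _ _ b<a = ⊥-elim (disjoint b (Equivalence.from (lower-rounded b) (a , b<a , la) , ub))

  -- Otherwise T would exceed n to the power `suc r / suc q`, which is 3 - `suc p / suc q` and lies
  -- above 3 - ε; so T would belong to its own upper cut. Positivity of that numerator follows from
  -- ε < 2.
  T^≤ : ∀ p q → lower ε (+ suc p / suc q) → n ^ suc p * T ^ suc q ≤ n ^ (3 * suc q)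
  T^≤ p q low = begin
    n ^ suc p * T ^ suc q ≤⟨ *-monoʳ-≤ (n ^ suc p) (≮⇒≥ T^≮) ⟩
    n ^ suc p * n ^ suc r ≡⟨ ^-distribˡ-+-* n (suc p) (suc r) ⟨
    n ^ (suc p + suc r)   ≡⟨ cong (n ^_) p+r≡ ⟩
    n ^ (3 * suc q)       ∎
    where
    open ≤-Reasoning
    p< : suc p < 3 * suc q
    p< = <-≤-trans
      (/-<-cancel (suc p) q 2 (ℚ.<-trans (lower<upper low (proj₁ (proj₂ ε<2))) (proj₂ (proj₂ ε<2))))
      (*-monoˡ-≤ (suc q) {2} {3} (s≤s (s≤s z≤n)))
    r = proj₁ (m≤n⇒∃[o]m+o≡n p<)
    p+r≡ : suc p + suc r ≡ 3 * suc q
    p+r≡ = trans (+-suc (suc p) r) (proj₂ (m≤n⇒∃[o]m+o≡n p<))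
    up : upper (fromℕ 3 -ᴿ ε) (+ suc r / suc q)
    -- Roundedness gives b strictly between the fraction and ε, as the upper cut of the difference
    -- needs b + `suc r / suc q` strictly above 3.
    up with b , p/q<b , lb ← Equivalence.to (lower-rounded (+ suc p / suc q)) low =
      b ℚ.+ + suc r / suc q , b ,
      subst (ℚ._< b ℚ.+ + suc r / suc q)
        (trans (/-+ (suc p) (suc r) q) (trans (cong (λ m → + m / suc q) p+r≡) (ℕ→ℚ-/ 3 q)))
        (ℚ.+-monoˡ-< (+ suc r / suc q) p/q<b) ,
      lb , solve 2 (λ b x → x := b :+ x :- b) refl b (+ suc r / suc q)
      where open +-*-Solver
    T^≮ : ¬ n ^ suc r < T ^ suc q
    T^≮ small = ℚ.<-irrefl refl (Equivalence.from (proj₂ (T≈ (ℕ→ℚ T)))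
      (ℕ→ℚ-mono-< (positiveBase T small) , r , q , up ,
       subst (ℕ→ℚ (n ^ suc r) ℚ.<_) (ℕ→ℚ-^ T (suc q)) (ℕ→ℚ-mono-< small)))
      where
      positiveBase : ∀ t → n ^ suc r < t ^ suc q → 0 < t
      positiveBase (suc t) _ = s≤s z≤n

  -- Behind this is n^ε · T = n³. Raising to the power `suc q` clears the denominator of an exponent
  -- below ε that witnesses a < n^ε, and `T^≤` bounds the corresponding power of T.
  n^ε*T≤ : ∀ {a} → 0ℚ ℚ.≤ a → lower (n ^ᴿ ε) a → (1 ≤ n) × (a ℚ.* ℕ→ℚ T ℚ.≤ ℕ→ℚ (n ^ 3))
  n^ε*T≤ 0≤a (inj₁ a<0) = ⊥-elim (ℚ.<-irrefl refl (ℚ.<-≤-trans a<0 0≤a))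
  n^ε*T≤ {a} 0≤a (inj₂ (p , q , low , a^<)) = 1≤n , ℚ.≮⇒≥ λ n³<aT →
    ℚ.<-irrefl refl (begin-strict
      ℕ→ℚ (n ^ (3 * suc q))                     ≡⟨ cong ℕ→ℚ (sym (^-*-assoc n 3 (suc q))) ⟩
      ℕ→ℚ ((n ^ 3) ^ suc q)                     ≡⟨ ℕ→ℚ-^ (n ^ 3) (suc q) ⟩
      ℕ→ℚ (n ^ 3) ^ℚ suc q                      ≤⟨ ^-mono-≤ (0≤ℕ→ℚ (n ^ 3)) (ℚ.<⇒≤ n³<aT) (suc q) ⟩
      (a ℚ.* ℕ→ℚ T) ^ℚ suc q                    ≡⟨ ^-distrib-* a (ℕ→ℚ T) (suc q) ⟩
      a ^ℚ suc q ℚ.* ℕ→ℚ T ^ℚ suc q             ≡⟨ cong (a ^ℚ suc q ℚ.*_) (ℕ→ℚ-^ T (suc q)) ⟨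
      a ^ℚ suc q ℚ.* ℕ→ℚ (T ^ suc q)            <⟨ ℚ.*-monoˡ-<-pos (ℕ→ℚ (T ^ suc q)) {{positive (ℕ→ℚ-mono-< 0<T^)}} a^< ⟩
      ℕ→ℚ (n ^ suc p) ℚ.* ℕ→ℚ (T ^ suc q)       ≡⟨ ℕ→ℚ-* (n ^ suc p) (T ^ suc q) ⟨
      ℕ→ℚ (n ^ suc p * T ^ suc q)               ≤⟨ ℕ→ℚ-mono-≤ (T^≤ p q low) ⟩
      ℕ→ℚ (n ^ (3 * suc q))                     ∎)
    where
    open ℚ.≤-Reasoning
    positive-n : ∀ m → ℕ→ℚ 0 ℚ.< ℕ→ℚ (m ^ suc p) → 1 ≤ m
    positive-n zero    lt = ⊥-elim (ℚ.<-irrefl refl lt)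
    positive-n (suc m) _  = s≤s z≤n
    1≤n : 1 ≤ n
    1≤n = positive-n n (ℚ.≤-<-trans (0≤^ 0≤a (suc q)) a^<)
    0<T^ : 0 < T ^ suc q
    0<T^ = m^n>0 T {{ℕ.>-nonZero (≤-trans 1≤n n≤T)}} (suc q)

  -- A rational below the left-hand side has the form (4/15) x - b with x below the root and b > 3,
  -- so it suffices that (4/15) x never exceeds k + 3.
  dimension-bound : ∀ k → 32 * (n * (n * n)) ≤ 675 * (T * ((k + 3) * (k + 3))) →
    (+ 4 / 15) ·ᴿ (√ ((+ 2 / 3) ·ᴿ (n ^ᴿ ε))) -ᴿ fromℕ 3 ≤ᴿ fromℕ k
  dimension-bound k bound _ (_ , b , (x , x∈ , refl) , 3<b , refl) = begin-strict
    + 4 / 15 ℚ.* x ℚ.- b                ≤⟨ ℚ.+-monoˡ-≤ (ℚ.- b) (ℚ.≮⇒≥ (small x∈)) ⟩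
    ℕ→ℚ (k + 3) ℚ.- b                   <⟨ ℚ.+-monoʳ-< (ℕ→ℚ (k + 3)) (ℚ.neg-antimono-< 3<b) ⟩
    ℕ→ℚ (k + 3) ℚ.- ℕ→ℚ 3               ≡⟨ cong (ℚ._- ℕ→ℚ 3) (/-+ k 3 0) ⟨
    ℕ→ℚ k ℚ.+ ℕ→ℚ 3 ℚ.- ℕ→ℚ 3           ≡⟨ solve 2 (λ x y → x :+ y :- y := x) refl (ℕ→ℚ k) (ℕ→ℚ 3) ⟩
    ℕ→ℚ k                               ∎
    where
    open ℚ.≤-Reasoning
    open +-*-Solver
    K = k + 3
    c = + 4 / 15
    d = + 2 / 3
    small : ∀ {x} → lower (√ (d ·ᴿ (n ^ᴿ ε))) x → ¬ ℕ→ℚ K ℚ.< c ℚ.* x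
    small {x} (inj₁ x<0) K<cx = ℚ.<-irrefl refl (ℚ.≤-<-trans (0≤ℕ→ℚ K)
      (ℚ.<-trans K<cx (subst (c ℚ.* x ℚ.<_) (ℚ.*-zeroʳ c) (ℚ.*-monoʳ-<-pos c x<0))))
    small {x} (inj₂ (a , a∈ , xx≡)) K<cx = ℚ.<-irrefl refl (begin-strict
      ℕ→ℚ (675 * (T * (K * K)))                        ≡⟨ trans (ℕ→ℚ-* 675 (T * (K * K))) (cong (ℕ→ℚ 675 ℚ.*_)
                                                           (trans (ℕ→ℚ-* T (K * K)) (cong (ℕ→ℚ T ℚ.*_) (ℕ→ℚ-* K K)))) ⟩
      ℕ→ℚ 675 ℚ.* (ℕ→ℚ T ℚ.* (ℕ→ℚ K ℚ.* ℕ→ℚ K))        <⟨ ℚ.*-monoʳ-<-pos (ℕ→ℚ 675) (ℚ.*-monoʳ-<-pos (ℕ→ℚ T) {{positive 0<T}} K²<) ⟩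
      ℕ→ℚ 675 ℚ.* (ℕ→ℚ T ℚ.* (c ℚ.* x ℚ.* (c ℚ.* x)))  ≡⟨ collect (ℕ→ℚ 675) (ℕ→ℚ T) c x ⟩
      ℕ→ℚ 675 ℚ.* (c ℚ.* c) ℚ.* (x ℚ.* x ℚ.* ℕ→ℚ T)    ≡⟨ cong (λ y → ℕ→ℚ 675 ℚ.* (c ℚ.* c) ℚ.* (y ℚ.* ℕ→ℚ T)) xx≡ ⟩
      ℕ→ℚ 675 ℚ.* (c ℚ.* c) ℚ.* (d ℚ.* a ℚ.* ℕ→ℚ T)    ≡⟨ solve 4 (λ u d a t → u :* (d :* a :* t) := u :* d :* (a :* t)) refl
                                                            (ℕ→ℚ 675 ℚ.* (c ℚ.* c)) d a (ℕ→ℚ T) ⟩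
      -- The constant 675 · (4/15)² · (2/3) evaluates to 32.
      ℕ→ℚ 32 ℚ.* (a ℚ.* ℕ→ℚ T)                         ≤⟨ ℚ.*-monoˡ-≤-nonNeg (ℕ→ℚ 32) aT≤ ⟩
      ℕ→ℚ 32 ℚ.* ℕ→ℚ (n ^ 3)                           ≡⟨ ℕ→ℚ-* 32 (n ^ 3) ⟨
      ℕ→ℚ (32 * n ^ 3)                                 ≡⟨ cong (λ y → ℕ→ℚ (32 * (n * (n * y)))) (*-identityʳ n) ⟩
      ℕ→ℚ (32 * (n * (n * n)))                         ≤⟨ ℕ→ℚ-mono-≤ bound ⟩
      ℕ→ℚ (675 * (T * (K * K)))                        ∎)
      where
      0<cx : 0ℚ ℚ.< c ℚ.* x
      0<cx = ℚ.≤-<-trans (0≤ℕ→ℚ K) K<cx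
      K²< : ℕ→ℚ K ℚ.* ℕ→ℚ K ℚ.< c ℚ.* x ℚ.* (c ℚ.* x)
      K²< = ℚ.≤-<-trans (ℚ.*-monoˡ-≤-nonNeg (ℕ→ℚ K) {{nonNegative (0≤ℕ→ℚ K)}} (ℚ.<⇒≤ K<cx))
        (ℚ.*-monoˡ-<-pos (c ℚ.* x) {{positive 0<cx}} K<cx)
      0≤x : 0ℚ ℚ.≤ x
      0≤x = ℚ.*-cancelˡ-≤-pos c (ℚ.≤-trans (ℚ.≤-reflexive (ℚ.*-zeroʳ c)) (ℚ.<⇒≤ 0<cx))
      0≤a : 0ℚ ℚ.≤ a
      0≤a = ℚ.*-cancelˡ-≤-pos d (ℚ.≤-trans (ℚ.≤-reflexive (ℚ.*-zeroʳ d))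
        (ℚ.≤-trans (0≤* 0≤x 0≤x) (ℚ.≤-reflexive xx≡)))
      aT≤ = proj₂ (n^ε*T≤ 0≤a a∈)
      0<T : 0ℚ ℚ.< ℕ→ℚ T
      0<T = ℕ→ℚ-mono-< (≤-trans (proj₁ (n^ε*T≤ 0≤a a∈)) n≤T)
      collect : ∀ u t c x → u ℚ.* (t ℚ.* (c ℚ.* x ℚ.* (c ℚ.* x))) ≡ u ℚ.* (c ℚ.* c) ℚ.* (x ℚ.* x ℚ.* t)
      collect = solve 4 (λ u t c x → u :* (t :* (c :* x :* (c :* x))) := u :* (c :* c) :* (x :* x :* t)) refl

constantFlat-dimension : ∀ {ε : Cut} {T} (A : AffineBijection n) (ms : List (Subset n)) →
  IsReal ε → ε <ᴿ fromℕ 2 → fromℕ T ≈ᴿ n ^ᴿ (fromℕ 3 -ᴿ ε) → length ms ≡ T →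
  (+ 4 / 15) ·ᴿ (√ ((+ 2 / 3) ·ᴿ (n ^ᴿ ε))) -ᴿ fromℕ 3 ≤ᴿ
    fromℕ (length (List.map (linear (AffineBijection.matrix A)) (directions ms)))
constantFlat-dimension {n} {ε} A ms real ε<2 T≈ refl =
  subst (λ k → (+ 4 / 15) ·ᴿ (√ ((+ 2 / 3) ·ᴿ (n ^ᴿ ε))) -ᴿ fromℕ 3 ≤ᴿ fromℕ k) (sym (length-map (linear (AffineBijection.matrix A)) (directions ms)))
    (dimension-bound {n} {length ms} {ε} real ε<2 T≈ (length (directions ms))
      (directions-dimension ms (n≤T {n} {length ms} {ε} real ε<2 T≈)))

FP⇒polynomial : ∀ {σ τ} {f : ⟦ σ ⟧ → ⟦ τ ⟧} → FP f → ∃ λ P → ∃ λ c → ∃ λ d →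
  ∀ x → ∃ λ t → (P ∶ enc x ⇓ enc (f x) within t) × t ≤ c * size (enc x) ^ d
FP⇒polynomial F with c , d , time≤ ← eval-≤-monomial (FP.time F) = FP.prog F , c , d , λ x →
  let t , run , t≤ = FP.runs F x in
  t , run , ≤-trans t≤ (≤-trans (eval-mono (FP.time F) (wt≤size x))
    (time≤ _ (≤-trans (1≤wt x) (wt≤size x))))

abstract
  -- Only the existence of a program matters from here on; `abstract` keeps the concrete program and
  -- its bounds from unfolding.
  flat-polynomial : ∃ λ P → ∃ λ c → ∃ λ d →
    ∀ x → ∃ λ t → (P ∶ enc x ⇓ enc (flatᴸ x) within t) × t ≤ c * size (enc x) ^ d
  flat-polynomial = FP⇒polynomial flatᶠ

theorem5 : (∀ (n : ℕ) (ε : Cut) (f : 𝔽₂^ n → 𝔽₂) (T : ℕ) →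
    IsReal ε → fromℕ 0 <ᴿ ε → ε <ᴿ fromℕ 2 →
    HasThickness f T → fromℕ T ≈ᴿ n ^ᴿ (fromℕ 3 -ᴿ ε) →
    ∃ λ (k : ℕ) → Σ (Flat n k) λ E →
    ((+ 4 / 15) ·ᴿ (√ ((+ 2 / 3) ·ᴿ (n ^ᴿ ε))) -ᴿ fromℕ 3 ≤ᴿ fromℕ k) ×
    ConstantOn f E)
    ×
    (∃ λ (P : Program) → ∃ λ (c : ℕ) → ∃ λ (d : ℕ) →
    ∀ (n : ℕ) (ε : Cut) (f : 𝔽₂^ n → 𝔽₂) (T : ℕ) →
    IsReal ε → fromℕ 0 <ᴿ ε → ε <ᴿ fromℕ 2 →
    HasThickness f T → fromℕ T ≈ᴿ n ^ᴿ (fromℕ 3 -ᴿ ε) →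
    (A : AffineBijection n) (g : Coefficients n) (ms : List (Subset n)) →
    IsANF g (f ∘ apply A) → length (support g) ≡ T → ms ↭ support g →
    ∃ λ (k : ℕ) → Σ (Flat n k) λ E → ∃ λ (t : ℕ) →
    (P ∶ encodeInput ms A ⇓ encodeFlat E within t) ×
    (t ≤ c * size (encodeInput ms A) ^ d) ×
    ((+ 4 / 15) ·ᴿ (√ ((+ 2 / 3) ·ᴿ (n ^ᴿ ε))) -ᴿ fromℕ 3 ≤ᴿ fromℕ k) ×
    ConstantOn f E)
theorem5 =
  -- The bijection attaining the thickness, with the support of its normal form as list of
  -- monomials, is itself an input of the algorithm, whose flat proves existence.
  (λ n ε f T real _ ε<2 ((A , g , anf , |g|) , _) T≈ →
    _ , constantFlat A (support g) ,
    constantFlat-dimension {n} {ε} {T} A (support g) real ε<2 T≈ |g| ,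
    constantFlat-constant A (support g) (IsANF⇒evaluate anf ↭-refl)) ,
  P , c , d , λ n ε f T real _ ε<2 _ T≈ A g ms anf |g| r →
    let t , runs , t≤ = run (inputᴸ ms A) in
    _ , constantFlat A ms , t ,
    subst₂ (λ x y → P ∶ x ⇓ y within t)
      (sym (encodeInput-inputᴸ ms A)) (sym (encodeFlat-constantFlat A ms)) runs ,
    subst (λ x → t ≤ c * size x ^ d) (sym (encodeInput-inputᴸ ms A)) t≤ ,
    constantFlat-dimension {n} {ε} {T} A ms real ε<2 T≈ (trans (↭-length r) |g|) ,
    constantFlat-constant A ms (IsANF⇒evaluate anf r)
  where
  P   = proj₁ flat-polynomial
  c   = proj₁ (proj₂ flat-polynomial)
  d   = proj₁ (proj₂ (proj₂ flat-polynomial))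
  run = proj₂ (proj₂ (proj₂ flat-polynomial))
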